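{- If $q=18n+1$ is a prime power with $n$ odd, then there exists a $(\mathbb Z_3\times\mathbb F_q,\{3^{12n+1},6^{3n}\},3)$-PDF which is the base (starter) parallel class of an HS$(2,\{3,6\},3q)$.
   Context: For a subset $B$ of an additive group, $\Delta B$ is the multiset of differences $b-b'$ over ordered pairs of distinct elements of $B$. A $(\Gamma,K,\lambda)$-PDF is a collection of subsets of $\Gamma$ partitioning $\Gamma$, with multiset of sizes $K$ (exponential notation: $\{k_1^{\mu_1},\dots\}$ means $k_i$ with multiplicity $\mu_i$), such that the multiset union of the $\Delta B$ equals $\lambda$ copies of $\Gamma\setminus\{0\}$. A linear space S$(2,K,v)$: $v$ points, blocks with sizes in $K$ (each element of $K$ occurring), every pair of points in exactly one block; a resolution partitions the blocks into parallel classes each partitioning the points. A PDF $\mathcal P$ in $\Gamma$ with $|\Gamma|=v$ is the base parallel class of an HS$(2,K,v)$ if $\{\mathcal P+x\mid x\in\Gamma\}$ is the set of parallel classes of a resolved S$(2,K,v)$ with point set $\Gamma$ (so the translations act sharply transitively on points and transitively on parallel classes). -}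

module Defs where

open import Level using (0ℓ)
open import Data.Nat using (ℕ; suc; _^_; _≥_)
open import Data.Nat.Primality using (Prime)
open import Data.Fin using (Fin; zero; suc)
open import Data.Product.Properties using (≡-dec)
open import Data.List.Relation.Binary.Permutation.Propositional using (_↭_)
import Data.Fin.Properties as FinP
open import Data.Product using (Σ; ∃; ∃-syntax; _×_; _,_; proj₁; proj₂)
open import Data.List using (List; []; _∷_; map; _++_; concatMap; filter; length)
open import Data.Nat.ListAction using (sum)
open import Data.List.Membership.Propositional using (_∈_)
open import Function.Bundles using (_↔_; Inverse)
open import Relation.Binary.PropositionalEquality using (_≡_; _≢_; refl; sym; trans; cong)
open import Relation.Binary.Definitions using (DecidableEquality)
open import Relation.Nullary using (yes; no; ¬_)
open import Algebra.Structures using (IsCommutativeRing)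

IsPrimePower : ℕ → Set
IsPrimePower q = ∃[ p ] ∃[ k ] (Prime p × k ≥ 1 × q ≡ p ^ k)

record FiniteField (q : ℕ) : Set₁ where
  infixl 6 _+_
  infixl 7 _*_
  field
    Carrier  : Set
    _+_ _*_  : Carrier → Carrier → Carrier
    -_       : Carrier → Carrier
    0# 1#    : Carrier
    isCommutativeRing : IsCommutativeRing _≡_ _+_ _*_ -_ 0# 1#
    0≢1      : 0# ≢ 1#
    inverse  : ∀ x → x ≢ 0# → ∃[ y ] (x * y ≡ 1#)
    card     : Fin q ↔ Carrier

  _≟_ : DecidableEquality Carrier
  x ≟ y with FinP._≟_ (Inverse.from card x) (Inverse.from card y)
  ... | yes e = yes (trans (sym (Inverse.strictlyInverseˡ card x))
                      (trans (cong (Inverse.to card) e) (Inverse.strictlyInverseˡ card y)))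
  ... | no ne = no (λ e → ne (cong (Inverse.from card) e))

_+₃_ : Fin 3 → Fin 3 → Fin 3
zero +₃ b = b
suc zero +₃ zero = suc zero
suc zero +₃ suc zero = suc (suc zero)
suc zero +₃ suc (suc zero) = zero
suc (suc zero) +₃ zero = suc (suc zero)
suc (suc zero) +₃ suc zero = zero
suc (suc zero) +₃ suc (suc zero) = suc zero

-₃_ : Fin 3 → Fin 3
-₃ zero = zero
-₃ suc zero = suc (suc zero)
-₃ suc (suc zero) = suc zero

-- The additive group Γ = Z_3 × F_q, and PDF / HS notions in it.
-- Subsets of Γ are represented as lists; a family of subsets as a list of lists.

module Group3 {q : ℕ} (F : FiniteField q) where
  open FiniteField F

  Γ : Set
  Γ = Fin 3 × Carrier

  infixl 6 _⊕_ _⊖_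

  _⊕_ : Γ → Γ → Γ
  (a , x) ⊕ (b , y) = (a +₃ b) , (x + y)

  _⊖_ : Γ → Γ → Γ
  (a , x) ⊖ (b , y) = (a +₃ (-₃ b)) , (x + (- y))

  0Γ : Γ
  0Γ = zero , 0#

  _≟Γ_ : DecidableEquality Γ
  _≟Γ_ = ≡-dec FinP._≟_ _≟_

  count : Γ → List Γ → ℕ
  count g xs = length (filter (_≟Γ g) xs)

  Δ : List Γ → List Γ
  Δ []       = []
  Δ (x ∷ xs) = map (x ⊖_) xs ++ map (_⊖ x) xs ++ Δ xs

  _+ₛ_ : List Γ → Γ → List Γ
  B +ₛ x = map (_⊕ x) B

  _≈ₛ_ : List Γ → List Γ → Set
  A ≈ₛ B = ∀ g → (g ∈ A → g ∈ B) × (g ∈ B → g ∈ A)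

  Partitions : List (List Γ) → Set
  Partitions P = ∀ g → sum (map (count g) P) ≡ 1

  IsPDF : List (List Γ) → List ℕ → ℕ → Set
  IsPDF P K lam =
    Partitions P ×
    (map length P ↭ K) ×
    (∀ g → g ≢ 0Γ → count g (concatMap Δ P) ≡ lam) ×
    count 0Γ (concatMap Δ P) ≡ 0

  -- {P + x | x ∈ Γ} is the set of parallel classes of a resolved S(2,K,|Γ|)
  -- on point set Γ, whose blocks are the sets B + x (B ∈ P, x ∈ Γ).
  IsHSBase : List (List Γ) → Set
  IsHSBase P =
    (∀ u v → u ≢ v → ∃[ B ] ∃[ x ] (B ∈ P × u ∈ B +ₛ x × v ∈ B +ₛ x)) ×
    (∀ u v → u ≢ v → ∀ B x B′ y → B ∈ P → B′ ∈ P →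
       u ∈ B +ₛ x → v ∈ B +ₛ x → u ∈ B′ +ₛ y → v ∈ B′ +ₛ y →
       (B +ₛ x) ≈ₛ (B′ +ₛ y)) ×
    -- resolution: the parallel classes P + x partition the blocks,
    -- i.e. two classes sharing a block are the same class
    (∀ B x B′ y → B ∈ P → B′ ∈ P → (B +ₛ x) ≈ₛ (B′ +ₛ y) →
       ∀ C → C ∈ P → ∃[ C′ ] (C′ ∈ P × (C +ₛ x) ≈ₛ (C′ +ₛ y)))

{-# OPTIONS --safe #-}

-- Let ε be a primitive cube root of unity in F. A starter class invariant under Z₃ × 0 consists of
-- Z₃ × 0 itself and of the three vertical translates of each of 4n triples and n hexads. It suffices
-- that the differences of these base blocks cover all (d , e) with e ≠ 0, and that their second
-- coordinates cover all e ≠ 0: the sizes leave no room for repetitions, so everything is covered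
-- exactly once, which also makes the block through two points unique.
--
-- All base blocks consist of multiples of 1, ε, ε². For a suitable y and for s running through the
-- sixth powers modulo ⟨ε⟩, the hexads are {(0 , εⁱ s)} ∪ {(1 , εⁱ y s)} if y is not a cube, and
-- {(i , εⁱ s)} ∪ {(i , εⁱ y s)} if y is a cube. The triples are {(0 , εⁱ t)} and {(± i , εⁱ t)}; the
-- sign, chosen separately on each coset of the sixth powers, turns the level 1 differences
-- ± (ε - 1) εⁱ t into those missed by the hexads. This works as soon as y - 1, y - ε, y - ε² lie in
-- different cosets of the cubes and y is not a sixth power.
--
-- Such y exist. The y satisfying the coset condition come from the x for which x and 1 + x lie in the
-- two different nontrivial cosets of the cubes. If all these y were sixth powers, there would be at
-- most 3n - 3 such x, which makes two of the nine cyclotomic numbers of order three too small: a pair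
-- u ≠ v in the same cell is determined by v / u and (1 + v) / (1 + u), two different nontrivial cubes,
-- so with f = (q - 1) / 3 the squares of these numbers sum to at most q + (f - 1)(f - 2), and
-- convexity gives a contradiction.

module Submission where

open import Defs
open import Algebra.Bundles using (CommutativeRing; RawRing)
import Algebra.Solver.Ring as RingSolver
open import Algebra.Solver.Ring.AlmostCommutativeRing
  using (AlmostCommutativeRing; fromCommutativeRing; -raw-almostCommutative⟶; _-Raw-AlmostCommutative⟶_)
open import Data.Empty using (⊥; ⊥-elim)
open import Data.Fin using (Fin; zero; suc; toℕ)
import Data.Fin.Properties as Fin
open import Data.List using (List; []; _∷_; _++_; map; concatMap; filter; length; foldr; concat; replicate; allFin; cartesianProduct)
open import Data.List.Membership.Propositional using (_∈_; _∉_; find; lose)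
open import Data.List.Membership.Propositional.Properties
  using (∈-∃++; ∈-++⁺ˡ; ∈-++⁺ʳ; ∈-++⁻; ∈-concatMap⁺; ∈-concatMap⁻; ∈-map⁺; ∈-map⁻; ∈-filter⁺; ∈-filter⁻; ∈-allFin;
         ∈-cartesianProduct⁺; ∈-cartesianProduct⁻; ∈-concat⁺′)
import Data.List.Membership.DecPropositional as DecMembership
open import Data.List.Properties
  using (length-map; length-++; length-tabulate; ++-identityʳ; filter-none; filter-++; map-++; map-∘; map-cong; map-concatMap;
         concatMap-cong; map-replicate; map-id; ∷-injective)
open import Data.List.Relation.Binary.Permutation.Propositional
  using (_↭_; ↭-sym; ↭-trans; ↭-refl; prep; ↭⇒↭ₛ; ↭-reflexive)
open import Data.List.Relation.Binary.Permutation.Propositional.Properties using (shift; ↭-length; ∈-resp-↭; filter-↭)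
import Data.List.Relation.Binary.Permutation.Setoid.Properties as PermS
open import Data.List.Relation.Binary.Subset.Propositional using (_⊆_)
open import Data.List.Relation.Unary.All as All using (All; []; _∷_)
import Data.List.Relation.Unary.All.Properties as All
open import Data.List.Relation.Unary.AllPairs using ([]; _∷_)
open import Data.List.Relation.Unary.Any as Any using (here; there)
open import Data.List.Relation.Unary.Unique.Propositional using (Unique)
import Data.List.Relation.Unary.Unique.Propositional.Properties as Unique
open import Data.Maybe using (Maybe; just; nothing)
open import Data.Nat as ℕ using (ℕ; zero; suc; _∸_; _≤_; s≤s; z≤n)
open import Data.Nat.ListAction using (sum)
open import Data.Nat.ListAction.Properties using (sum-++)
import Data.Nat.Properties as ℕ
open import Data.Nat.Tactic.RingSolver using (solve-∀)
open import Data.Product using (∃; ∃-syntax; _×_; _,_; proj₁; proj₂)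
open import Data.Product.Properties using (≡-dec)
open import Data.Sum using (_⊎_; inj₁; inj₂; [_,_]′)
open import Data.Vec as Vec using (Vec; []; _∷_)
open import Function using (const; id)
open import Function.Bundles using (Inverse)
open import Level using (Level; 0ℓ)
open import Relation.Binary.Definitions using (DecidableEquality; tri<; tri≈; tri>)
open import Relation.Binary.PropositionalEquality
open import Relation.Nullary using (Dec; yes; no; ¬_; contradiction)
open import Relation.Nullary.Decidable using (¬?; _×-dec_; _→-dec_; from-yes; decidable-stable)
open import Relation.Unary using (Pred; Decidable)

-- Repetition-free lists: pigeonhole and counting

module ListLemmas where
  open import Data.Nat using (_+_; _*_; z<s)
  open import Data.Nat.Properties
    using (≤-trans; ≤-reflexive; ≤-antisym; m≤m+n; m<m+n; <⇒≱; +-mono-≤; +-monoˡ-≤; +-monoʳ-≤; +-cancelˡ-≤; +-cancelʳ-≤)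

  private variable
    a b : Level
    A : Set a
    B : Set b

  unique-⊆-↭ : {xs ys : List A} → Unique xs → xs ⊆ ys → ∃[ zs ] (ys ↭ xs ++ zs)
  unique-⊆-↭ {xs = []} {ys} _ _ = ys , ↭-refl
  unique-⊆-↭ {xs = x ∷ xs} {ys} (x∉xs ∷ xs!) xs⊆ys
    with ls , rs , refl ← ∈-∃++ (xs⊆ys (here refl)) = zs , ↭-trans (shift x ls rs) (prep x perm)
    where
    rest : xs ⊆ ls ++ rs
    rest {y} y∈xs with ∈-++⁻ ls (xs⊆ys (there y∈xs))
    ... | inj₁ y∈ls = ∈-++⁺ˡ y∈ls
    ... | inj₂ (here y≡x) = ⊥-elim (All.lookup x∉xs y∈xs (sym y≡x))
    ... | inj₂ (there y∈rs) = ∈-++⁺ʳ ls y∈rs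
    zs = proj₁ (unique-⊆-↭ xs! rest)
    perm = proj₂ (unique-⊆-↭ xs! rest)

  unique-⊆-length : {xs ys : List A} → Unique xs → xs ⊆ ys → length xs ≤ length ys
  unique-⊆-length {xs = xs} {ys} xs! xs⊆ys with zs , p ← unique-⊆-↭ xs! xs⊆ys =
    ≤-trans (m≤m+n (length xs) (length zs))
      (≤-reflexive (sym (trans (↭-length p) (length-++ xs))))

  -- Pigeonhole: the distinct entries of `xs` use up different positions of `ys`, and the length
  -- bound leaves none over. This turns a covering of the right size into an exact one.
  unique-⊆-≥⇒↭ : {xs ys : List A} → Unique xs → xs ⊆ ys → length ys ≤ length xs → ys ↭ xs
  unique-⊆-≥⇒↭ {xs = xs} {ys} xs! xs⊆ys ys≤xs with unique-⊆-↭ xs! xs⊆ys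
  ... | [] , p = ↭-trans p (↭-reflexive (++-identityʳ xs))
  ... | z ∷ zs , p = ⊥-elim (<⇒≱ (m<m+n (length xs) z<s)
    (subst (_≤ length xs) (trans (↭-length p) (length-++ xs)) ys≤xs))

  unique-↭ : {xs ys : List A} → xs ↭ ys → Unique xs → Unique ys
  unique-↭ p = PermS.Unique-resp-↭ (setoid _) (↭⇒↭ₛ p)

  unique-map : {f : A → B} {xs : List A} →
    (∀ {x y} → x ∈ xs → y ∈ xs → f x ≡ f y → x ≡ y) → Unique xs → Unique (map f xs)
  unique-map {xs = []} inj [] = []
  unique-map {f = f} {xs = x ∷ xs} inj (x∉xs ∷ xs!) =
    All.tabulate (λ fy∈ fx≡fy → distinct (∈-map⁻ f fy∈) fx≡fy) ∷
    unique-map (λ p r → inj (there p) (there r)) xs!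
    where
    distinct : ∀ {z} → ∃ (λ y → y ∈ xs × z ≡ f y) → ¬ (f x ≡ z)
    distinct (y , y∈xs , refl) fx≡fy = All.lookup x∉xs y∈xs (inj (here refl) (there y∈xs) fx≡fy)

  -- For reading a list of differences backwards: once differences are known not to repeat, each one
  -- determines where it comes from.
  unique-map⁻-injective : {f : A → B} {xs : List A} → Unique (map f xs) →
    ∀ {x y} → x ∈ xs → y ∈ xs → f x ≡ f y → x ≡ y
  unique-map⁻-injective _ (here refl) (here refl) _ = refl
  unique-map⁻-injective {f = f} (p ∷ _) (here refl) (there y∈) e = ⊥-elim (All.lookup p (∈-map⁺ f y∈) e)
  unique-map⁻-injective {f = f} (p ∷ _) (there x∈) (here refl) e = ⊥-elim (All.lookup p (∈-map⁺ f x∈) (sym e))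
  unique-map⁻-injective (_ ∷ ps) (there x∈) (there y∈) e = unique-map⁻-injective ps x∈ y∈ e

  ∈-concatMap-intro : (f : A → List B) {xs : List A} → ∀ {x y} → x ∈ xs → y ∈ f x → y ∈ concatMap f xs
  ∈-concatMap-intro f x∈xs y∈fx = ∈-concatMap⁺ f (lose x∈xs y∈fx)

  ∈-concatMap-elim : (f : A → List B) (xs : List A) → ∀ {y} → y ∈ concatMap f xs → ∃[ x ] (x ∈ xs × y ∈ f x)
  ∈-concatMap-elim f xs y∈ = find (∈-concatMap⁻ f y∈)

  -- `key` recovers from an entry the index of the sublist containing it, so sublists with different
  -- indices are disjoint.
  unique-concatMap : (f : A → List B) (key : B → A) {xs : List A} →
    (∀ {x y} → x ∈ xs → y ∈ f x → key y ≡ x) → (∀ {x} → x ∈ xs → Unique (f x)) → Unique xs → Unique (concatMap f xs)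
  unique-concatMap f key {[]} key-f f! [] = []
  unique-concatMap f key {x ∷ xs} key-f f! (x∉xs ∷ xs!) =
    Unique.++⁺ (f! (here refl)) (unique-concatMap f key (λ x∈ → key-f (there x∈)) (λ x∈ → f! (there x∈)) xs!)
      λ (y∈fx , y∈rest) →
        let z , z∈xs , y∈fz = ∈-concatMap-elim f xs y∈rest
        in All.lookup x∉xs z∈xs (trans (sym (key-f (here refl) y∈fx)) (key-f (there z∈xs) y∈fz))

  length-concatMap : (f : A → List B) (xs : List A) → length (concatMap f xs) ≡ sum (map (λ x → length (f x)) xs)
  length-concatMap f [] = refl
  length-concatMap f (x ∷ xs) = trans (length-++ (f x)) (cong (length (f x) +_) (length-concatMap f xs))

  length-concatMap-≤ : (f : A → List B) (k : ℕ) (xs : List A) →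
    (∀ {x} → x ∈ xs → length (f x) ≤ k) → length (concatMap f xs) ≤ length xs * k
  length-concatMap-≤ f k [] _ = z≤n
  length-concatMap-≤ f k (x ∷ xs) bound = ≤-trans (≤-reflexive (length-++ (f x)))
    (+-mono-≤ (bound (here refl)) (length-concatMap-≤ f k xs (λ p → bound (there p))))

  length-cartesianProduct : (xs : List A) (ys : List B) → length (cartesianProduct xs ys) ≡ length xs * length ys
  length-cartesianProduct [] ys = refl
  length-cartesianProduct (x ∷ xs) ys = trans (length-++ (map (x ,_) ys))
    (cong₂ _+_ (length-map (x ,_) ys) (length-cartesianProduct xs ys))

  -- An entry below `k` would leave a deficit that the other entries, bounded by `k` as well, cannot
  -- make up.
  sum-saturated : ∀ k xs → All (_≤ k) xs → length xs * k ≤ sum xs → All (_≡ k) xs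
  sum-saturated k [] [] _ = []
  sum-saturated k (x ∷ xs) (x≤k ∷ xs≤k) k*≤ = ≤-antisym x≤k k≤x ∷ sum-saturated k xs xs≤k
    (+-cancelˡ-≤ k _ _ (≤-trans k*≤ (+-monoˡ-≤ (sum xs) x≤k)))
    where
    sum-≤ : ∀ ys → All (_≤ k) ys → sum ys ≤ length ys * k
    sum-≤ [] [] = z≤n
    sum-≤ (y ∷ ys) (y≤k ∷ ys≤k) = +-mono-≤ y≤k (sum-≤ ys ys≤k)
    k≤x : k ≤ x
    k≤x = +-cancelʳ-≤ (sum xs) k x (≤-trans (+-monoʳ-≤ k (sum-≤ xs xs≤k)) k*≤)

  sum-replicate : ∀ n k → sum (replicate n k) ≡ n * k
  sum-replicate zero k = refl
  sum-replicate (suc n) k = cong (k +_) (sum-replicate n k)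

  ∈-replicate⁻ : ∀ n {x y : A} → y ∈ replicate n x → y ≡ x
  ∈-replicate⁻ (suc n) (here y≡x) = y≡x
  ∈-replicate⁻ (suc n) (there y∈) = ∈-replicate⁻ n y∈

  map-length-replicate : (f : A → List B) (k : ℕ) → (∀ x → length (f x) ≡ k) → ∀ xs →
    map length (map f xs) ≡ replicate (length xs) k
  map-length-replicate f k len [] = refl
  map-length-replicate f k len (x ∷ xs) = cong₂ _∷_ (len x) (map-length-replicate f k len xs)

  replicate-++ : ∀ m n {x : A} → replicate m x ++ replicate n x ≡ replicate (m + n) x
  replicate-++ zero n = refl
  replicate-++ (suc m) n = cong (_ ∷_) (replicate-++ m n)

  module Count (_≟_ : DecidableEquality A) where

    count : A → List A → ℕ
    count g xs = length (filter (_≟ g) xs)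

    count-++ : ∀ g xs ys → count g (xs ++ ys) ≡ count g xs + count g ys
    count-++ g xs ys = trans (cong length (filter-++ (_≟ g) xs ys)) (length-++ (filter (_≟ g) xs))

    count-↭ : ∀ {xs ys} g → xs ↭ ys → count g xs ≡ count g ys
    count-↭ g p = ↭-length (filter-↭ (_≟ g) p)

    count-∉ : ∀ {g xs} → ¬ (g ∈ xs) → count g xs ≡ 0
    count-∉ {g} {xs} g∉ = cong length (filter-none (_≟ g) (All.tabulate (λ { x∈ refl → g∉ x∈ })))

    count-unique : ∀ {g xs} → Unique xs → g ∈ xs → count g xs ≡ 1
    count-unique {g} {x ∷ xs} (x∉xs ∷ xs!) g∈ with x ≟ g
    ... | yes refl = cong suc (count-∉ (λ x∈ → All.lookup x∉xs x∈ refl))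
    count-unique {g} {x ∷ xs} (x∉xs ∷ xs!) (here refl) | no x≢g = ⊥-elim (x≢g refl)
    count-unique {g} {x ∷ xs} (x∉xs ∷ xs!) (there g∈) | no x≢g = count-unique xs! g∈

    sum-count : ∀ g xss → sum (map (count g) xss) ≡ count g (concat xss)
    sum-count g [] = refl
    sum-count g (xs ∷ xss) = trans (cong (count g xs +_) (sum-count g xss)) (sym (count-++ g xs (concat xss)))

open ListLemmas

-- A ring solver with integer coefficients, and the enumeration of the field

module Field {q : ℕ} (F : FiniteField q) where
  open FiniteField F

  commutativeRing : CommutativeRing 0ℓ 0ℓ
  commutativeRing = record { isCommutativeRing = isCommutativeRing }

  open CommutativeRing commutativeRing public
    using (+-assoc; +-comm; +-identityˡ; +-identityʳ; -‿inverseˡ; -‿inverseʳ;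
           *-assoc; *-comm; *-identityˡ; *-identityʳ; zeroˡ; zeroʳ;
           semiring; +-monoid; ring; +-abelianGroup; commutativeSemiring)

  open import Algebra.Properties.Ring ring using (-‿distribˡ-*; -‿distribʳ-*)
  open import Algebra.Properties.AbelianGroup +-abelianGroup using (⁻¹-involutive)
  open import Algebra.Properties.Monoid.Mult.TCOptimised +-monoid using (×-homo-+) renaming (_×_ to _·_)
  open import Algebra.Properties.Semiring.Mult.TCOptimised semiring using (×1-homo-*)

  almostCommutativeRing : AlmostCommutativeRing 0ℓ 0ℓ
  almostCommutativeRing = fromCommutativeRing commutativeRing

  reduce : ℕ → ℕ → ℕ × ℕ
  reduce (suc a) (suc b) = reduce a b
  reduce a b = a , b

  -- The pair (a , b) stands for the integer a - b; the solver compares normal forms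
  -- syntactically, hence the reduction.
  differences : RawRing 0ℓ 0ℓ
  differences = record
    { Carrier = ℕ × ℕ ; _≈_ = _≡_
    ; _+_ = λ (a , b) (c , d) → reduce (a ℕ.+ c) (b ℕ.+ d)
    ; _*_ = λ (a , b) (c , d) → reduce (a ℕ.* c ℕ.+ b ℕ.* d) (a ℕ.* d ℕ.+ b ℕ.* c)
    ; -_ = λ (a , b) → (b , a)
    ; 0# = (0 , 0) ; 1# = (1 , 0) }

  -- The clause for b = 0 makes 0# and 1# definitionally the values of (0 , 0) and (1 , 0).
  ⟦_⟧ℤ : ℕ × ℕ → Carrier
  ⟦ a , zero ⟧ℤ = a · 1#
  ⟦ a , suc b ⟧ℤ = a · 1# + - (suc b · 1#)

  private
    -- This auxiliary solver never recognises two coefficients as equal, so `x + - x` does not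
    -- cancel in it. It is just strong enough to justify the solver with integer coefficients.
    module S = RingSolver (AlmostCommutativeRing.rawRing almostCommutativeRing)
      almostCommutativeRing (-raw-almostCommutative⟶ almostCommutativeRing) (λ _ _ → nothing)

    neg*neg : ∀ x y → (- x) * (- y) ≡ x * y
    neg*neg x y = trans (sym (-‿distribˡ-* x (- y)))
      (trans (cong -_ (sym (-‿distribʳ-* x y))) (⁻¹-involutive (x * y)))

    distrib₄ : ∀ a b c d → (a + - b) * (c + - d) ≡ (a * c + b * d) + - (a * d + b * c)
    distrib₄ a b c d = trans
      (S.solve 4 (λ a b c d → (a S.:+ b) S.:* (c S.:+ d)
         S.:= (a S.:* c S.:+ b S.:* d) S.:+ (a S.:* d S.:+ b S.:* c)) refl a (- b) c (- d))
      (cong₂ _+_ (cong (a * c +_) (neg*neg b d))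
        (trans (cong₂ _+_ (sym (-‿distribʳ-* a d)) (sym (-‿distribˡ-* b c)))
          (S.solve 2 (λ x y → (S.:- x) S.:+ (S.:- y) S.:= S.:- (x S.:+ y)) refl (a * d) (b * c))))

    ×1-homo-sum : ∀ a b c d → (a ℕ.* c ℕ.+ b ℕ.* d) · 1# ≡ a · 1# * (c · 1#) + b · 1# * (d · 1#)
    ×1-homo-sum a b c d = trans (×-homo-+ 1# (a ℕ.* c) (b ℕ.* d)) (cong₂ _+_ (×1-homo-* a c) (×1-homo-* b d))

    -0≡0 : - 0# ≡ 0#
    -0≡0 = trans (sym (+-identityˡ (- 0#))) (-‿inverseʳ 0#)

    ⟦⟧ℤ-difference : ∀ p → ⟦ p ⟧ℤ ≡ proj₁ p · 1# + - (proj₂ p · 1#)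
    ⟦⟧ℤ-difference (a , zero) = sym (trans (cong (a · 1# +_) -0≡0) (+-identityʳ (a · 1#)))
    ⟦⟧ℤ-difference (a , suc b) = refl

    ⟦⟧ℤ-reduce : ∀ a b → ⟦ reduce a b ⟧ℤ ≡ a · 1# + - (b · 1#)
    ⟦⟧ℤ-reduce zero b = ⟦⟧ℤ-difference (zero , b)
    ⟦⟧ℤ-reduce (suc a) zero = ⟦⟧ℤ-difference (suc a , zero)
    ⟦⟧ℤ-reduce (suc a) (suc b) = trans (⟦⟧ℤ-reduce a b) (sym (trans
      (cong₂ (λ u v → u + - v) (×-homo-+ 1# 1 a) (×-homo-+ 1# 1 b))
      (trans (S.solve 4 (λ e x y z → (e S.:+ x) S.:+ (S.:- (z S.:+ y))
        S.:= (e S.:+ (S.:- z)) S.:+ (x S.:+ (S.:- y))) refl 1# (a · 1#) (b · 1#) 1#)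
        (trans (cong (_+ (a · 1# + - (b · 1#))) (-‿inverseʳ 1#)) (+-identityˡ _)))))

  differencesMorphism : differences -Raw-AlmostCommutative⟶ almostCommutativeRing
  differencesMorphism = record
    { ⟦_⟧ = ⟦_⟧ℤ
    ; +-homo = λ p@(a , b) r@(c , d) → trans (⟦⟧ℤ-reduce (a ℕ.+ c) (b ℕ.+ d)) (trans
        (cong₂ (λ u v → u + - v) (×-homo-+ 1# a c) (×-homo-+ 1# b d))
        (trans (S.solve 4 (λ a b c d → (a S.:+ c) S.:+ (S.:- (b S.:+ d))
           S.:= (a S.:+ (S.:- b)) S.:+ (c S.:+ (S.:- d))) refl (a · 1#) (b · 1#) (c · 1#) (d · 1#))
          (sym (cong₂ _+_ (⟦⟧ℤ-difference p) (⟦⟧ℤ-difference r)))))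
    ; *-homo = λ p@(a , b) r@(c , d) →
        trans (⟦⟧ℤ-reduce (a ℕ.* c ℕ.+ b ℕ.* d) (a ℕ.* d ℕ.+ b ℕ.* c)) (trans
        (cong₂ (λ u v → u + - v) (×1-homo-sum a b c d) (×1-homo-sum a b d c))
        (trans (sym (distrib₄ (a · 1#) (b · 1#) (c · 1#) (d · 1#)))
          (sym (cong₂ _*_ (⟦⟧ℤ-difference p) (⟦⟧ℤ-difference r)))))
    ; -‿homo = λ p@(a , b) → trans (⟦⟧ℤ-difference (b , a)) (sym (trans
        (cong -_ (⟦⟧ℤ-difference p)) (trans
        (S.solve 2 (λ x y → S.:- (x S.:+ y) S.:= (S.:- y) S.:+ (S.:- x)) refl (a · 1#) (- (b · 1#)))
        (cong (_+ - (a · 1#)) (⁻¹-involutive (b · 1#))))))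
    ; 0-homo = refl
    ; 1-homo = refl
    }

  ⟦⟧ℤ-≟ : ∀ x y → Maybe (⟦ x ⟧ℤ ≡ ⟦ y ⟧ℤ)
  ⟦⟧ℤ-≟ x y with ≡-dec ℕ._≟_ ℕ._≟_ x y
  ... | yes x≡y = just (cong ⟦_⟧ℤ x≡y)
  ... | no _ = nothing

  open RingSolver differences almostCommutativeRing differencesMorphism ⟦⟧ℤ-≟ public
    using (solve; _:=_; _:+_; _:*_; :-_; con)

  elements : List Carrier
  elements = map (Inverse.to card) (allFin q)

  elements! : Unique elements
  elements! = Unique.map⁺ (λ {i} {j} e → trans (sym (Inverse.strictlyInverseʳ card i))
    (trans (cong (Inverse.from card) e) (Inverse.strictlyInverseʳ card j))) (Unique.allFin⁺ q)

  ∈-elements : ∀ x → x ∈ elements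
  ∈-elements x = subst (_∈ elements) (Inverse.strictlyInverseˡ card x)
    (∈-map⁺ (Inverse.to card) (∈-allFin (Inverse.from card x)))

  length-elements : length elements ≡ q
  length-elements = trans (length-map (Inverse.to card) (allFin q)) (length-tabulate (λ i → i))

  units : List Carrier
  units = filter (λ x → ¬? (x ≟ 0#)) elements

  units! : Unique units
  units! = Unique.filter⁺ (λ x → ¬? (x ≟ 0#)) elements!

  ∈-units : ∀ {x} → x ≢ 0# → x ∈ units
  ∈-units x≢0 = ∈-filter⁺ (λ x → ¬? (x ≟ 0#)) (∈-elements _) x≢0

  units-≢0 : ∀ {x} → x ∈ units → x ≢ 0#
  units-≢0 x∈ = proj₂ (∈-filter⁻ (λ x → ¬? (x ≟ 0#)) {xs = elements} x∈)

  length-units : suc (length units) ≡ q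
  length-units = trans (ℕ.≤-antisym (unique-⊆-length 0∷units! (λ _ → ∈-elements _))
    (unique-⊆-length elements! elements⊆)) length-elements
    where
    0∷units! : Unique (0# ∷ units)
    0∷units! = All.tabulate (λ x∈ e → units-≢0 x∈ (sym e)) ∷ units!
    elements⊆ : ∀ {x} → x ∈ elements → x ∈ 0# ∷ units
    elements⊆ {x} _ with x ≟ 0#
    ... | yes x≡0 = here x≡0
    ... | no x≢0 = there (∈-units x≢0)

  length-units-pred : ∀ {k} → q ≡ k ℕ.+ 1 → length units ≡ k
  length-units-pred {k} q≡k+1 = ℕ.suc-injective (trans length-units (trans q≡k+1 (ℕ.+-comm k 1)))

-- Translations and differences in Z₃ × F

module Differences {q : ℕ} (F : FiniteField q) where
  open FiniteField F
  open Group3 F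
  open Field F

  τ : Fin 3 → Γ
  τ k = k , 0#

  private
    ₃-translate : ∀ a b c → (a +₃ c) +₃ (-₃ (b +₃ c)) ≡ a +₃ (-₃ b)
    ₃-translate = from-yes (Fin.all? λ a → Fin.all? λ b → Fin.all? λ c →
      (a +₃ c) +₃ (-₃ (b +₃ c)) Fin.≟ a +₃ (-₃ b))

    ₃-assoc : ∀ a b c → (a +₃ b) +₃ c ≡ a +₃ (b +₃ c)
    ₃-assoc = from-yes (Fin.all? λ a → Fin.all? λ b → Fin.all? λ c → (a +₃ b) +₃ c Fin.≟ a +₃ (b +₃ c))

    ₃-comm : ∀ a b → a +₃ b ≡ b +₃ a
    ₃-comm = from-yes (Fin.all? λ a → Fin.all? λ b → a +₃ b Fin.≟ b +₃ a)

    ₃-recover : ∀ a b → b +₃ (a +₃ (-₃ b)) ≡ a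
    ₃-recover = from-yes (Fin.all? λ a → Fin.all? λ b → b +₃ (a +₃ (-₃ b)) Fin.≟ a)

    ₃-transport : ∀ a b c → b +₃ (c +₃ (-₃ a)) ≡ c +₃ (-₃ (a +₃ (-₃ b)))
    ₃-transport = from-yes (Fin.all? λ a → Fin.all? λ b → Fin.all? λ c →
      b +₃ (c +₃ (-₃ a)) Fin.≟ c +₃ (-₃ (a +₃ (-₃ b))))

    ₃-double : ∀ a b → a +₃ (-₃ (a +₃ (-₃ b))) ≡ b
    ₃-double = from-yes (Fin.all? λ a → Fin.all? λ b → a +₃ (-₃ (a +₃ (-₃ b))) Fin.≟ b)

    ₃-cancel : ∀ a b c → a +₃ b ≡ a +₃ c → b ≡ c
    ₃-cancel = from-yes (Fin.all? λ a → Fin.all? λ b → Fin.all? λ c →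
      (a +₃ b Fin.≟ a +₃ c) →-dec (b Fin.≟ c))

    ₃-solve : ∀ i j a b → i +₃ a ≡ j +₃ b → a ≡ (j +₃ (-₃ i)) +₃ b
    ₃-solve = from-yes (Fin.all? λ i → Fin.all? λ j → Fin.all? λ a → Fin.all? λ b →
      (i +₃ a Fin.≟ j +₃ b) →-dec (a Fin.≟ (j +₃ (-₃ i)) +₃ b))

  ⊖-translate : ∀ x y t → (x ⊕ t) ⊖ (y ⊕ t) ≡ x ⊖ y
  ⊖-translate (a , x) (b , y) (c , t) = cong₂ _,_ (₃-translate a b c)
    (solve 3 (λ x y t → (x :+ t) :+ (:- (y :+ t)) := x :+ (:- y)) refl x y t)

  ⊕-assoc : ∀ x y z → (x ⊕ y) ⊕ z ≡ x ⊕ (y ⊕ z)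
  ⊕-assoc (a , x) (b , y) (c , z) = cong₂ _,_ (₃-assoc a b c) (+-assoc x y z)

  ⊕-comm : ∀ x y → x ⊕ y ≡ y ⊕ x
  ⊕-comm (a , x) (b , y) = cong₂ _,_ (₃-comm a b) (+-comm x y)

  ⊕-vertical : ∀ ε δ e → (ε , e) ⊕ τ (δ +₃ (-₃ ε)) ≡ (δ , e)
  ⊕-vertical ε δ e = cong₂ _,_ (₃-recover δ ε) (+-identityʳ e)

  ⊕-recover : ∀ x y → y ⊕ (x ⊖ y) ≡ x
  ⊕-recover (a , x) (b , y) = cong₂ _,_ (₃-recover a b)
    (solve 2 (λ x y → y :+ (x :+ (:- y)) := x) refl x y)

  -- For placing a base block on two prescribed points: the translation by `u ⊖ b` moves `b` to `u`,
  -- and equality of the differences makes it move `c` to `v`.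
  ⊕-transport : ∀ b c u v → b ⊖ c ≡ u ⊖ v → c ⊕ (u ⊖ b) ≡ v
  ⊕-transport (a , x) (b , y) (c , u) (d , v) e = cong₂ _,_
    (trans (₃-transport a b c) (trans (cong (λ z → c +₃ (-₃ z)) (cong proj₁ e)) (₃-double c d)))
    (trans (solve 3 (λ x y u → y :+ (u :+ (:- x)) := u :+ (:- (x :+ (:- y)))) refl x y u)
      (trans (cong (λ z → u + - z) (cong proj₂ e))
        (solve 2 (λ u v → u :+ (:- (u :+ (:- v))) := v) refl u v)))

  ⊕-cancelˡ : ∀ b x y → b ⊕ x ≡ b ⊕ y → x ≡ y
  ⊕-cancelˡ (a , b) (c , x) (d , y) e = cong₂ _,_ (₃-cancel a c d (cong proj₁ e))
    (trans (drop b x) (trans (cong (λ z → - b + z) (cong proj₂ e)) (sym (drop b y))))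
    where
    drop : ∀ b x → x ≡ - b + (b + x)
    drop = solve 2 (λ b x → x := (:- b) :+ (b :+ x)) refl

  τ⊕-solve : ∀ i j x y → τ i ⊕ x ≡ τ j ⊕ y → x ≡ τ (j +₃ (-₃ i)) ⊕ y
  τ⊕-solve i j (a , x) (b , y) e = cong₂ _,_ (₃-solve i j a b (cong proj₁ e))
    (trans (sym (+-identityˡ x)) (cong proj₂ e))

  τ-homo : ∀ i j → τ i ⊕ τ j ≡ τ (i +₃ j)
  τ-homo i j = cong (_ ,_) (+-identityˡ 0#)

  -- The ordered pairs come in the order in which `Δ` lists their differences; unlike a difference,
  -- a pair still shows its two points.
  pairs : List Γ → List (Γ × Γ)
  pairs [] = []
  pairs (x ∷ xs) = map (x ,_) xs ++ map (_, x) xs ++ pairs xs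

  Δ-pairs : ∀ B → map (λ p → proj₁ p ⊖ proj₂ p) (pairs B) ≡ Δ B
  Δ-pairs [] = refl
  Δ-pairs (x ∷ xs) = trans (map-++ diff (map (x ,_) xs) (map (_, x) xs ++ pairs xs))
    (cong₂ _++_ (sym (map-∘ xs)) (trans (map-++ diff (map (_, x) xs) (pairs xs))
      (cong₂ _++_ (sym (map-∘ xs)) (Δ-pairs xs))))
    where
    diff : Γ × Γ → Γ
    diff p = proj₁ p ⊖ proj₂ p

  ∈-pairs : ∀ {B b c} → b ∈ B → c ∈ B → b ≢ c → (b , c) ∈ pairs B
  ∈-pairs (here refl) (here refl) b≢c = contradiction refl b≢c
  ∈-pairs {x ∷ xs} (here refl) (there c∈) b≢c = ∈-++⁺ˡ (∈-map⁺ (x ,_) c∈)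
  ∈-pairs {x ∷ xs} (there b∈) (here refl) b≢c = ∈-++⁺ʳ (map (x ,_) xs) (∈-++⁺ˡ (∈-map⁺ (_, x) b∈))
  ∈-pairs {x ∷ xs} (there b∈) (there c∈) b≢c =
    ∈-++⁺ʳ (map (x ,_) xs) (∈-++⁺ʳ (map (_, x) xs) (∈-pairs b∈ c∈ b≢c))

  pairs-∈ : ∀ {B b c} → (b , c) ∈ pairs B → b ∈ B × c ∈ B
  pairs-∈ {x ∷ xs} p with ∈-++⁻ (map (x ,_) xs) p
  ... | inj₁ p₁ with _ , c∈ , refl ← ∈-map⁻ (x ,_) p₁ = here refl , there c∈
  ... | inj₂ p₂ with ∈-++⁻ (map (_, x) xs) p₂
  ...   | inj₁ p₃ with _ , b∈ , refl ← ∈-map⁻ (_, x) p₃ = there b∈ , here refl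
  ...   | inj₂ p₄ = there (proj₁ (pairs-∈ p₄)) , there (proj₂ (pairs-∈ p₄))

  ∈-Δ⁺ : ∀ {B b c} → b ∈ B → c ∈ B → b ≢ c → b ⊖ c ∈ Δ B
  ∈-Δ⁺ {B} b∈ c∈ b≢c = subst (_ ∈_) (Δ-pairs B)
    (∈-map⁺ (λ p → proj₁ p ⊖ proj₂ p) (∈-pairs b∈ c∈ b≢c))

  ∈-Δ⁻ : ∀ {B g} → g ∈ Δ B → ∃[ b ] ∃[ c ] (b ∈ B × c ∈ B × g ≡ b ⊖ c)
  ∈-Δ⁻ {B} g∈ with (b , c) , p , e ← ∈-map⁻ (λ p → proj₁ p ⊖ proj₂ p) (subst (_ ∈_) (sym (Δ-pairs B)) g∈) =
    b , c , proj₁ (pairs-∈ p) , proj₂ (pairs-∈ p) , e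

  Δ-translate : ∀ B t → Δ (B +ₛ t) ≡ Δ B
  Δ-translate [] t = refl
  Δ-translate (x ∷ xs) t = cong₂ _++_
    (trans (sym (map-∘ xs)) (map-cong (λ y → ⊖-translate x y t) xs))
    (cong₂ _++_ (trans (sym (map-∘ xs)) (map-cong (λ y → ⊖-translate y x t) xs)) (Δ-translate xs t))

  length-Δ : ∀ B → length (Δ B) ≡ length B ℕ.* (length B ∸ 1)
  length-Δ [] = refl
  length-Δ (x ∷ []) = refl
  length-Δ (x ∷ xs@(_ ∷ ys)) = begin
    length (map (x ⊖_) xs ++ map (_⊖ x) xs ++ Δ xs)
      ≡⟨ length-++ (map (x ⊖_) xs) ⟩
    length (map (x ⊖_) xs) ℕ.+ length (map (_⊖ x) xs ++ Δ xs)
      ≡⟨ cong₂ ℕ._+_ (length-map _ xs) (trans (length-++ (map (_⊖ x) xs)) (cong₂ ℕ._+_ (length-map _ xs) (length-Δ xs))) ⟩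
    suc k ℕ.+ (suc k ℕ.+ suc k ℕ.* k)
      ≡⟨ arithmetic k ⟩
    suc (suc k) ℕ.* suc k ∎
    where
    open ≡-Reasoning
    k = length ys
    arithmetic : ∀ k → suc k ℕ.+ (suc k ℕ.+ suc k ℕ.* k) ≡ suc (suc k) ℕ.* suc k
    arithmetic = solve-∀

-- A starter class from a family of base blocks

module BaseFamily {q : ℕ} (F : FiniteField q) (n : ℕ) (q≡18n+1 : q ≡ 18 ℕ.* n ℕ.+ 1)
  (𝓑 : List (List (Fin 3 × FiniteField.Carrier F)))
  (sizes : map length 𝓑 ≡ replicate (4 ℕ.* n) 3 ++ replicate n 6)
  (Δ-cover : ∀ δ e → e ≢ FiniteField.0# F → (δ , e) ∈ concatMap (Group3.Δ F) 𝓑)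
  (cover : ∀ e → e ≢ FiniteField.0# F → ∃[ B ] ∃[ δ ] (B ∈ 𝓑 × (δ , e) ∈ B))
  where
  open FiniteField F
  open Group3 F
  open Field F
  open Differences F
  open Count _≟Γ_ using (count-++; count-↭; count-∉; count-unique; sum-count)

  private
    nonvertical : List Γ
    nonvertical = cartesianProduct (allFin 3) units

    nonvertical! : Unique nonvertical
    nonvertical! = Unique.cartesianProduct⁺ (Unique.allFin⁺ 3) units!

    sum-base-sizes : ∀ (f : ℕ → ℕ) → sum (map f (map length 𝓑)) ≡ 4 ℕ.* n ℕ.* f 3 ℕ.+ n ℕ.* f 6
    sum-base-sizes f = begin
      sum (map f (map length 𝓑))
        ≡⟨ cong (λ ks → sum (map f ks)) sizes ⟩
      sum (map f (replicate (4 ℕ.* n) 3 ++ replicate n 6))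
        ≡⟨ cong sum (trans (map-++ f (replicate (4 ℕ.* n) 3) (replicate n 6))
             (cong₂ _++_ (map-replicate f (4 ℕ.* n) 3) (map-replicate f n 6))) ⟩
      sum (replicate (4 ℕ.* n) (f 3) ++ replicate n (f 6))
        ≡⟨ sum-++ (replicate (4 ℕ.* n) (f 3)) (replicate n (f 6)) ⟩
      sum (replicate (4 ℕ.* n) (f 3)) ℕ.+ sum (replicate n (f 6))
        ≡⟨ cong₂ ℕ._+_ (sum-replicate (4 ℕ.* n) (f 3)) (sum-replicate n (f 6)) ⟩
      4 ℕ.* n ℕ.* f 3 ℕ.+ n ℕ.* f 6 ∎
      where open ≡-Reasoning

    length-Δ𝓑 : length (concatMap Δ 𝓑) ≡ 54 ℕ.* n
    length-Δ𝓑 = begin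
      length (concatMap Δ 𝓑)
        ≡⟨ length-concatMap Δ 𝓑 ⟩
      sum (map (λ B → length (Δ B)) 𝓑)
        ≡⟨ cong sum (trans (map-cong length-Δ 𝓑) (map-∘ 𝓑)) ⟩
      sum (map (λ k → k ℕ.* (k ∸ 1)) (map length 𝓑))
        ≡⟨ sum-base-sizes (λ k → k ℕ.* (k ∸ 1)) ⟩
      4 ℕ.* n ℕ.* 6 ℕ.+ n ℕ.* 30
        ≡⟨ arithmetic n ⟩
      54 ℕ.* n ∎
      where
      open ≡-Reasoning
      arithmetic : ∀ n → 4 ℕ.* n ℕ.* 6 ℕ.+ n ℕ.* 30 ≡ 54 ℕ.* n
      arithmetic = solve-∀

    -- Both lists have 54 n entries, so covering already means covering exactly once.
    Δ𝓑↭nonvertical : concatMap Δ 𝓑 ↭ nonvertical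
    Δ𝓑↭nonvertical = unique-⊆-≥⇒↭ nonvertical!
      (λ {g} g∈ → Δ-cover (proj₁ g) (proj₂ g) (units-≢0 (proj₂ (∈-cartesianProduct⁻ (allFin 3) units g∈))))
      (ℕ.≤-reflexive (trans length-Δ𝓑 (sym (trans (length-cartesianProduct (allFin 3) units)
        (trans (cong (3 ℕ.*_) (length-units-pred q≡18n+1)) (sym (ℕ.*-assoc 3 18 n)))))))

    Δ𝓑-≢0 : ∀ {g} → g ∈ concatMap Δ 𝓑 → proj₂ g ≢ 0#
    Δ𝓑-≢0 g∈ = units-≢0 (proj₂ (∈-cartesianProduct⁻ (allFin 3) units (∈-resp-↭ Δ𝓑↭nonvertical g∈)))

    -- Each difference is kept together with its block and its two points, so that distinctness of
    -- the differences says something about blocks.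
    flags : List (List Γ × (Γ × Γ))
    flags = concatMap (λ B → map (B ,_) (pairs B)) 𝓑

    ∈-flags : ∀ {B b c} → B ∈ 𝓑 → b ∈ B → c ∈ B → b ≢ c → (B , (b , c)) ∈ flags
    ∈-flags {B} B∈ b∈ c∈ b≢c = ∈-concatMap-intro (λ B → map (B ,_) (pairs B)) B∈
      (∈-map⁺ (B ,_) (∈-pairs b∈ c∈ b≢c))

    difference : List Γ × (Γ × Γ) → Γ
    difference (_ , (b , c)) = b ⊖ c

    differences-of-flags : map difference flags ≡ concatMap Δ 𝓑
    differences-of-flags = trans (map-concatMap difference (λ B → map (B ,_) (pairs B)) 𝓑)
      (concatMap-cong (λ B → trans (sym (map-∘ (pairs B))) (Δ-pairs B)) 𝓑)

    -- The differences of all flags rearrange the repetition-free list `nonvertical`, so no two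
    -- flags share one. The uniqueness of the block through two points rests on this.
    flag-injective : ∀ {B b c B′ b′ c′} → B ∈ 𝓑 → b ∈ B → c ∈ B → b ≢ c →
      B′ ∈ 𝓑 → b′ ∈ B′ → c′ ∈ B′ → b′ ≢ c′ → b ⊖ c ≡ b′ ⊖ c′ → B ≡ B′ × b ≡ b′
    flag-injective B∈ b∈ c∈ b≢c B′∈ b′∈ c′∈ b′≢c′ e = cong proj₁ same , cong (λ f → proj₁ (proj₂ f)) same
      where
      same = unique-map⁻-injective
        (subst Unique (sym differences-of-flags) (unique-↭ (↭-sym Δ𝓑↭nonvertical) nonvertical!))
        (∈-flags B∈ b∈ c∈ b≢c) (∈-flags B′∈ b′∈ c′∈ b′≢c′) e

    Z : List Γ
    Z = map τ (allFin 3)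

    shifts : List Γ → List (List Γ)
    shifts B = map (λ k → B +ₛ τ k) (allFin 3)

  parallelClass : List (List Γ)
  parallelClass = Z ∷ concatMap shifts 𝓑

  private
    ∈-shifts : ∀ {B} k → B ∈ 𝓑 → (B +ₛ τ k) ∈ parallelClass
    ∈-shifts {B} k B∈ = there (∈-concatMap-intro shifts B∈ (∈-map⁺ (λ k → B +ₛ τ k) (∈-allFin k)))

    lengths-shifts : ∀ Bs → sum (map length (concatMap shifts Bs)) ≡ 3 ℕ.* sum (map length Bs)
    lengths-shifts [] = refl
    lengths-shifts (B ∷ Bs) rewrite length-map (_⊕ τ zero) B | length-map (_⊕ τ (suc zero)) B
      | length-map (_⊕ τ (suc (suc zero))) B | lengths-shifts Bs = arithmetic (length B) (sum (map length Bs))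
      where
      arithmetic : ∀ a b → a ℕ.+ (a ℕ.+ (a ℕ.+ 3 ℕ.* b)) ≡ 3 ℕ.* (a ℕ.+ b)
      arithmetic = solve-∀

    length-parallelClass : length (concat parallelClass) ≡ 3 ℕ.* q
    length-parallelClass = begin
      length (concat parallelClass)
        ≡⟨ length-concat parallelClass ⟩
      3 ℕ.+ sum (map length (concatMap shifts 𝓑))
        ≡⟨ cong (3 ℕ.+_) (trans (lengths-shifts 𝓑) (cong (λ ks → 3 ℕ.* sum ks) (sym (map-id (map length 𝓑))))) ⟩
      3 ℕ.+ 3 ℕ.* sum (map (λ k → k) (map length 𝓑))
        ≡⟨ cong (λ k → 3 ℕ.+ 3 ℕ.* k) (sum-base-sizes (λ k → k)) ⟩
      3 ℕ.+ 3 ℕ.* (4 ℕ.* n ℕ.* 3 ℕ.+ n ℕ.* 6)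
        ≡⟨ arithmetic n ⟩
      3 ℕ.* (18 ℕ.* n ℕ.+ 1)
        ≡⟨ cong (3 ℕ.*_) (sym q≡18n+1) ⟩
      3 ℕ.* q ∎
      where
      open ≡-Reasoning
      arithmetic : ∀ n → 3 ℕ.+ 3 ℕ.* (4 ℕ.* n ℕ.* 3 ℕ.+ n ℕ.* 6) ≡ 3 ℕ.* (18 ℕ.* n ℕ.+ 1)
      arithmetic = solve-∀
      length-concat : ∀ (xss : List (List Γ)) → length (concat xss) ≡ sum (map length xss)
      length-concat [] = refl
      length-concat (xs ∷ xss) = trans (length-++ xs) (cong (length xs ℕ.+_) (length-concat xss))

    points : List Γ
    points = cartesianProduct (allFin 3) elements

    points! : Unique points
    points! = Unique.cartesianProduct⁺ (Unique.allFin⁺ 3) elements!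

    covered : ∀ g → g ∈ concat parallelClass
    covered (δ , e) with e ≟ 0#
    ... | yes refl = ∈-++⁺ˡ (∈-map⁺ τ (∈-allFin δ))
    ... | no e≢0 with B , ε , B∈ , g∈ ← cover e e≢0 =
      ∈-concat⁺′ (subst (_∈ (B +ₛ τ (δ +₃ (-₃ ε)))) (⊕-vertical ε δ e) (∈-map⁺ (_⊕ τ (δ +₃ (-₃ ε))) g∈))
        (∈-shifts (δ +₃ (-₃ ε)) B∈)

    points↭ : concat parallelClass ↭ points
    points↭ = unique-⊆-≥⇒↭ points! (λ _ → covered _)
      (ℕ.≤-reflexive (trans length-parallelClass (sym (trans (length-cartesianProduct (allFin 3) elements)
        (cong (3 ℕ.*_) length-elements)))))

    partitions : Partitions parallelClass
    partitions g = trans (sum-count g parallelClass) (trans (count-↭ g points↭)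
      (count-unique points! (∈-cartesianProduct⁺ (∈-allFin (proj₁ g)) (∈-elements (proj₂ g)))))

    lengths-parallelClass : ∀ Bs a b → map length Bs ≡ replicate a 3 ++ replicate b 6 →
      map length (concatMap shifts Bs) ≡ replicate (3 ℕ.* a) 3 ++ replicate (3 ℕ.* b) 6
    lengths-parallelClass [] zero zero e = refl
    lengths-parallelClass (B ∷ Bs) zero (suc b) e
      rewrite length-map (_⊕ τ zero) B | length-map (_⊕ τ (suc zero)) B | length-map (_⊕ τ (suc (suc zero))) B
        | proj₁ (∷-injective e) | lengths-parallelClass Bs zero b (proj₂ (∷-injective e)) =
      cong (λ k → replicate k 6) (sym (ℕ.*-suc 3 b))
    lengths-parallelClass (B ∷ Bs) (suc a) b e
      rewrite length-map (_⊕ τ zero) B | length-map (_⊕ τ (suc zero)) B | length-map (_⊕ τ (suc (suc zero))) B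
        | proj₁ (∷-injective e) | lengths-parallelClass Bs a b (proj₂ (∷-injective e)) =
      cong (λ k → replicate k 3 ++ replicate (3 ℕ.* b) 6) (sym (ℕ.*-suc 3 a))

    block-sizes : map length parallelClass ↭ replicate (12 ℕ.* n ℕ.+ 1) 3 ++ replicate (3 ℕ.* n) 6
    block-sizes = ↭-reflexive (trans (cong (3 ∷_) (lengths-parallelClass 𝓑 (4 ℕ.* n) n sizes))
      (cong (λ k → replicate k 3 ++ replicate (3 ℕ.* n) 6) (arithmetic n)))
      where
      arithmetic : ∀ n → suc (3 ℕ.* (4 ℕ.* n)) ≡ 12 ℕ.* n ℕ.+ 1
      arithmetic = solve-∀

    count-Δ-shifts : ∀ g Bs → count g (concatMap Δ (concatMap shifts Bs)) ≡ 3 ℕ.* count g (concatMap Δ Bs)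
    count-Δ-shifts g [] = refl
    count-Δ-shifts g (B ∷ Bs)
      rewrite Δ-translate B (τ zero) | Δ-translate B (τ (suc zero)) | Δ-translate B (τ (suc (suc zero)))
        | count-++ g (Δ B) (Δ B ++ (Δ B ++ concatMap Δ (concatMap shifts Bs)))
        | count-++ g (Δ B) (Δ B ++ concatMap Δ (concatMap shifts Bs))
        | count-++ g (Δ B) (concatMap Δ (concatMap shifts Bs)) | count-Δ-shifts g Bs
        | count-++ g (Δ B) (concatMap Δ Bs) = arithmetic (count g (Δ B)) (count g (concatMap Δ Bs))
      where
      arithmetic : ∀ a b → a ℕ.+ (a ℕ.+ (a ℕ.+ 3 ℕ.* b)) ≡ 3 ℕ.* (a ℕ.+ b)
      arithmetic = solve-∀

    -- The levels of the six differences of `Z`, in the order produced by `Δ`. Levels 1 and 2 occur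
    -- three times each, so `Z` alone supplies the vertical differences with the multiplicity that
    -- the three shifts of the base blocks give to all others.
    ΔZ : List (Fin 3)
    ΔZ = suc (suc zero) ∷ suc zero ∷ suc zero ∷ suc (suc zero) ∷ suc (suc zero) ∷ suc zero ∷ []

    Δ-Z : Δ Z ≡ map τ ΔZ
    Δ-Z rewrite -‿inverseʳ 0# = refl

    count-τ : ∀ k ks → count (τ k) (map τ ks) ≡ Count.count Fin._≟_ k ks
    count-τ k [] = refl
    count-τ k (j ∷ ks) with j Fin.≟ k | τ j ≟Γ τ k
    ... | yes refl | yes _ = cong suc (count-τ k ks)
    ... | yes refl | no τ≢ = contradiction refl τ≢
    ... | no j≢k | yes τ≡ = contradiction (cong proj₁ τ≡) j≢k
    ... | no _ | no _ = count-τ k ks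

    count-Δ : ∀ g → count g (concatMap Δ parallelClass) ≡ count g (map τ ΔZ) ℕ.+ 3 ℕ.* count g (concatMap Δ 𝓑)
    count-Δ g = trans (count-++ g (Δ Z) _) (cong₂ ℕ._+_ (cong (count g) Δ-Z) (count-Δ-shifts g 𝓑))

    count-Δ-vertical : ∀ k → count (τ k) (concatMap Δ parallelClass) ≡ Count.count Fin._≟_ k ΔZ
    count-Δ-vertical k = trans (count-Δ (τ k)) (trans
      (cong₂ (λ a b → a ℕ.+ 3 ℕ.* b) (count-τ k ΔZ) (count-∉ {τ k} {concatMap Δ 𝓑} (λ τ∈ → Δ𝓑-≢0 τ∈ refl)))
      (ℕ.+-identityʳ _))

    differences-3 : ∀ g → g ≢ 0Γ → count g (concatMap Δ parallelClass) ≡ 3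
    differences-3 (δ , e) g≢0 with e ≟ 0#
    differences-3 (zero , e) g≢0 | yes refl = contradiction refl g≢0
    differences-3 (suc zero , e) g≢0 | yes refl = count-Δ-vertical (suc zero)
    differences-3 (suc (suc zero) , e) g≢0 | yes refl = count-Δ-vertical (suc (suc zero))
    differences-3 (δ , e) g≢0 | no e≢0 = trans (count-Δ (δ , e)) (cong₂ (λ a b → a ℕ.+ 3 ℕ.* b)
      (count-∉ {δ , e} {map τ ΔZ} (λ g∈ → e≢0 (cong proj₂ (proj₂ (proj₂ (∈-map⁻ τ g∈))))))
      (trans (count-↭ (δ , e) Δ𝓑↭nonvertical)
        (count-unique nonvertical! (∈-cartesianProduct⁺ (∈-allFin δ) (∈-units e≢0)))))

  isPDF : IsPDF parallelClass (replicate (12 ℕ.* n ℕ.+ 1) 3 ++ replicate (3 ℕ.* n) 6) 3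
  isPDF = partitions , block-sizes , differences-3 , count-Δ-vertical zero

  private
    data Block : List Γ → Set where
      vertical : Block Z
      shifted : ∀ {B} k → B ∈ 𝓑 → Block (B +ₛ τ k)

    block : ∀ {B} → B ∈ parallelClass → Block B
    block (here refl) = vertical
    block (there B∈) with ∈-concatMap-elim shifts 𝓑 B∈
    ... | B₀ , B₀∈ , B∈shifts with k , _ , refl ← ∈-map⁻ (λ k → B₀ +ₛ τ k) B∈shifts = shifted k B₀∈

    ∈-shifted⁻ : ∀ {B k x u} → u ∈ (B +ₛ τ k) +ₛ x → ∃[ b ] (b ∈ B × u ≡ b ⊕ (τ k ⊕ x))
    ∈-shifted⁻ {B} {k} {x} u∈ with _ , c∈ , refl ← ∈-map⁻ (_⊕ x) u∈ with b , b∈ , refl ← ∈-map⁻ (_⊕ τ k) c∈ =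
      b , b∈ , ⊕-assoc b (τ k) x

    ∈-shifted⁺ : ∀ {B b} k x → b ∈ B → b ⊕ (τ k ⊕ x) ∈ (B +ₛ τ k) +ₛ x
    ∈-shifted⁺ {B} {b} k x b∈ = subst (_∈ ((B +ₛ τ k) +ₛ x)) (⊕-assoc b (τ k) x)
      (∈-map⁺ (_⊕ x) (∈-map⁺ (_⊕ τ k) b∈))

    ∈-vertical⁻ : ∀ {x u} → u ∈ Z +ₛ x → ∃[ k ] (u ≡ τ k ⊕ x)
    ∈-vertical⁻ {x} u∈ with _ , c∈ , refl ← ∈-map⁻ (_⊕ x) u∈ with k , _ , refl ← ∈-map⁻ τ c∈ = k , refl

    ∈-vertical⁺ : ∀ k x → τ k ⊕ x ∈ Z +ₛ x
    ∈-vertical⁺ k x = ∈-map⁺ (_⊕ x) (∈-map⁺ τ (∈-allFin k))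

    vertical-⊆ : ∀ {x y k} → x ≡ τ k ⊕ y → ∀ {u} → u ∈ Z +ₛ x → u ∈ Z +ₛ y
    vertical-⊆ {x} {y} {k} refl u∈ with j , refl ← ∈-vertical⁻ u∈ = subst (_∈ (Z +ₛ y))
      (trans (cong (_⊕ y) (sym (τ-homo j k))) (⊕-assoc (τ j) (τ k) y)) (∈-vertical⁺ (j +₃ k) y)

    shifted-⊆ : ∀ {B i j x y} → τ i ⊕ x ≡ τ j ⊕ y → ∀ {u} → u ∈ (B +ₛ τ i) +ₛ x → u ∈ (B +ₛ τ j) +ₛ y
    shifted-⊆ {B} {i} {j} {x} {y} e u∈ with b , b∈ , refl ← ∈-shifted⁻ u∈ =
      subst (_∈ ((B +ₛ τ j) +ₛ y)) (cong (b ⊕_) (sym e)) (∈-shifted⁺ j y b∈)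

    same-vertical : ∀ {x y u} → u ∈ Z +ₛ x → u ∈ Z +ₛ y → ∃[ k ] (x ≡ τ k ⊕ y)
    same-vertical {x} {y} u∈ u∈′ with i , u≡ ← ∈-vertical⁻ u∈ | j , u≡′ ← ∈-vertical⁻ u∈′ =
      j +₃ (-₃ i) , τ⊕-solve i j x y (trans (sym u≡) u≡′)

    vertical-sym : ∀ {x y k} → x ≡ τ k ⊕ y → y ≡ τ (-₃ k) ⊕ x
    vertical-sym {x} {y} {k} x≡ = τ⊕-solve k zero y x (trans (sym x≡) (sym (cong (_ ,_) (+-identityˡ _))))

    vertical-≈ : ∀ {x y k} → x ≡ τ k ⊕ y → (Z +ₛ x) ≈ₛ (Z +ₛ y)
    vertical-≈ x≡ _ = vertical-⊆ x≡ , vertical-⊆ (vertical-sym x≡)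

    ∈-shifted-pair : ∀ {B k x u v} → u ≢ v → u ∈ (B +ₛ τ k) +ₛ x → v ∈ (B +ₛ τ k) +ₛ x →
      ∃[ b ] ∃[ c ] (b ∈ B × c ∈ B × b ≢ c × u ≡ b ⊕ (τ k ⊕ x) × b ⊖ c ≡ u ⊖ v)
    ∈-shifted-pair {B} {k} {x} {u} {v} u≢v u∈ v∈ with b , b∈ , u≡ ← ∈-shifted⁻ u∈ | c , c∈ , v≡ ← ∈-shifted⁻ v∈ =
      b , c , b∈ , c∈ , (λ b≡c → u≢v (trans u≡ (trans (cong (_⊕ (τ k ⊕ x)) b≡c) (sym v≡)))) , u≡ ,
      trans (sym (⊖-translate b c (τ k ⊕ x))) (sym (cong₂ _⊖_ u≡ v≡))

    -- Two points of a translate of `Z` agree in the second coordinate, whereas no difference within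
    -- a base block has second coordinate zero.
    not-mixed : ∀ {B k x y u v} → u ≢ v → B ∈ 𝓑 →
      u ∈ Z +ₛ x → v ∈ Z +ₛ x → u ∈ (B +ₛ τ k) +ₛ y → ¬ (v ∈ (B +ₛ τ k) +ₛ y)
    not-mixed {x = x} u≢v B∈ u∈Z v∈Z u∈B v∈B =
      let i , u≡ = ∈-vertical⁻ u∈Z
          j , v≡ = ∈-vertical⁻ v∈Z
          _ , _ , b∈ , c∈ , b≢c , _ , d≡ = ∈-shifted-pair u≢v u∈B v∈B
      in Δ𝓑-≢0 (∈-concatMap-intro Δ B∈ (∈-Δ⁺ b∈ c∈ b≢c))
           (trans (cong proj₂ (trans d≡ (trans (cong₂ _⊖_ u≡ v≡) (⊖-translate (τ i) (τ j) x)))) (-‿inverseʳ 0#))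

    same-shifted : ∀ {B i x B′ j y u v} → u ≢ v → B ∈ 𝓑 → B′ ∈ 𝓑 →
      u ∈ (B +ₛ τ i) +ₛ x → v ∈ (B +ₛ τ i) +ₛ x → u ∈ (B′ +ₛ τ j) +ₛ y → v ∈ (B′ +ₛ τ j) +ₛ y →
      B ≡ B′ × τ i ⊕ x ≡ τ j ⊕ y
    same-shifted u≢v B∈ B′∈ u∈ v∈ u∈′ v∈′ =
      let b , _ , b∈ , c∈ , b≢c , u≡ , d≡ = ∈-shifted-pair u≢v u∈ v∈
          b′ , _ , b′∈ , c′∈ , b′≢c′ , u≡′ , d≡′ = ∈-shifted-pair u≢v u∈′ v∈′
          B≡B′ , b≡b′ = flag-injective B∈ b∈ c∈ b≢c B′∈ b′∈ c′∈ b′≢c′ (trans d≡ (sym d≡′))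
      in B≡B′ , ⊕-cancelˡ b _ _ (trans (sym u≡) (trans u≡′ (cong (_⊕ _) (sym b≡b′))))

    -- The vertical shift between `x` and `y` is recorded next to the equality of the blocks because
    -- the resolution needs it: it makes the two parallel classes equal, not only the two blocks.
    same-block : ∀ {B x B′ y u v} → u ≢ v → Block B → Block B′ →
      u ∈ B +ₛ x → v ∈ B +ₛ x → u ∈ B′ +ₛ y → v ∈ B′ +ₛ y →
      (∃[ k ] (x ≡ τ k ⊕ y)) × (B +ₛ x) ≈ₛ (B′ +ₛ y)
    same-block u≢v vertical vertical u∈ v∈ u∈′ v∈′ =
      same-vertical u∈ u∈′ , vertical-≈ (proj₂ (same-vertical u∈ u∈′))
    same-block u≢v vertical (shifted k B∈) u∈ v∈ u∈′ v∈′ = contradiction v∈′ (not-mixed u≢v B∈ u∈ v∈ u∈′)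
    same-block u≢v (shifted k B∈) vertical u∈ v∈ u∈′ v∈′ = contradiction v∈ (not-mixed u≢v B∈ u∈′ v∈′ u∈)
    same-block {x = x} {y = y} u≢v (shifted {B} i B∈) (shifted {B′} j B′∈) u∈ v∈ u∈′ v∈′ =
      from-equal (same-shifted u≢v B∈ B′∈ u∈ v∈ u∈′ v∈′)
      where
      from-equal : B ≡ B′ × τ i ⊕ x ≡ τ j ⊕ y →
        (∃[ k ] (x ≡ τ k ⊕ y)) × ((B +ₛ τ i) +ₛ x) ≈ₛ ((B′ +ₛ τ j) +ₛ y)
      from-equal (refl , e) = (j +₃ (-₃ i) , τ⊕-solve i j x y e) ,
        λ _ → shifted-⊆ {B} {i} {j} e , shifted-⊆ {B} {j} {i} (sym e)

    joined : ∀ u v → u ≢ v → ∃[ B ] ∃[ x ] (B ∈ parallelClass × u ∈ B +ₛ x × v ∈ B +ₛ x)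
    joined u v u≢v with proj₂ (u ⊖ v) ≟ 0#
    ... | yes e = Z , v , here refl ,
      subst (_∈ (Z +ₛ v)) (trans (cong (λ z → (proj₁ (u ⊖ v) , z) ⊕ v) (sym e)) (trans (⊕-comm (u ⊖ v) v) (⊕-recover u v)))
        (∈-vertical⁺ (proj₁ (u ⊖ v)) v) ,
      subst (_∈ (Z +ₛ v)) (cong (proj₁ v ,_) (+-identityˡ (proj₂ v))) (∈-vertical⁺ zero v)
    ... | no ne with B , B∈ , d∈ ← ∈-concatMap-elim Δ 𝓑 (Δ-cover (proj₁ (u ⊖ v)) (proj₂ (u ⊖ v)) ne)
      with b , c , b∈ , c∈ , e ← ∈-Δ⁻ d∈ =
      B +ₛ τ zero , u ⊖ (b ⊕ τ zero) , ∈-shifts zero B∈ ,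
      subst (_∈ ((B +ₛ τ zero) +ₛ (u ⊖ (b ⊕ τ zero)))) (⊕-recover u (b ⊕ τ zero))
        (∈-map⁺ (_⊕ (u ⊖ (b ⊕ τ zero))) (∈-map⁺ (_⊕ τ zero) b∈)) ,
      subst (_∈ ((B +ₛ τ zero) +ₛ (u ⊖ (b ⊕ τ zero))))
        (⊕-transport (b ⊕ τ zero) (c ⊕ τ zero) u v (trans (⊖-translate b c (τ zero)) (sym e)))
        (∈-map⁺ (_⊕ (u ⊖ (b ⊕ τ zero))) (∈-map⁺ (_⊕ τ zero) c∈))

    length-≥2 : ∀ {B} → B ∈ 𝓑 → 2 ℕ.≤ length B
    length-≥2 B∈ with ∈-++⁻ (replicate (4 ℕ.* n) 3) (subst (_ ∈_) sizes (∈-map⁺ length B∈))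
    ... | inj₁ l∈ = subst (2 ℕ.≤_) (sym (∈-replicate⁻ (4 ℕ.* n) l∈)) (ℕ.s≤s (ℕ.s≤s ℕ.z≤n))
    ... | inj₂ l∈ = subst (2 ℕ.≤_) (sym (∈-replicate⁻ n l∈)) (ℕ.s≤s (ℕ.s≤s ℕ.z≤n))

    two-points : ∀ {B} → Block B → ∃[ b ] ∃[ c ] (b ∈ B × c ∈ B × b ≢ c)
    two-points vertical = τ zero , τ (suc zero) , here refl , there (here refl) , λ ()
    two-points (shifted {B} k B∈) with B | B∈ | length-≥2 B∈
    ... | _ ∷ [] | _ | ℕ.s≤s ()
    -- The first entry of `Δ` is `b ⊖ c`, and its second coordinate is nonzero; hence `b` and `c`
    -- differ.
    ... | b ∷ c ∷ B′ | B∈ | _ = b ⊕ τ k , c ⊕ τ k , here refl , there (here refl) , λ e →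
      Δ𝓑-≢0 (∈-concatMap-intro Δ B∈ (here refl)) (trans (cong proj₂
        (trans (sym (⊖-translate b c (τ k))) (cong (_⊖ (c ⊕ τ k)) e))) (-‿inverseʳ _))

    -- A vertical translation fixes `Z` and permutes the three shifts of every base block, so it
    -- preserves the parallel class.
    translate-class : ∀ {x y k} → x ≡ τ k ⊕ y → ∀ {C} → Block C →
      ∃[ C′ ] (C′ ∈ parallelClass × (C +ₛ x) ≈ₛ (C′ +ₛ y))
    translate-class x≡ vertical = Z , here refl , vertical-≈ x≡
    translate-class {x} {y} {k} x≡ (shifted {C₀} i C₀∈) = C₀ +ₛ τ (i +₃ k) , ∈-shifts (i +₃ k) C₀∈ ,
      λ _ → shifted-⊆ {C₀} {i} {i +₃ k} e , shifted-⊆ {C₀} {i +₃ k} {i} (sym e)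
      where
      e : τ i ⊕ x ≡ τ (i +₃ k) ⊕ y
      e = trans (cong (τ i ⊕_) x≡) (trans (sym (⊕-assoc (τ i) (τ k) y)) (cong (_⊕ y) (τ-homo i k)))

    shared-block⇒vertical-shift : ∀ {B x B′ y} → Block B → Block B′ → (B +ₛ x) ≈ₛ (B′ +ₛ y) → ∃[ k ] (x ≡ τ k ⊕ y)
    shared-block⇒vertical-shift {x = x} B-block B′-block B≈B′ =
      let b , c , b∈ , c∈ , b≢c = two-points B-block
      in proj₁ (same-block
           (λ e → b≢c (⊕-cancelˡ x b c (trans (⊕-comm x b) (trans e (⊕-comm c x))))) B-block B′-block
           (∈-map⁺ (_⊕ x) b∈) (∈-map⁺ (_⊕ x) c∈)
           (proj₁ (B≈B′ _) (∈-map⁺ (_⊕ x) b∈)) (proj₁ (B≈B′ _) (∈-map⁺ (_⊕ x) c∈)))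

    resolved : ∀ B x B′ y → B ∈ parallelClass → B′ ∈ parallelClass → (B +ₛ x) ≈ₛ (B′ +ₛ y) →
      ∀ C → C ∈ parallelClass → ∃[ C′ ] (C′ ∈ parallelClass × (C +ₛ x) ≈ₛ (C′ +ₛ y))
    resolved B x B′ y B∈ B′∈ B≈B′ C C∈ =
      translate-class (proj₂ (shared-block⇒vertical-shift (block B∈) (block B′∈) B≈B′)) (block C∈)

  isHSBase : IsHSBase parallelClass
  isHSBase = joined ,
    (λ u v u≢v B x B′ y B∈ B′∈ u∈ v∈ u∈′ v∈′ → proj₂ (same-block u≢v (block B∈) (block B′∈) u∈ v∈ u∈′ v∈′)) ,
    resolved

-- Roots of unity and cosets of sixth powers

module Roots {q : ℕ} (F : FiniteField q) where
  open FiniteField F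
  open Field F
  open import Algebra.Properties.CommutativeSemiring.Exp commutativeSemiring public
    using (_^_; ^-homo-*; ^-assocʳ; ^-distrib-*)

  1≢0 : 1# ≢ 0#
  1≢0 e = 0≢1 (sym e)

  inv : ∀ {x} → x ≢ 0# → Carrier
  inv x≢0 = proj₁ (inverse _ x≢0)

  *-inv : ∀ {x} (x≢0 : x ≢ 0#) → x * inv x≢0 ≡ 1#
  *-inv x≢0 = proj₂ (inverse _ x≢0)

  *-cancelˡ : ∀ {a x y} → a ≢ 0# → a * x ≡ a * y → x ≡ y
  *-cancelˡ {a} {x} {y} a≢0 e = trans (recover x) (trans (cong (inv a≢0 *_) e) (sym (recover y)))
    where
    recover : ∀ x → x ≡ inv a≢0 * (a * x)
    recover x = sym (trans (sym (*-assoc (inv a≢0) a x))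
      (trans (cong (_* x) (trans (*-comm (inv a≢0) a) (*-inv a≢0))) (*-identityˡ x)))

  integral : ∀ {a b} → a * b ≡ 0# → a ≢ 0# → b ≡ 0#
  integral {a} e a≢0 = *-cancelˡ a≢0 (trans e (sym (zeroʳ a)))

  *-≢0 : ∀ {a b} → a ≢ 0# → b ≢ 0# → a * b ≢ 0#
  *-≢0 a≢0 b≢0 e = b≢0 (integral e a≢0)

  factor-≢0ʳ : ∀ {a b} → a * b ≢ 0# → b ≢ 0#
  factor-≢0ʳ {a} {b} ab≢0 refl = ab≢0 (zeroʳ a)

  inv-≢0 : ∀ {x} (x≢0 : x ≢ 0#) → inv x≢0 ≢ 0#
  inv-≢0 x≢0 = factor-≢0ʳ (λ e → 1≢0 (trans (sym (*-inv x≢0)) e))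

  quotient : ∀ {a x} → a ≢ 0# → x ≢ 0# → ∃[ z ] (z ≢ 0# × x ≡ a * z)
  quotient {a} {x} a≢0 x≢0 = inv a≢0 * x , *-≢0 (inv-≢0 a≢0) x≢0 ,
    sym (trans (sym (*-assoc a (inv a≢0) x)) (trans (cong (_* x) (*-inv a≢0)) (*-identityˡ x)))

  difference-≡0 : ∀ {x y} → x + - y ≡ 0# → x ≡ y
  difference-≡0 {x} {y} e = trans (solve 2 (λ x y → x := (x :+ (:- y)) :+ y) refl x y)
    (trans (cong (_+ y) e) (+-identityˡ y))

  difference-≢0 : ∀ {x y} → x ≢ y → x + - y ≢ 0#
  difference-≢0 x≢y e = x≢y (difference-≡0 e)

  -‿≢0 : ∀ {x} → x ≢ 0# → - x ≢ 0#
  -‿≢0 {x} x≢0 e = x≢0 (trans (solve 1 (λ x → x := :- (:- x)) refl x)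
    (trans (cong -_ e) (solve 0 (:- con (0 , 0) := con (0 , 0)) refl)))

  ^-≢0 : ∀ {x} k → x ≢ 0# → x ^ k ≢ 0#
  ^-≢0 zero x≢0 = 1≢0
  ^-≢0 (suc k) x≢0 = *-≢0 x≢0 (^-≢0 k x≢0)

  1^ : ∀ k → 1# ^ k ≡ 1#
  1^ zero = refl
  1^ (suc k) = trans (*-identityˡ (1# ^ k)) (1^ k)

  -- The monic polynomial whose lower coefficients, constant term first, are the given ones.
  eval : ∀ {d} → Vec Carrier d → Carrier → Carrier
  eval [] t = 1#
  eval (a ∷ as) t = a + t * eval as t

  -- The quotient in synthetic division by `t - x`; the remainder is the value at `x`.
  deflate : ∀ {d} → Vec Carrier (suc d) → Carrier → Vec Carrier d
  deflate (a ∷ []) x = []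
  deflate (a ∷ as@(_ ∷ _)) x = eval as x ∷ deflate as x

  eval-deflate : ∀ {d} (as : Vec Carrier (suc d)) x t →
    eval as t ≡ (t + - x) * eval (deflate as x) t + eval as x
  eval-deflate (a ∷ []) x t = solve 3 (λ a x t → a :+ t :* con (1 , 0)
    := (t :+ (:- x)) :* con (1 , 0) :+ (a :+ x :* con (1 , 0))) refl a x t
  eval-deflate (a ∷ as@(_ ∷ _)) x t = trans
    (cong (λ z → a + t * z) (eval-deflate as x t))
    (solve 5 (λ a x t c d → a :+ t :* ((t :+ (:- x)) :* c :+ d)
      := (t :+ (:- x)) :* (d :+ t :* c) :+ (a :+ x :* d)) refl
      a x t (eval (deflate as x) t) (eval as x))

  -- Splitting off the root `x` leaves a monic quotient of smaller degree, and the other roots are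
  -- roots of it because they differ from `x`. In degree zero the polynomial is 1 and has no roots.
  length-roots-≤ : ∀ {d} (as : Vec Carrier d) {xs} → Unique xs → All (λ x → eval as x ≡ 0#) xs → length xs ≤ d
  length-roots-≤ as [] [] = z≤n
  length-roots-≤ [] (_ ∷ _) (e ∷ _) = contradiction e 1≢0
  length-roots-≤ as@(_ ∷ _) {x ∷ xs} (x∉xs ∷ xs!) (e ∷ es) =
    s≤s (length-roots-≤ (deflate as x) xs! (All.tabulate λ {t} t∈ →
      integral
        (trans (sym (+-identityʳ _)) (trans (cong ((t + - x) * eval (deflate as x) t +_) (sym e)) (trans (sym (eval-deflate as x t)) (All.lookup es t∈))))
        (difference-≢0 (λ t≡x → All.lookup x∉xs t∈ (sym t≡x)))))

  -- Applies the root bound to `t ^ d - c`. The upper bounds for cosets of the cubes and of the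
  -- sixth powers come from here.
  length-power-roots-≤ : ∀ d c {xs} → 0 ℕ.< d → Unique xs → All (λ x → x ^ d ≡ c) xs → length xs ≤ d
  length-power-roots-≤ (suc d) c _ xs! es = length-roots-≤ (- c ∷ Vec.replicate d 0#) xs!
    (All.map (λ {x} e → trans (cong₂ (λ u v → - u + x * v) (sym e) (eval-power d x)) (-‿inverseˡ (x ^ suc d))) es)
    where
    eval-power : ∀ d x → eval (Vec.replicate d 0#) x ≡ x ^ d
    eval-power zero x = refl
    eval-power (suc d) x = trans (+-identityˡ _) (cong (x *_) (eval-power d x))

  product : List Carrier → Carrier
  product = foldr _*_ 1#

  product-scale : ∀ a xs → product (map (a *_) xs) ≡ a ^ length xs * product xs
  product-scale a [] = sym (*-identityˡ 1#)
  product-scale a (x ∷ xs) = trans (cong (a * x *_) (product-scale a xs))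
    (solve 4 (λ a x p r → a :* x :* (p :* r) := a :* p :* (x :* r)) refl a x (a ^ length xs) (product xs))

  product-≢0 : ∀ {xs} → All (_≢ 0#) xs → product xs ≢ 0#
  product-≢0 [] = 1≢0
  product-≢0 (x≢0 ∷ xs≢0) = *-≢0 x≢0 (product-≢0 xs≢0)

  product-↭ : ∀ {xs ys} → xs ↭ ys → product xs ≡ product ys
  product-↭ p = PermS.foldr-commMonoid (setoid Carrier) (CommutativeRing.*-isCommutativeMonoid commutativeRing) (↭⇒↭ₛ p)

  -- Multiplication by `a` permutes the units. Comparing the product of all units before and after,
  -- and cancelling it, leaves the power of `a`.
  fermat : ∀ {a} → a ≢ 0# → a ^ length units ≡ 1#
  fermat {a} a≢0 = *-cancelˡ Π≢0 (trans (*-comm _ _) (trans (sym (product-scale a units))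
    (trans (product-↭ scaled↭) (sym (*-identityʳ _)))))
    where
    Π≢0 : product units ≢ 0#
    Π≢0 = product-≢0 (All.tabulate units-≢0)
    scaled! : Unique (map (a *_) units)
    scaled! = Unique.map⁺ (*-cancelˡ a≢0) units!
    scaled⊆ : ∀ {x} → x ∈ map (a *_) units → x ∈ units
    scaled⊆ x∈ with z , z∈ , refl ← ∈-map⁻ (a *_) x∈ = ∈-units (*-≢0 a≢0 (units-≢0 z∈))
    scaled↭ : map (a *_) units ↭ units
    scaled↭ = ↭-sym (unique-⊆-≥⇒↭ scaled! scaled⊆ (ℕ.≤-reflexive (sym (length-map (a *_) units))))

-- A primitive cube root of unity

module CubeRoot {q : ℕ} (F : FiniteField q) (n : ℕ) (0<n : 0 ℕ.< n) (q≡18n+1 : q ≡ 18 ℕ.* n ℕ.+ 1) where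
  open FiniteField F
  open Field F
  open Roots F

  length-units-18n : length units ≡ 18 ℕ.* n
  length-units-18n = length-units-pred q≡18n+1

  ^18n : ∀ {x} → x ≢ 0# → x ^ (18 ℕ.* n) ≡ 1#
  ^18n {x} x≢0 = subst (λ k → x ^ k ≡ 1#) length-units-18n (fermat x≢0)

  0<6n : 0 ℕ.< 6 ℕ.* n
  0<6n = ℕ.*-mono-< {0} {6} (s≤s z≤n) 0<n

  6n<18n : 6 ℕ.* n ℕ.< 18 ℕ.* n
  6n<18n = ℕ.*-monoˡ-< n {{ℕ.>-nonZero 0<n}} {6} {18} (ℕ.m≤m+n 7 11)

  -- No generator of the unit group is required: `x ^ (6 n)` is a cube root of unity for every unit
  -- `x`, and it cannot be 1 for all 18 n units, since a polynomial of degree 6 n has at most 6 n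
  -- roots.
  nontrivial-cube-root : ∃[ ε ] (ε ≢ 1# × ε * (ε * ε) ≡ 1#)
  nontrivial-cube-root with Any.any? (λ x → ¬? ((x ^ (6 ℕ.* n)) ≟ 1#)) units
  ... | yes found with x , x∈ , χx≢1 ← find found = x ^ (6 ℕ.* n) , χx≢1 , (begin
    x ^ (6 ℕ.* n) * (x ^ (6 ℕ.* n) * x ^ (6 ℕ.* n))
      ≡⟨ cong (x ^ (6 ℕ.* n) *_) (sym (^-homo-* x (6 ℕ.* n) (6 ℕ.* n))) ⟩
    x ^ (6 ℕ.* n) * x ^ (6 ℕ.* n ℕ.+ 6 ℕ.* n)
      ≡⟨ sym (^-homo-* x (6 ℕ.* n) (6 ℕ.* n ℕ.+ 6 ℕ.* n)) ⟩
    x ^ (6 ℕ.* n ℕ.+ (6 ℕ.* n ℕ.+ 6 ℕ.* n))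
      ≡⟨ cong (x ^_) (arithmetic n) ⟩
    x ^ (18 ℕ.* n)
      ≡⟨ ^18n (units-≢0 x∈) ⟩
    1# ∎)
    where
    open ≡-Reasoning
    arithmetic : ∀ n → 6 ℕ.* n ℕ.+ (6 ℕ.* n ℕ.+ 6 ℕ.* n) ≡ 18 ℕ.* n
    arithmetic = solve-∀
  ... | no none = contradiction
    (subst (_≤ 6 ℕ.* n) length-units-18n (length-power-roots-≤ (6 ℕ.* n) 1# 0<6n units!
      (All.map (λ {x} → decidable-stable ((x ^ (6 ℕ.* n)) ≟ 1#)) (All.¬Any⇒All¬ units none))))
    (ℕ.<⇒≱ 6n<18n)

-- The characters of order six and three

module Cyclotomy {q : ℕ} (F : FiniteField q) (n m : ℕ) (n≡2m+1 : n ≡ 2 ℕ.* m ℕ.+ 1) (q≡18n+1 : q ≡ 18 ℕ.* n ℕ.+ 1)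
  (ε : FiniteField.Carrier F) (ε≢1 : ε ≢ FiniteField.1# F)
  (ε³≡1 : FiniteField._*_ F ε (FiniteField._*_ F ε ε) ≡ FiniteField.1# F) where
  open FiniteField F
  open Field F
  open Roots F

  0<n : 0 ℕ.< n
  0<n = subst (0 ℕ.<_) (sym (trans n≡2m+1 (ℕ.+-comm (2 ℕ.* m) 1))) (s≤s z≤n)

  open CubeRoot F n 0<n q≡18n+1 public using (^18n; length-units-18n; 0<6n)

  0<3n : 0 ℕ.< 3 ℕ.* n
  0<3n = ℕ.*-mono-< {0} {3} (s≤s z≤n) 0<n

  ε≢0 : ε ≢ 0#
  ε≢0 refl = 1≢0 (trans (sym ε³≡1) (zeroˡ (0# * 0#)))

  ζ : Fin 3 → Carrier
  ζ zero = 1#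
  ζ (suc zero) = ε
  ζ (suc (suc zero)) = ε * ε

  ζ-suc : ∀ i → ε * ζ i ≡ ζ (suc zero +₃ i)
  ζ-suc zero = *-identityʳ ε
  ζ-suc (suc zero) = refl
  ζ-suc (suc (suc zero)) = ε³≡1

  ε²≢1 : ε * ε ≢ 1#
  ε²≢1 e = ε≢1 (trans (sym (*-identityʳ ε)) (trans (cong (ε *_) (sym e)) ε³≡1))

  ε²≢ε : ε * ε ≢ ε
  ε²≢ε e = ε≢1 (*-cancelˡ ε≢0 (trans e (sym (*-identityʳ ε))))

  IsCubeRoot : Carrier → Set
  IsCubeRoot x = x ^ 3 ≡ 1#

  ζ-cube : ∀ i → IsCubeRoot (ζ i)
  ζ-cube zero = 1^ 3
  ζ-cube (suc zero) = trans (cong (λ z → ε * (ε * z)) (*-identityʳ ε)) ε³≡1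
  ζ-cube (suc (suc zero)) = trans
    (solve 1 (λ e → (e :* e) :* ((e :* e) :* ((e :* e) :* con (1 , 0))) := (e :* (e :* e)) :* (e :* (e :* e))) refl ε)
    (trans (cong₂ _*_ ε³≡1 ε³≡1) (*-identityˡ 1#))

  record Distinct (a b c : Carrier) : Set where
    constructor distinct
    field
      a≢b : a ≢ b
      a≢c : a ≢ c
      b≢c : b ≢ c

  -- A fourth cube root of unity would be one root too many for `t ^ 3 - 1`. Applied to values of
  -- `χ`, this splits the units into the three cosets of the cubes, with any convenient
  -- representatives.
  cube-roots-exhausted : ∀ {a b c d} → IsCubeRoot a → IsCubeRoot b → IsCubeRoot c → Distinct a b c →
    IsCubeRoot d → d ≡ a ⊎ d ≡ b ⊎ d ≡ c
  cube-roots-exhausted {a} {b} {c} {d} a³ b³ c³ (distinct a≢b a≢c b≢c) d³ with d ≟ a | d ≟ b | d ≟ c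
  ... | yes e | _ | _ = inj₁ e
  ... | no _ | yes e | _ = inj₂ (inj₁ e)
  ... | no _ | no _ | yes e = inj₂ (inj₂ e)
  ... | no d≢a | no d≢b | no d≢c = contradiction
    (length-power-roots-≤ 3 1# (s≤s z≤n)
      ((d≢a ∷ d≢b ∷ d≢c ∷ []) ∷ (a≢b ∷ a≢c ∷ []) ∷ (b≢c ∷ []) ∷ [] ∷ []) (d³ ∷ a³ ∷ b³ ∷ c³ ∷ []))
    (ℕ.<⇒≱ ℕ.≤-refl)

  -- Characters of the unit group with values in the field itself: `θ` has the sixth powers as its
  -- kernel, `χ` the cubes. Cosets are named by these values throughout.
  θ χ : Carrier → Carrier
  θ x = x ^ (3 ℕ.* n)
  χ x = x ^ (6 ℕ.* n)

  θ-* : ∀ x y → θ (x * y) ≡ θ x * θ y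
  θ-* x y = ^-distrib-* x y (3 ℕ.* n)

  χ-* : ∀ x y → χ (x * y) ≡ χ x * χ y
  χ-* x y = ^-distrib-* x y (6 ℕ.* n)

  χ≡θ² : ∀ x → χ x ≡ θ x * θ x
  χ≡θ² x = trans (cong (x ^_) (arithmetic n)) (^-homo-* x (3 ℕ.* n) (3 ℕ.* n))
    where
    arithmetic : ∀ n → 6 ℕ.* n ≡ 3 ℕ.* n ℕ.+ 3 ℕ.* n
    arithmetic = solve-∀

  χ-cube : ∀ {x} → x ≢ 0# → IsCubeRoot (χ x)
  χ-cube {x} x≢0 = trans (^-assocʳ x (6 ℕ.* n) 3) (trans (cong (x ^_) (arithmetic n)) (^18n x≢0))
    where
    arithmetic : ∀ n → 6 ℕ.* n ℕ.* 3 ≡ 18 ℕ.* n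
    arithmetic = solve-∀

  ζ-exhausted : ∀ {d} → IsCubeRoot d → d ≡ 1# ⊎ d ≡ ε ⊎ d ≡ ε * ε
  ζ-exhausted = cube-roots-exhausted (ζ-cube zero) (ζ-cube (suc zero)) (ζ-cube (suc (suc zero)))
    (distinct (λ e → ε≢1 (sym e)) (λ e → ε²≢1 (sym e)) (λ e → ε²≢ε (sym e)))

  -- The powers of `ε` are themselves sixth powers, so multiplying by them never changes the coset;
  -- a triple `t , ε t , ε² t` stays within one.
  θ-ζ : ∀ i → θ (ζ i) ≡ 1#
  θ-ζ i = trans (sym (^-assocʳ (ζ i) 3 n)) (trans (cong (_^ n) (ζ-cube i)) (1^ n))

  χ-ζ : ∀ i → χ (ζ i) ≡ 1#
  χ-ζ i = trans (χ≡θ² (ζ i)) (trans (cong₂ _*_ (θ-ζ i) (θ-ζ i)) (*-identityˡ 1#))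

  -- This is where n has to be odd: for even n, -1 is a sixth power.
  θ-1 : θ (- 1#) ≡ - 1#
  θ-1 = begin
    (- 1#) ^ (3 ℕ.* n)             ≡⟨ cong ((- 1#) ^_) (trans (cong (3 ℕ.*_) n≡2m+1) (arithmetic m)) ⟩
    (- 1#) ^ (1 ℕ.+ 2 ℕ.* (3 ℕ.* m ℕ.+ 1))
                                   ≡⟨ cong (- 1# *_) (sym (^-assocʳ (- 1#) 2 (3 ℕ.* m ℕ.+ 1))) ⟩
    - 1# * ((- 1#) ^ 2) ^ (3 ℕ.* m ℕ.+ 1)
                                   ≡⟨ cong (λ z → - 1# * z ^ (3 ℕ.* m ℕ.+ 1)) -1² ⟩
    - 1# * 1# ^ (3 ℕ.* m ℕ.+ 1)    ≡⟨ cong (- 1# *_) (1^ (3 ℕ.* m ℕ.+ 1)) ⟩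
    - 1# * 1#                      ≡⟨ *-identityʳ (- 1#) ⟩
    - 1#                           ∎
    where
    open ≡-Reasoning
    arithmetic : ∀ m → 3 ℕ.* (2 ℕ.* m ℕ.+ 1) ≡ 1 ℕ.+ 2 ℕ.* (3 ℕ.* m ℕ.+ 1)
    arithmetic = solve-∀
    -1² : (- 1#) ^ 2 ≡ 1#
    -1² = solve 0 ((:- con (1 , 0)) :* ((:- con (1 , 0)) :* con (1 , 0)) := con (1 , 0)) refl

  neg≡-1* : ∀ x → - x ≡ - 1# * x
  neg≡-1* = solve 1 (λ x → :- x := (:- con (1 , 0)) :* x) refl

  θ-neg : ∀ x → θ (- x) ≡ - θ x
  θ-neg x = trans (cong θ (neg≡-1* x)) (trans (θ-* (- 1#) x) (trans (cong (_* θ x) θ-1) (sym (neg≡-1* (θ x)))))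

  χ-neg : ∀ x → χ (- x) ≡ χ x
  χ-neg x = trans (χ≡θ² (- x)) (trans (cong₂ _*_ (θ-neg x) (θ-neg x))
    (trans (solve 1 (λ t → (:- t) :* (:- t) := t :* t) refl (θ x)) (sym (χ≡θ² x))))

  θ-≢0 : ∀ {x} → x ≢ 0# → θ x ≢ 0#
  θ-≢0 = ^-≢0 (3 ℕ.* n)

  squares-≡ : ∀ {u v} → u * u ≡ v * v → u ≡ v ⊎ u ≡ - v
  squares-≡ {u} {v} e with u ≟ v
  ... | yes u≡v = inj₁ u≡v
  ... | no u≢v = inj₂ (trans (solve 2 (λ u v → u := (u :+ v) :+ (:- v)) refl u v)
    (trans (cong (_+ - v) (integral (trans
      (solve 2 (λ u v → (u :+ (:- v)) :* (u :+ v) := u :* u :+ (:- (v :* v))) refl u v)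
      (trans (cong (_+ - (v * v)) e) (-‿inverseʳ (v * v)))) (difference-≢0 u≢v)))
      (+-identityˡ (- v))))

  -- Each coset of the cubes consists of two cosets of the sixth powers, with opposite values of
  -- `θ`. As `θ (- 1)` is -1, negation exchanges the two.
  χ-≡⇒θ : ∀ {x y} → χ x ≡ χ y → θ x ≡ θ y ⊎ θ x ≡ - θ y
  χ-≡⇒θ {x} {y} e = squares-≡ (trans (sym (χ≡θ² x)) (trans e (χ≡θ² y)))

  sixthRoots : List Carrier
  sixthRoots = 1# ∷ ε ∷ ε * ε ∷ - 1# ∷ - ε ∷ - (ε * ε) ∷ []

  -- The cube of `t` has square 1, hence is 1 or -1; accordingly `t` or `- t` is a cube root of
  -- unity.
  sixth-root-cases : ∀ {t} → t ^ 3 * t ^ 3 ≡ 1# → t ∈ sixthRoots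
  sixth-root-cases {t} square = cases (squares-≡ (trans square (sym (*-identityˡ 1#))))
    where
    flip-neg : ∀ {u v} → - u ≡ v → u ≡ - v
    flip-neg {u} e = trans (solve 1 (λ u → u := :- (:- u)) refl u) (cong -_ e)
    neg-cube : t ^ 3 ≡ - 1# → IsCubeRoot (- t)
    neg-cube e = trans
      (solve 1 (λ t → (:- t) :* ((:- t) :* ((:- t) :* con (1 , 0))) := :- (t :* (t :* (t :* con (1 , 0))))) refl t)
      (trans (cong -_ e) (solve 0 (:- (:- con (1 , 0)) := con (1 , 0)) refl))
    positive : t ≡ 1# ⊎ t ≡ ε ⊎ t ≡ ε * ε → t ∈ sixthRoots
    positive (inj₁ e) = here e
    positive (inj₂ (inj₁ e)) = there (here e)
    positive (inj₂ (inj₂ e)) = there (there (here e))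
    negative : - t ≡ 1# ⊎ - t ≡ ε ⊎ - t ≡ ε * ε → t ∈ sixthRoots
    negative (inj₁ e) = there (there (there (here (flip-neg e))))
    negative (inj₂ (inj₁ e)) = there (there (there (there (here (flip-neg e)))))
    negative (inj₂ (inj₂ e)) = there (there (there (there (there (here (flip-neg e))))))
    cases : t ^ 3 ≡ 1# ⊎ t ^ 3 ≡ - 1# → t ∈ sixthRoots
    cases (inj₁ e) = positive (ζ-exhausted e)
    cases (inj₂ e) = negative (ζ-exhausted (neg-cube e))

  θ-sixth : ∀ {x} → x ≢ 0# → θ x ∈ sixthRoots
  θ-sixth {x} x≢0 = sixth-root-cases (trans (sym (^-homo-* (θ x) 3 3)) (trans (^-assocʳ x (3 ℕ.* n) 6)
    (trans (cong (x ^_) (arithmetic n)) (^18n x≢0))))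
    where
    arithmetic : ∀ n → 3 ℕ.* n ℕ.* 6 ≡ 18 ℕ.* n
    arithmetic = solve-∀

-- Transversals of the cube roots of unity in the cosets of the sixth powers

module Classes {q : ℕ} (F : FiniteField q) (n m : ℕ) (n≡2m+1 : n ≡ 2 ℕ.* m ℕ.+ 1) (q≡18n+1 : q ≡ 18 ℕ.* n ℕ.+ 1)
  (ε : FiniteField.Carrier F) (ε≢1 : ε ≢ FiniteField.1# F)
  (ε³≡1 : FiniteField._*_ F ε (FiniteField._*_ F ε ε) ≡ FiniteField.1# F) where
  open FiniteField F
  open Field F
  open Roots F
  open Cyclotomy F n m n≡2m+1 q≡18n+1 ε ε≢1 ε³≡1

  index : Carrier → ℕ
  index x = toℕ (Inverse.from card x)

  index-injective : ∀ {x y} → index x ≡ index y → x ≡ y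
  index-injective {x} {y} e = trans (sym (Inverse.strictlyInverseˡ card x))
    (trans (cong (Inverse.to card) (Fin.toℕ-injective e)) (Inverse.strictlyInverseˡ card y))

  ε³* : ∀ x → ε * (ε * (ε * x)) ≡ x
  ε³* x = trans (solve 2 (λ e x → e :* (e :* (e :* x)) := (e :* (e :* e)) :* x) refl ε x)
    (trans (cong (_* x) ε³≡1) (*-identityˡ x))

  -- One element of each coset of {1, ε, ε²} is singled out, by the enumeration of the field.
  Lead : Carrier → Set
  Lead x = x ≢ 0# × index x ℕ.< index (ε * x) × index x ℕ.< index (ε * (ε * x))

  lead? : ∀ x → Dec (Lead x)
  lead? x = ¬? (x ≟ 0#) ×-dec (index x ℕ.<? index (ε * x)) ×-dec (index x ℕ.<? index (ε * (ε * x)))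

  lead-ε : ∀ {x} → Lead x → ¬ Lead (ε * x)
  lead-ε {x} (_ , x<εx , _) (_ , _ , εx<ε³x) = ℕ.<-asym x<εx (subst (λ z → index (ε * x) ℕ.< index z) (ε³* x) εx<ε³x)

  lead-ε² : ∀ {x} → Lead x → ¬ Lead (ε * (ε * x))
  lead-ε² {x} (_ , _ , x<ε²x) (_ , ε²x<ε³x , _) =
    ℕ.<-asym x<ε²x (subst (λ z → index (ε * (ε * x)) ℕ.< index z) (ε³* x) ε²x<ε³x)

  -- Leads back from any unit to the chosen element of its coset; needed as the `key` which shows
  -- that orbits of different leads are disjoint.
  leader : Carrier → Carrier
  leader x with lead? x | lead? (ε * x)
  ... | yes _ | _ = x
  ... | no _ | yes _ = ε * x
  ... | no _ | no _ = ε * (ε * x)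

  leader-lead : ∀ {x} → Lead x → leader x ≡ x
  leader-lead {x} ℓ with lead? x | lead? (ε * x)
  ... | yes _ | _ = refl
  ... | no ¬ℓ | _ = contradiction ℓ ¬ℓ

  leader-ε : ∀ {x} → Lead x → leader (ε * x) ≡ x
  leader-ε {x} ℓ with lead? (ε * x) | lead? (ε * (ε * x))
  ... | yes ℓ′ | _ = contradiction ℓ′ (lead-ε ℓ)
  ... | no _ | yes ℓ′ = contradiction ℓ′ (lead-ε² ℓ)
  ... | no _ | no _ = ε³* x

  leader-ε² : ∀ {x} → Lead x → leader (ε * (ε * x)) ≡ x
  leader-ε² {x} ℓ with lead? (ε * (ε * x)) | lead? (ε * (ε * (ε * x)))
  ... | yes ℓ′ | _ = contradiction ℓ′ (lead-ε² ℓ)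
  ... | no _ | yes _ = ε³* x
  ... | no _ | no ¬ℓ = contradiction (subst Lead (sym (ε³* x)) ℓ) ¬ℓ

  leader-ζ : ∀ {x} i → Lead x → leader (ζ i * x) ≡ x
  leader-ζ {x} zero ℓ = trans (cong leader (*-identityˡ x)) (leader-lead ℓ)
  leader-ζ (suc zero) ℓ = leader-ε ℓ
  leader-ζ {x} (suc (suc zero)) ℓ = trans (cong leader (*-assoc ε ε x)) (leader-ε² ℓ)

  min₃ : ∀ {a b c} → a ≢ b → b ≢ c → a ≢ c →
    (a ℕ.< b × a ℕ.< c) ⊎ (b ℕ.< c × b ℕ.< a) ⊎ (c ℕ.< a × c ℕ.< b)
  min₃ {a} {b} {c} a≢b b≢c a≢c with ℕ.<-cmp a b | ℕ.<-cmp b c | ℕ.<-cmp a c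
  ... | tri≈ _ e _ | _ | _ = contradiction e a≢b
  ... | _ | tri≈ _ e _ | _ = contradiction e b≢c
  ... | _ | _ | tri≈ _ e _ = contradiction e a≢c
  ... | tri< a<b _ _ | _ | tri< a<c _ _ = inj₁ (a<b , a<c)
  ... | tri> _ _ b<a | tri< b<c _ _ | _ = inj₂ (inj₁ (b<c , b<a))
  ... | tri< a<b _ _ | tri< b<c _ _ | tri> _ _ c<a = inj₂ (inj₂ (c<a , ℕ.<-trans c<a a<b))
  ... | tri< _ _ _ | tri> _ _ c<b | tri> _ _ c<a = inj₂ (inj₂ (c<a , c<b))
  ... | tri> _ _ b<a | tri> _ _ c<b | _ = inj₂ (inj₂ (ℕ.<-trans c<b b<a , c<b))

  ε*-≢ : ∀ {x} → x ≢ 0# → x ≢ ε * x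
  ε*-≢ {x} x≢0 e = ε≢1 (sym (*-cancelˡ x≢0 (trans (*-comm x 1#) (trans (*-identityˡ x) (trans e (*-comm ε x))))))

  has-leader : ∀ {x} → x ≢ 0# → ∃[ i ] ∃[ r ] (Lead r × x ≡ ζ i * r)
  has-leader {x} x≢0 = cases (min₃
      (λ e → ε*-≢ x≢0 (index-injective e))
      (λ e → ε*-≢ (*-≢0 ε≢0 x≢0) (index-injective e))
      (λ e → ε*-≢ x≢0 (*-cancelˡ ε≢0 (*-cancelˡ ε≢0 (trans (sym (index-injective e)) (sym (ε³* x)))))))
    where
    a = index x
    b = index (ε * x)
    c = index (ε * (ε * x))
    cases : (a ℕ.< b × a ℕ.< c) ⊎ (b ℕ.< c × b ℕ.< a) ⊎ (c ℕ.< a × c ℕ.< b) →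
      ∃[ i ] ∃[ r ] (Lead r × x ≡ ζ i * r)
    cases (inj₁ (p , r)) = zero , x , (x≢0 , p , r) , sym (*-identityˡ x)
    cases (inj₂ (inj₁ (p , r))) = suc (suc zero) , ε * x ,
      (*-≢0 ε≢0 x≢0 , p , subst (λ z → b ℕ.< index z) (sym (ε³* x)) r) ,
      sym (trans (*-assoc ε ε (ε * x)) (ε³* x))
    cases (inj₂ (inj₂ (p , r))) = suc zero , ε * (ε * x) ,
      (*-≢0 ε≢0 (*-≢0 ε≢0 x≢0) ,
        subst (λ z → c ℕ.< index z) (sym (ε³* x)) p ,
        subst (λ z → c ℕ.< index z) (sym (cong (ε *_) (ε³* x))) r) ,
      sym (ε³* x)

  -- For a sixth root of unity `c`, these are the parameters `s` or `t` of the base blocks: one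
  -- element from each coset of the cube roots of unity inside the coset `θ x ≡ c`.
  class : Carrier → List Carrier
  class c = filter (λ x → lead? x ×-dec (θ x ≟ c)) elements

  ∈-class⁺ : ∀ {r c} → Lead r → θ r ≡ c → r ∈ class c
  ∈-class⁺ {r} {c} ℓ e = ∈-filter⁺ (λ x → lead? x ×-dec (θ x ≟ c)) (∈-elements r) (ℓ , e)

  ∈-class⁻ : ∀ {r c} → r ∈ class c → Lead r × θ r ≡ c
  ∈-class⁻ {r} {c} r∈ = proj₂ (∈-filter⁻ (λ x → lead? x ×-dec (θ x ≟ c)) {xs = elements} r∈)

  orbit : Carrier → List Carrier
  orbit r = ζ zero * r ∷ ζ (suc zero) * r ∷ ζ (suc (suc zero)) * r ∷ []

  ∈-orbit⁺ : ∀ i {r} → ζ i * r ∈ orbit r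
  ∈-orbit⁺ zero = here refl
  ∈-orbit⁺ (suc zero) = there (here refl)
  ∈-orbit⁺ (suc (suc zero)) = there (there (here refl))

  ∈-orbit⁻ : ∀ {x r} → x ∈ orbit r → ∃[ i ] (x ≡ ζ i * r)
  ∈-orbit⁻ (here e) = zero , e
  ∈-orbit⁻ (there (here e)) = suc zero , e
  ∈-orbit⁻ (there (there (here e))) = suc (suc zero) , e

  orbit! : ∀ {r} → r ≢ 0# → Unique (orbit r)
  orbit! {r} r≢0 = ((λ e → ε≢1 (sym (cancel e))) ∷ (λ e → ε²≢1 (sym (cancel e))) ∷ []) ∷
    ((λ e → ε²≢ε (sym (cancel e))) ∷ []) ∷ [] ∷ []
    where
    cancel : ∀ {u v} → u * r ≡ v * r → u ≡ v
    cancel {u} {v} e = *-cancelˡ r≢0 (trans (*-comm r u) (trans e (*-comm v r)))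

  length-orbits : ∀ rs → length (concatMap orbit rs) ≡ length rs ℕ.* 3
  length-orbits [] = refl
  length-orbits (r ∷ rs) = cong (3 ℕ.+_) (length-orbits rs)

  θ-ζ* : ∀ i x → θ (ζ i * x) ≡ θ x
  θ-ζ* i x = trans (θ-* (ζ i) x) (trans (cong (_* θ x) (θ-ζ i)) (*-identityˡ (θ x)))

  -- Every member contributes an orbit of three solutions of `x ^ (3 n) ≡ c`, the orbits are
  -- disjoint, and there are at most 3 n solutions.
  length-class-≤ : ∀ c → length (class c) ≤ n
  length-class-≤ c = ℕ.*-cancelʳ-≤ (length (class c)) n 3
    (ℕ.≤-trans (ℕ.≤-reflexive (sym (length-orbits (class c))))
      (ℕ.≤-trans (length-power-roots-≤ (3 ℕ.* n) c 0<3n orbits! (All.tabulate root)) (ℕ.≤-reflexive (ℕ.*-comm 3 n))))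
    where
    orbits! : Unique (concatMap orbit (class c))
    orbits! = unique-concatMap orbit leader
      (λ {r} r∈ y∈ → let i , y≡ = ∈-orbit⁻ y∈ in trans (cong leader y≡) (leader-ζ i (proj₁ (∈-class⁻ r∈))))
      (λ r∈ → orbit! (proj₁ (proj₁ (∈-class⁻ r∈))))
      (Unique.filter⁺ (λ x → lead? x ×-dec (θ x ≟ c)) elements!)
    root : ∀ {x} → x ∈ concatMap orbit (class c) → θ x ≡ c
    root x∈ = let r , r∈ , x∈r = ∈-concatMap-elim orbit (class c) x∈
                  i , x≡ = ∈-orbit⁻ x∈r
              in trans (cong θ x≡) (trans (θ-ζ* i r) (proj₂ (∈-class⁻ r∈)))

  -- The six classes have at most n elements each, and their orbits exhaust the 18 n units.
  length-class : ∀ {c} → c ∈ sixthRoots → length (class c) ≡ n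
  length-class c∈ = All.lookup (sum-saturated n lengths (All.map⁺ (All.tabulate {xs = sixthRoots} (λ {c} _ → length-class-≤ c))) 6n≤)
    (∈-map⁺ (λ c → length (class c)) c∈)
    where
    lengths : List ℕ
    lengths = map (λ c → length (class c)) sixthRoots
    units⊆ : ∀ {x} → x ∈ units → x ∈ concatMap orbit (concatMap class sixthRoots)
    units⊆ {x} x∈ = let i , r , ℓ , x≡ = has-leader (units-≢0 x∈) in
      ∈-concatMap-intro orbit (∈-concatMap-intro class (θ-sixth (proj₁ ℓ)) (∈-class⁺ ℓ refl))
        (subst (_∈ orbit r) (sym x≡) (∈-orbit⁺ i))
    6n≤ : 6 ℕ.* n ≤ sum lengths
    6n≤ = ℕ.*-cancelʳ-≤ (6 ℕ.* n) (sum lengths) 3 (begin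
      6 ℕ.* n ℕ.* 3                    ≡⟨ arithmetic n ⟩
      18 ℕ.* n                         ≡⟨ length-units-18n ⟨
      length units                     ≤⟨ unique-⊆-length units! units⊆ ⟩
      length (concatMap orbit (concatMap class sixthRoots))
                                       ≡⟨ length-orbits (concatMap class sixthRoots) ⟩
      length (concatMap class sixthRoots) ℕ.* 3
                                       ≡⟨ cong (ℕ._* 3) (length-concatMap class sixthRoots) ⟩
      sum lengths ℕ.* 3                ∎)
      where
      open ℕ.≤-Reasoning
      arithmetic : ∀ n → 6 ℕ.* n ℕ.* 3 ≡ 18 ℕ.* n
      arithmetic = solve-∀

  -- As `r` runs through a class and `i` through the exponents, `a * (ζ i * r)` runs through a full
  -- coset of the sixth powers. Thus one difference formula for a block yields a whole coset of
  -- differences.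
  in-class : ∀ {a x c} → a ≢ 0# → x ≢ 0# → θ x ≡ θ a * c → ∃[ i ] ∃[ r ] (r ∈ class c × x ≡ a * (ζ i * r))
  in-class {a} {x} {c} a≢0 x≢0 e =
    let z , z≢0 , x≡ = quotient a≢0 x≢0
        i , r , ℓ , z≡ = has-leader z≢0
        θz≡c = *-cancelˡ (θ-≢0 a≢0) (trans (sym (θ-* a z)) (trans (cong θ (sym x≡)) e))
    in i , r , ∈-class⁺ ℓ (trans (sym (θ-ζ* i r)) (trans (cong θ (sym z≡)) θz≡c)) , trans x≡ (cong (a *_) z≡)

-- The base blocks

module Construction {q : ℕ} (F : FiniteField q) (n m : ℕ) (n≡2m+1 : n ≡ 2 ℕ.* m ℕ.+ 1) (q≡18n+1 : q ≡ 18 ℕ.* n ℕ.+ 1)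
  (ε : FiniteField.Carrier F) (ε≢1 : ε ≢ FiniteField.1# F)
  (ε³≡1 : FiniteField._*_ F ε (FiniteField._*_ F ε ε) ≡ FiniteField.1# F) where
  open FiniteField F
  open Group3 F
  open Field F
  open Roots F
  open Differences F using (∈-Δ⁺; ∈-Δ⁻)
  open Cyclotomy F n m n≡2m+1 q≡18n+1 ε ε≢1 ε³≡1
  open Classes F n m n≡2m+1 q≡18n+1 ε ε≢1 ε³≡1
  open DecMembership _≟_ using (_∈?_)

  -- The multiplier of a triple: consecutive entries of `t , ε t , ε² t`, taken cyclically, differ
  -- by `π` times a power of `ε` times `t`.
  π : Carrier
  π = ε + - 1#

  π≢0 : π ≢ 0#
  π≢0 = difference-≢0 ε≢1

  1₃ 2₃ : Fin 3
  1₃ = suc zero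
  2₃ = suc (suc zero)

  ζ-+ : ∀ k i → ζ k * ζ i ≡ ζ (k +₃ i)
  ζ-+ zero i = *-identityˡ (ζ i)
  ζ-+ (suc zero) i = ζ-suc i
  ζ-+ (suc (suc zero)) i = trans (*-assoc ε ε (ζ i)) (trans (cong (ε *_) (ζ-suc i)) (trans (ζ-suc (1₃ +₃ i)) (cong ζ (twice i))))
    where
    twice : ∀ i → 1₃ +₃ (1₃ +₃ i) ≡ 2₃ +₃ i
    twice zero = refl
    twice (suc zero) = refl
    twice (suc (suc zero)) = refl

  up : ∀ i → (1₃ +₃ i) +₃ (-₃ i) ≡ 1₃
  up = from-yes (Fin.all? λ i → (1₃ +₃ i) +₃ (-₃ i) Fin.≟ 1₃)

  -- Reversing a pair of points negates its difference. So level 2 follows from level 1, and level 0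
  -- has to be covered only up to sign.
  negate-∈ : ∀ Bs {δ e} → e ≢ 0# → (δ , e) ∈ concatMap Δ Bs → (-₃ δ , - e) ∈ concatMap Δ Bs
  negate-∈ Bs {δ} {e} e≢0 g∈ =
    let B , B∈ , g∈ΔB = ∈-concatMap-elim Δ Bs g∈
        b , c , b∈ , c∈ , g≡ = ∈-Δ⁻ {B} g∈ΔB
    in ∈-concatMap-intro Δ B∈ (subst (_∈ Δ B) (reverse b c g≡)
         (∈-Δ⁺ {B} c∈ b∈ (λ c≡b → e≢0 (trans (cong proj₂ g≡) (trans (cong (λ z → proj₂ b + - proj₂ z) c≡b) (-‿inverseʳ (proj₂ b)))))))
    where
    reverse₃ : ∀ a b → b +₃ (-₃ a) ≡ -₃ (a +₃ (-₃ b))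
    reverse₃ = from-yes (Fin.all? λ a → Fin.all? λ b → b +₃ (-₃ a) Fin.≟ -₃ (a +₃ (-₃ b)))
    reverse : ∀ b c → (δ , e) ≡ b ⊖ c → c ⊖ b ≡ (-₃ δ , - e)
    reverse (i , x) (j , y) refl = cong₂ _,_ (reverse₃ i j)
      (solve 2 (λ x y → y :+ (:- x) := :- (x :+ (:- y))) refl x y)

  triple : (Fin 3 → Fin 3) → Carrier → List Γ
  triple l t = (l zero , ζ zero * t) ∷ (l 1₃ , ζ 1₃ * t) ∷ (l (2₃) , ζ (2₃) * t) ∷ []

  ∈-triple : ∀ l i {t} → (l i , ζ i * t) ∈ triple l t
  ∈-triple l zero = here refl
  ∈-triple l (suc zero) = there (here refl)
  ∈-triple l (suc (suc zero)) = there (there (here refl))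

  -- The two orientations of a triple of level pattern (0,1,2) give opposite differences at level 1.
  orient : List Carrier → Carrier → Fin 3 → Fin 3
  orient W c with θ π * c ∈? W
  ... | yes _ = -₃_
  ... | no _ = id

  orient-∈ : ∀ {W c} → θ π * c ∈ W → orient W c ≡ -₃_
  orient-∈ {W} {c} c∈ with θ π * c ∈? W
  ... | yes _ = refl
  ... | no c∉ = contradiction c∈ c∉

  orient-∉ : ∀ {W c} → θ π * c ∉ W → orient W c ≡ id
  orient-∉ {W} {c} c∉ with θ π * c ∈? W
  ... | yes c∈ = contradiction c∈ c∉
  ... | no _ = refl

  π* : ∀ i r → π * (ζ i * r) ≡ ζ (1₃ +₃ i) * r + - (ζ i * r)
  π* i r = trans (solve 3 (λ e z r → (e :+ (:- con (1 , 0))) :* (z :* r) := (e :* z) :* r :+ (:- (z :* r))) refl ε (ζ i) r)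
    (cong (λ w → w * r + - (ζ i * r)) (ζ-suc i))

  -- The condition on `θ y` puts the two halves `s` and `y s` of a hexad into different cosets of
  -- the sixth powers; the one on `χ` puts the differences between the halves into different cosets
  -- of the cubes.
  record Good (y : Carrier) : Set where
    field
      y≢0 : y ≢ 0#
      y≢ζ : ∀ i → y ≢ ζ i
      separated : Distinct (χ (y + - ζ zero)) (χ (y + - ζ 1₃)) (χ (y + - ζ 2₃))
      θ≢1 : θ y ≢ 1#

  Starter : Set
  Starter = ∃[ P ] (IsPDF P (replicate (12 ℕ.* n ℕ.+ 1) 3 ++ replicate (3 ℕ.* n) 6) 3 × IsHSBase P)

  -- An entry `(c , k)` of `gens` asks for a triple with level pattern `k` for every member of
  -- `class c`, so four entries give the 4 n triples. The patterns `l` and `l′` are those of the two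
  -- halves of a hexad.
  module Family (gens : List (Carrier × (Fin 3 → Fin 3))) (l l′ : Fin 3 → Fin 3) (y : Carrier) where

    hexagon : Carrier → List Γ
    hexagon s = triple l s ++ triple l′ (y * s)

    triples : Carrier × (Fin 3 → Fin 3) → List (List Γ)
    triples (c , k) = map (triple k) (class c)

    base : List (List Γ)
    base = concatMap triples gens ++ map hexagon (class 1#)

    hexagon-∈ : ∀ {s} → s ∈ class 1# → hexagon s ∈ base
    hexagon-∈ s∈ = ∈-++⁺ʳ (concatMap triples gens) (∈-map⁺ hexagon s∈)

    triple-∈ : ∀ {c k t} → (c , k) ∈ gens → t ∈ class c → triple k t ∈ base
    triple-∈ {c} {k} g∈ t∈ = ∈-++⁺ˡ (∈-concatMap-intro triples g∈ (∈-map⁺ (triple k) t∈))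

    ∈-hexagon : ∀ i {s} → (l i , ζ i * s) ∈ hexagon s
    ∈-hexagon i = ∈-++⁺ˡ (∈-triple l i)

    ∈-hexagon′ : ∀ i {s} → (l′ i , ζ i * (y * s)) ∈ hexagon s
    ∈-hexagon′ i {s} = ∈-++⁺ʳ (triple l s) (∈-triple l′ i)

    lengths : length gens ≡ 4 → All (λ g → proj₁ g ∈ sixthRoots) gens →
      map length base ≡ replicate (4 ℕ.* n) 3 ++ replicate n 6
    lengths len gens-ok = trans (map-++ length (concatMap triples gens) (map hexagon (class 1#)))
      (cong₂ _++_
        (trans (lengths-triples gens gens-ok) (cong (λ k → replicate (k ℕ.* n) 3) len))
        (trans (map-length-replicate hexagon 6 (λ _ → refl) (class 1#))
          (cong (λ k → replicate k 6) (length-class (here refl)))))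
      where
      lengths-triples : ∀ gs → All (λ g → proj₁ g ∈ sixthRoots) gs →
        map length (concatMap triples gs) ≡ replicate (length gs ℕ.* n) 3
      lengths-triples [] [] = refl
      lengths-triples (g@(c , k) ∷ gs) (c∈ ∷ ok) =
        trans (map-++ length (triples g) (concatMap triples gs))
          (trans (cong₂ _++_
            (trans (map-length-replicate (triple k) 3 (λ _ → refl) (class c)) (cong (λ j → replicate j 3) (length-class c∈)))
            (lengths-triples gs ok))
          (replicate-++ n (length gs ℕ.* n)))

    difference-∈ : ∀ {B γ γ′ a a′ δ e} → B ∈ base → (γ , a) ∈ B → (γ′ , a′) ∈ B →
      γ +₃ (-₃ γ′) ≡ δ → e ≡ a + - a′ → e ≢ 0# → (δ , e) ∈ concatMap Δ base
    difference-∈ {B} {γ} {γ′} {a} {a′} B∈ p p′ γ≡ e≡ e≢0 = ∈-concatMap-intro Δ B∈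
      (subst (_∈ Δ B) (cong₂ _,_ γ≡ (sym e≡)) (∈-Δ⁺ p p′ (λ same →
        e≢0 (trans e≡ (trans (cong (λ z → a + - z) (sym (cong proj₂ same))) (-‿inverseʳ a))))))

    starter : length gens ≡ 4 → All (λ g → proj₁ g ∈ sixthRoots) gens →
      (∀ {e} → e ≢ 0# → (zero , e) ∈ concatMap Δ base ⊎ (zero , - e) ∈ concatMap Δ base) →
      (∀ {e} → e ≢ 0# → (1₃ , e) ∈ concatMap Δ base) →
      (∀ {e} → e ≢ 0# → ∃[ B ] ∃[ δ ] (B ∈ base × (δ , e) ∈ B)) →
      Starter
    starter len gens-ok level0 level1 cover = parallelClass , isPDF , isHSBase
      where
      double-neg : ∀ e → - - e ≡ e
      double-neg = solve 1 (λ e → :- (:- e) := e) refl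
      level2 : ∀ {e} → e ≢ 0# → (2₃ , e) ∈ concatMap Δ base
      level2 {e} e≢0 = subst (λ z → (2₃ , z) ∈ concatMap Δ base) (double-neg e)
        (negate-∈ base (-‿≢0 e≢0) (level1 (-‿≢0 e≢0)))
      Δ-cover : ∀ δ e → e ≢ 0# → (δ , e) ∈ concatMap Δ base
      Δ-cover zero e e≢0 = [ id , (λ p → subst (λ z → (zero , z) ∈ concatMap Δ base) (double-neg e)
        (negate-∈ base (-‿≢0 e≢0) p)) ]′ (level0 e≢0)
      Δ-cover (suc zero) e e≢0 = level1 e≢0
      Δ-cover (suc (suc zero)) e e≢0 = level2 e≢0
      open BaseFamily F n q≡18n+1 base (lengths len gens-ok) Δ-cover (λ e → cover {e})

    flat-difference : ∀ {c e} → (c , const zero) ∈ gens → e ≢ 0# → θ e ≡ θ π * c → (zero , e) ∈ concatMap Δ base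
    flat-difference g∈ e≢0 θe =
      let i , r , r∈ , e≡ = in-class π≢0 e≢0 θe
      in difference-∈ (triple-∈ g∈ r∈) (∈-triple (const zero) (1₃ +₃ i)) (∈-triple (const zero) i) refl
           (trans e≡ (π* i r)) e≢0

    -- `W` holds the cosets of the level 1 differences between the halves of the hexads. A triple of
    -- class `c` would add the coset `θ π * c` at level 1; if that lies in `W`, the reversed
    -- orientation adds its negative instead.
    steep-difference : ∀ W {c e} → (c , orient W c) ∈ gens → e ≢ 0# →
      (θ e ≡ θ π * c × θ e ∉ W) ⊎ (θ (- e) ≡ θ π * c × θ (- e) ∈ W) → (1₃ , e) ∈ concatMap Δ base
    steep-difference W {c} {e} g∈ e≢0 (inj₁ (θe , θe∉W)) =
      let i , r , r∈ , e≡ = in-class π≢0 e≢0 θe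
      in difference-∈ (triple-∈ (subst (λ k → (c , k) ∈ gens) (orient-∉ (subst (_∉ W) θe θe∉W)) g∈) r∈)
           (∈-triple id (1₃ +₃ i)) (∈-triple id i) (up i) (trans e≡ (π* i r)) e≢0
    steep-difference W {c} {e} g∈ e≢0 (inj₂ (θ-e , θ-e∈W)) =
      let i , r , r∈ , -e≡ = in-class π≢0 (-‿≢0 e≢0) θ-e
      in difference-∈ (triple-∈ (subst (λ k → (c , k) ∈ gens) (orient-∈ (subst (_∈ W) θ-e θ-e∈W)) g∈) r∈)
           (∈-triple -₃_ i) (∈-triple -₃_ (1₃ +₃ i)) (down i) (flip (trans -e≡ (π* i r))) e≢0
      where
      down : ∀ i → (-₃ i) +₃ (-₃ (-₃ (1₃ +₃ i))) ≡ 1₃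
      down = from-yes (Fin.all? λ i → (-₃ i) +₃ (-₃ (-₃ (1₃ +₃ i))) Fin.≟ 1₃)
      flip : ∀ {x y z} → - x ≡ y + - z → x ≡ z + - y
      flip {x} {y} {z} e = trans (solve 1 (λ x → x := :- (:- x)) refl x) (trans (cong -_ e)
        (solve 2 (λ y z → :- (y :+ (:- z)) := z :+ (:- y)) refl y z))

    triple-point : ∀ {c k e} → (c , k) ∈ gens → e ≢ 0# → θ e ≡ c → ∃[ B ] ∃[ δ ] (B ∈ base × (δ , e) ∈ B)
    triple-point {c} {k} {e} g∈ e≢0 θe =
      let i , r , ℓ , e≡ = has-leader e≢0
      in triple k r , k i , triple-∈ g∈ (∈-class⁺ ℓ (trans (sym (θ-ζ* i r)) (trans (cong θ (sym e≡)) θe))) ,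
         subst (λ z → (k i , z) ∈ triple k r) (sym e≡) (∈-triple k i)

    hexagon-point : ∀ {e} → e ≢ 0# → θ e ≡ 1# → ∃[ B ] ∃[ δ ] (B ∈ base × (δ , e) ∈ B)
    hexagon-point {e} e≢0 θe =
      let i , r , ℓ , e≡ = has-leader e≢0
      in hexagon r , l i , hexagon-∈ (∈-class⁺ ℓ (trans (sym (θ-ζ* i r)) (trans (cong θ (sym e≡)) θe))) ,
         subst (λ z → (l i , z) ∈ hexagon r) (sym e≡) (∈-hexagon i)

    in-class-1 : ∀ {a e} → a ≢ 0# → e ≢ 0# → θ e ≡ θ a → ∃[ i ] ∃[ r ] (r ∈ class 1# × e ≡ a * (ζ i * r))
    in-class-1 {a} a≢0 e≢0 θe = in-class a≢0 e≢0 (trans θe (sym (*-identityʳ (θ a))))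

    hexagon-point′ : ∀ {e} → y ≢ 0# → e ≢ 0# → θ e ≡ θ y → ∃[ B ] ∃[ δ ] (B ∈ base × (δ , e) ∈ B)
    hexagon-point′ {e} y≢0 e≢0 θe =
      let i , r , r∈ , e≡ = in-class-1 y≢0 e≢0 θe
      in hexagon r , l′ i , hexagon-∈ r∈ , subst (λ z → (l′ i , z) ∈ hexagon r)
           (sym (trans e≡ (solve 3 (λ y z r → y :* (z :* r) := z :* (y :* r)) refl y (ζ i) r))) (∈-hexagon′ i)

  signs : ∀ {x y} → χ x ≡ χ y → θ x ≡ θ y ⊎ θ (- x) ≡ θ y
  signs {x} {y} e = [ inj₁ , (λ p → inj₂ (trans (θ-neg x) (trans (cong -_ p)
    (solve 1 (λ t → :- (:- t) := t) refl (θ y))))) ]′ (χ-≡⇒θ e)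

  -- Base blocks from a noncube `y`

  module CaseI (y : Carrier) (good : Good y) (χy≢1 : χ y ≢ 1#) where
    open Good good

    y⁻¹ : Carrier
    y⁻¹ = inv y≢0

    y⁻¹≢0 : y⁻¹ ≢ 0#
    y⁻¹≢0 = inv-≢0 y≢0

    χyχy⁻¹ : χ y * χ y⁻¹ ≡ 1#
    χyχy⁻¹ = trans (sym (χ-* y y⁻¹)) (trans (cong χ (*-inv y≢0)) (1^ (6 ℕ.* n)))

    three-classes : ∀ {z} → z ≢ 0# → χ z ≡ χ 1# ⊎ χ z ≡ χ y ⊎ χ z ≡ χ y⁻¹
    three-classes z≢0 = cube-roots-exhausted (χ-cube 1≢0) (χ-cube y≢0) (χ-cube y⁻¹≢0)
      (distinct (λ e → χy≢1 (trans (sym e) χ1)) (λ e → χy⁻¹≢1 (trans (sym e) χ1)) χy≢χy⁻¹) (χ-cube z≢0)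
      where
      χ1 : χ 1# ≡ 1#
      χ1 = 1^ (6 ℕ.* n)
      χy⁻¹≢1 : χ y⁻¹ ≢ 1#
      χy⁻¹≢1 e = χy≢1 (trans (sym (*-identityʳ (χ y)))
        (trans (cong (χ y *_) (sym e)) χyχy⁻¹))
      χy≢χy⁻¹ : χ y ≢ χ y⁻¹
      -- Equality would make the square of `χ y` equal to 1; its cube is 1 too, so `χ y` would be 1.
      χy≢χy⁻¹ e = χy≢1 (trans (sym (trans (cong (χ y *_) (trans (sym (*-assoc (χ y) (χ y) 1#)) (trans (*-comm _ 1#)
        (trans (*-identityˡ _) (trans (cong (χ y *_) e) χyχy⁻¹))))) (*-identityʳ (χ y))))
        (χ-cube y≢0))

    W : List Carrier
    W = θ (y + - ζ zero) ∷ θ (y + - ζ 1₃) ∷ θ (y + - ζ 2₃) ∷ []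

    steep : Carrier → Carrier × (Fin 3 → Fin 3)
    steep a = θ (- a) , orient W (θ (- a))

    -- The six cosets are those of 1, `y`, `y⁻¹` and their negatives. The hexads occupy 1 and `y`,
    -- the flat triples `y⁻¹`; their level 0 differences, up to sign, are `π` times these three and
    -- so reach everything. The negatives carry the steep triples, which serve level 1 only.
    gens : List (Carrier × (Fin 3 → Fin 3))
    gens = (θ y⁻¹ , const zero) ∷ steep 1# ∷ steep y ∷ steep y⁻¹ ∷ []

    open Family gens (const zero) (const 1₃) y

    level0-positive : ∀ {e a} → e ≢ 0# → a ≡ 1# ⊎ a ≡ y ⊎ a ≡ y⁻¹ → θ e ≡ θ (π * a) → (zero , e) ∈ concatMap Δ base
    level0-positive e≢0 (inj₁ refl) θe =
      let i , r , r∈ , e≡ = in-class-1 (*-≢0 π≢0 1≢0) e≢0 θe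
      in difference-∈ (hexagon-∈ r∈) (∈-hexagon (1₃ +₃ i)) (∈-hexagon i) refl
           (trans e≡ (trans (cong (_* (ζ i * r)) (*-identityʳ π)) (π* i r))) e≢0
    level0-positive e≢0 (inj₂ (inj₁ refl)) θe =
      let i , r , r∈ , e≡ = in-class-1 (*-≢0 π≢0 y≢0) e≢0 θe
      in difference-∈ (hexagon-∈ r∈) (∈-hexagon′ (1₃ +₃ i)) (∈-hexagon′ i) refl
           (trans e≡ (trans (solve 4 (λ p y z r → (p :* y) :* (z :* r) := p :* (z :* (y :* r))) refl π y (ζ i) r)
             (π* i (y * r)))) e≢0
    level0-positive e≢0 (inj₂ (inj₂ refl)) θe = flat-difference (here refl) e≢0 (trans θe (θ-* π y⁻¹))

    signs-π : ∀ {z a} → χ z ≡ χ a → θ (π * z) ≡ θ (π * a) ⊎ θ (- (π * z)) ≡ θ (π * a)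
    signs-π {z} {a} e = signs (trans (χ-* π z) (trans (cong (χ π *_) e) (sym (χ-* π a))))

    level0 : ∀ {e} → e ≢ 0# → (zero , e) ∈ concatMap Δ base ⊎ (zero , - e) ∈ concatMap Δ base
    level0 {e} e≢0 = from-quotient (quotient π≢0 e≢0)
      where
      from-signs : ∀ {a} → a ≡ 1# ⊎ a ≡ y ⊎ a ≡ y⁻¹ → θ e ≡ θ (π * a) ⊎ θ (- e) ≡ θ (π * a) →
        (zero , e) ∈ concatMap Δ base ⊎ (zero , - e) ∈ concatMap Δ base
      from-signs a (inj₁ p) = inj₁ (level0-positive e≢0 a p)
      from-signs a (inj₂ p) = inj₂ (level0-positive (-‿≢0 e≢0) a p)
      from-quotient : ∃[ z ] (z ≢ 0# × e ≡ π * z) → (zero , e) ∈ concatMap Δ base ⊎ (zero , - e) ∈ concatMap Δ base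
      from-quotient (z , z≢0 , refl) = [ (λ p → from-signs (inj₁ refl) (signs-π p)) ,
        [ (λ p → from-signs (inj₂ (inj₁ refl)) (signs-π p)) ,
          (λ p → from-signs (inj₂ (inj₂ refl)) (signs-π p)) ]′ ]′ (three-classes z≢0)

    level1-hexagon : ∀ {e} k → e ≢ 0# → θ e ≡ θ (y + - ζ k) → (1₃ , e) ∈ concatMap Δ base
    level1-hexagon {e} k e≢0 θe =
      let i , r , r∈ , e≡ = in-class-1 (difference-≢0 (y≢ζ k)) e≢0 θe
      in difference-∈ (hexagon-∈ r∈) (∈-hexagon′ i) (∈-hexagon (k +₃ i)) refl
           (trans e≡ (trans
             (solve 4 (λ y x z r → (y :+ (:- x)) :* (z :* r) := z :* (y :* r) :+ (:- ((x :* z) :* r))) refl y (ζ k) (ζ i) r)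
             (cong (λ w → ζ i * (y * r) + - (w * r)) (ζ-+ k i)))) e≢0

    ∈W : ∀ k → θ (y + - ζ k) ∈ W
    ∈W zero = here refl
    ∈W (suc zero) = there (here refl)
    ∈W (suc (suc zero)) = there (there (here refl))

    -- By separation `W` meets all three cosets of the cubes, and negation exchanges the two halves
    -- of each of them.
    W-up-to-sign : ∀ {e} → e ≢ 0# → θ e ∉ W → θ (- e) ∈ W
    W-up-to-sign {e} e≢0 e∉W = [ use zero , [ use 1₃ , use 2₃ ]′ ]′
      (cube-roots-exhausted (χ-cube (difference-≢0 (y≢ζ zero))) (χ-cube (difference-≢0 (y≢ζ 1₃)))
        (χ-cube (difference-≢0 (y≢ζ 2₃))) separated (χ-cube e≢0))
      where
      use : ∀ k → χ e ≡ χ (y + - ζ k) → θ (- e) ∈ W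
      use k p = [ (λ q → contradiction (subst (_∈ W) (sym q) (∈W k)) e∉W) ,
        (λ q → subst (_∈ W) (sym q) (∈W k)) ]′ (signs p)

    level1 : ∀ {e} → e ≢ 0# → (1₃ , e) ∈ concatMap Δ base
    level1 {e} e≢0 = by-W (θ e ∈? W)
      where
      from-steep : ∀ {z a} → steep a ∈ gens → θ e ∉ W → e ≡ π * z → χ z ≡ χ a → (1₃ , e) ∈ concatMap Δ base
      -- Either `e` or `- e` lies in the coset of `π * - a`, the unreversed one for this triple. If
      -- it is `e`, that coset is not in `W` and the orientation is kept; if it is `- e`, that coset
      -- is in `W` and the reversal yields `e`.
      from-steep {z} {a} a∈ e∉W e≡ p = steep-difference W a∈ e≢0
        ([ (λ r → inj₂ (trans (θ-neg e) (trans (cong -_ r) (trans (sym (θ-neg (π * a))) (trans (cong θ (neg* a)) (θ-* π (- a)))))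
                   , W-up-to-sign e≢0 e∉W)) ,
           (λ r → inj₁ (trans (cong θ (double-neg e)) (trans (θ-neg (- e)) (trans (cong -_ r) (trans (sym (θ-neg (π * a)))
                   (trans (cong θ (neg* a)) (θ-* π (- a)))))) , e∉W)) ]′
         (subst (λ x → θ x ≡ θ (π * a) ⊎ θ (- x) ≡ θ (π * a)) (sym e≡) (signs-π p)))
        where
        neg* : ∀ a → - (π * a) ≡ π * - a
        neg* a = solve 2 (λ p a → :- (p :* a) := p :* (:- a)) refl π a
        double-neg : ∀ e → e ≡ - - e
        double-neg = solve 1 (λ e → e := :- (:- e)) refl
      from-quotient : θ e ∉ W → ∃[ z ] (z ≢ 0# × e ≡ π * z) → (1₃ , e) ∈ concatMap Δ base
      from-quotient e∉W (z , z≢0 , e≡) = [ from-steep (there (here refl)) e∉W e≡ ,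
        [ from-steep (there (there (here refl))) e∉W e≡ ,
          from-steep (there (there (there (here refl)))) e∉W e≡ ]′ ]′ (three-classes z≢0)
      by-W : Dec (θ e ∈ W) → (1₃ , e) ∈ concatMap Δ base
      by-W (no e∉W) = from-quotient e∉W (quotient π≢0 e≢0)
      by-W (yes (here p)) = level1-hexagon zero e≢0 p
      by-W (yes (there (here p))) = level1-hexagon 1₃ e≢0 p
      by-W (yes (there (there (here p)))) = level1-hexagon 2₃ e≢0 p

    cover : ∀ {e} → e ≢ 0# → ∃[ B ] ∃[ δ ] (B ∈ base × (δ , e) ∈ B)
    cover {e} e≢0 = [ (λ p → [ (λ r → hexagon-point e≢0 (trans r (1^ (3 ℕ.* n)))) , from-steep (there (here refl)) ]′ (χ-≡⇒θ p)) ,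
      [ (λ p → [ hexagon-point′ y≢0 e≢0 , from-steep (there (there (here refl))) ]′ (χ-≡⇒θ p)) ,
        (λ p → [ triple-point (here refl) e≢0 , from-steep (there (there (there (here refl)))) ]′ (χ-≡⇒θ p)) ]′ ]′
      (three-classes e≢0)
      where
      from-steep : ∀ {a} → steep a ∈ gens → θ e ≡ - θ a → ∃[ B ] ∃[ δ ] (B ∈ base × (δ , e) ∈ B)
      from-steep {a} a∈ p = triple-point a∈ e≢0 (trans p (sym (θ-neg a)))

    caseI : Starter
    caseI = starter refl
      (θ-sixth y⁻¹≢0 ∷ θ-sixth (-‿≢0 1≢0) ∷ θ-sixth (-‿≢0 y≢0) ∷ θ-sixth (-‿≢0 y⁻¹≢0) ∷ [])
      level0 level1 cover

  -- Base blocks from a cube `y` that is not a sixth power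

  module CaseII (y : Carrier) (good : Good y) (θy≡-1 : θ y ≡ - 1#) (aligned : χ π ≡ χ (y + - ζ zero)) where
    open Good good

    εy-1 ε-y : Carrier
    εy-1 = ε * (y + - ζ 2₃)
    ε-y = - (y + - ζ 1₃)

    εy-1≢0 : εy-1 ≢ 0#
    εy-1≢0 = *-≢0 ε≢0 (difference-≢0 (y≢ζ 2₃))

    ε-y≢0 : ε-y ≢ 0#
    ε-y≢0 = -‿≢0 (difference-≢0 (y≢ζ 1₃))

    W : List Carrier
    W = θ εy-1 ∷ θ ε-y ∷ []

    steep : Carrier → Carrier × (Fin 3 → Fin 3)
    steep c = c , orient W c

    -- Here `ε` and `ε * ε` are values of `θ` naming cosets. The halves of the hexads occupy the
    -- cosets with values 1 and -1, since `θ y` is -1. Flat and steep triples share the other four,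
    -- one of each kind in every remaining coset of the cubes.
    gens : List (Carrier × (Fin 3 → Fin 3))
    gens = (ε , const zero) ∷ (ε * ε , const zero) ∷ steep (- ε) ∷ steep (- (ε * ε)) ∷ []

    open Family gens id id y

    neg* : ∀ {a b c} → a ≡ b * - c → - a ≡ b * c
    neg* {a} {b} {c} e = trans (cong -_ e) (solve 2 (λ b c → :- (b :* (:- c)) := b :* c) refl b c)

    neg*′ : ∀ {a b c} → a ≡ b * c → - a ≡ b * - c
    neg*′ {a} {b} {c} e = trans (cong -_ e) (solve 2 (λ b c → :- (b :* c) := b :* (:- c)) refl b c)

    θ-π* : ∀ {e z t} → e ≡ π * z → θ z ≡ t → θ e ≡ θ π * t
    θ-π* {z = z} e≡ p = trans (cong θ e≡) (trans (θ-* π z) (cong (θ π *_) p))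

    self-difference : ∀ i {r} → ζ i * (y * r) + - (ζ i * r) ≡ (y + - ζ zero) * (ζ i * r)
    self-difference i {r} = solve 3 (λ y z r → z :* (y :* r) :+ (:- (z :* r)) := (y :+ (:- con (1 , 0))) :* (z :* r)) refl y (ζ i) r

    level0-hexagon : ∀ {e} → e ≢ 0# → θ e ≡ θ (y + - ζ zero) → (zero , e) ∈ concatMap Δ base
    level0-hexagon e≢0 θe =
      let i , r , r∈ , e≡ = in-class-1 (difference-≢0 (y≢ζ zero)) e≢0 θe
      in difference-∈ (hexagon-∈ r∈) (∈-hexagon′ i) (∈-hexagon i) (same i) (trans e≡ (sym (self-difference i))) e≢0
      where
      same : ∀ i → i +₃ (-₃ i) ≡ zero
      same = from-yes (Fin.all? λ i → i +₃ (-₃ i) Fin.≟ zero)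

    -- The flat triples miss the coset of the cubes containing `π`. The hexads have level 0
    -- differences in the coset of `y - 1`, and alignment makes these fill the gap up to sign.
    level0-aligned : ∀ {e z} → e ≢ 0# → e ≡ π * z → χ z ≡ 1# → (zero , e) ∈ concatMap Δ base ⊎ (zero , - e) ∈ concatMap Δ base
    level0-aligned {e} {z} e≢0 e≡ χz = [ (λ p → inj₁ (level0-hexagon e≢0 p)) , (λ p → inj₂ (level0-hexagon (-‿≢0 e≢0) p)) ]′
      (signs {e} {y + - ζ zero} (trans (cong χ e≡) (trans (χ-* π z) (trans (cong (χ π *_) χz)
        (trans (*-comm (χ π) 1#) (trans (*-identityˡ (χ π)) aligned))))))

    χ-from-θ : ∀ {z t} → θ z ≡ t → χ z ≡ t * t
    χ-from-θ {z} p = trans (χ≡θ² z) (cong₂ _*_ p p)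

    neg-square : ∀ t → - t * - t ≡ t * t
    neg-square = solve 1 (λ t → (:- t) :* (:- t) := t :* t) refl

    level0 : ∀ {e} → e ≢ 0# → (zero , e) ∈ concatMap Δ base ⊎ (zero , - e) ∈ concatMap Δ base
    level0 {e} e≢0 = from-quotient (quotient π≢0 e≢0)
      where
      from-class : ∀ {z} → e ≡ π * z → θ z ∈ sixthRoots → (zero , e) ∈ concatMap Δ base ⊎ (zero , - e) ∈ concatMap Δ base
      from-class e≡ (here p) = level0-aligned e≢0 e≡ (trans (χ-from-θ p) (*-identityˡ 1#))
      from-class e≡ (there (here p)) = inj₁ (flat-difference (here refl) e≢0 (θ-π* e≡ p))
      from-class e≡ (there (there (here p))) = inj₁ (flat-difference (there (here refl)) e≢0 (θ-π* e≡ p))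
      from-class e≡ (there (there (there (here p)))) =
        level0-aligned e≢0 e≡ (trans (χ-from-θ p) (trans (neg-square 1#) (*-identityˡ 1#)))
      from-class {z} e≡ (there (there (there (there (here p))))) =
        inj₂ (flat-difference (here refl) (-‿≢0 e≢0) (trans (θ-neg e) (neg* (θ-π* e≡ p))))
      from-class {z} e≡ (there (there (there (there (there (here p)))))) =
        inj₂ (flat-difference (there (here refl)) (-‿≢0 e≢0) (trans (θ-neg e) (neg* (θ-π* e≡ p))))
      from-quotient : ∃[ z ] (z ≢ 0# × e ≡ π * z) → (zero , e) ∈ concatMap Δ base ⊎ (zero , - e) ∈ concatMap Δ base
      from-quotient (z , z≢0 , e≡) = from-class e≡ (θ-sixth z≢0)

    level1-εy-1 : ∀ {e} → e ≢ 0# → θ e ≡ θ εy-1 → (1₃ , e) ∈ concatMap Δ base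
    level1-εy-1 e≢0 θe =
      let i , r , r∈ , e≡ = in-class-1 εy-1≢0 e≢0 θe
      in difference-∈ (hexagon-∈ r∈) (∈-hexagon′ (1₃ +₃ i)) (∈-hexagon i) (up i)
           (trans e≡ (trans (solve 4 (λ e y z r → (e :* (y :+ (:- (e :* e)))) :* (z :* r)
               := (e :* z) :* (y :* r) :+ (:- ((e :* (e :* e)) :* (z :* r)))) refl ε y (ζ i) r)
             (cong₂ (λ u v → u * (y * r) + - v) (ζ-suc i) (trans (cong (_* (ζ i * r)) ε³≡1) (*-identityˡ (ζ i * r)))))) e≢0

    level1-ε-y : ∀ {e} → e ≢ 0# → θ e ≡ θ ε-y → (1₃ , e) ∈ concatMap Δ base
    level1-ε-y e≢0 θe =
      let i , r , r∈ , e≡ = in-class-1 ε-y≢0 e≢0 θe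
      in difference-∈ (hexagon-∈ r∈) (∈-hexagon (1₃ +₃ i)) (∈-hexagon′ i) (up i)
           (trans e≡ (trans (solve 4 (λ e y z r → (:- (y :+ (:- e))) :* (z :* r)
               := (e :* z) :* r :+ (:- (z :* (y :* r)))) refl ε y (ζ i) r)
             (cong (λ u → u * r + - (ζ i * (y * r))) (ζ-suc i)))) e≢0

    level1-π : ∀ {e} → e ≢ 0# → θ e ≡ θ π → (1₃ , e) ∈ concatMap Δ base
    level1-π e≢0 θe =
      let i , r , r∈ , e≡ = in-class-1 π≢0 e≢0 θe
      in difference-∈ (hexagon-∈ r∈) (∈-hexagon (1₃ +₃ i)) (∈-hexagon i) (up i) (trans e≡ (π* i r)) e≢0

    level1-πy : ∀ {e} → e ≢ 0# → θ e ≡ θ (π * y) → (1₃ , e) ∈ concatMap Δ base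
    level1-πy e≢0 θe =
      let i , r , r∈ , e≡ = in-class-1 (*-≢0 π≢0 y≢0) e≢0 θe
      in difference-∈ (hexagon-∈ r∈) (∈-hexagon′ (1₃ +₃ i)) (∈-hexagon′ i) (up i)
           (trans e≡ (trans (solve 4 (λ p y z r → (p :* y) :* (z :* r) := p :* (z :* (y :* r))) refl π y (ζ i) r)
             (π* i (y * r)))) e≢0

    -- `W` meets only the cosets of the cubes of `y - ε` and `y - ε²`. The third one is that of `π`,
    -- by alignment, and `χ z ≢ 1#` excludes it.
    W-up-to-sign : ∀ {e z} → e ≢ 0# → e ≡ π * z → χ z ≢ 1# → θ e ∉ W → θ (- e) ∈ W
    W-up-to-sign {e} {z} e≢0 e≡ χz≢1 e∉W = [ (λ p → contradiction (misaligned p) χz≢1) , [ use-ε-y , use-εy-1 ]′ ]′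
      (cube-roots-exhausted (χ-cube (difference-≢0 (y≢ζ zero))) (χ-cube (difference-≢0 (y≢ζ 1₃)))
        (χ-cube (difference-≢0 (y≢ζ 2₃))) separated (χ-cube e≢0))
      where
      misaligned : χ e ≡ χ (y + - ζ zero) → χ z ≡ 1#
      misaligned p = *-cancelˡ (^-≢0 (6 ℕ.* n) π≢0) (trans (sym (χ-* π z)) (trans (cong χ (sym e≡))
        (trans p (trans (sym aligned) (sym (*-identityʳ (χ π)))))))
      use-ε-y : χ e ≡ χ (y + - ζ 1₃) → θ (- e) ∈ W
      use-ε-y p = [ (λ r → contradiction (there (here r)) e∉W) , (λ r → there (here r)) ]′
        (signs {e} {ε-y} (trans p (sym (χ-neg (y + - ζ 1₃)))))
      use-εy-1 : χ e ≡ χ (y + - ζ 2₃) → θ (- e) ∈ W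
      use-εy-1 p = [ (λ r → contradiction (here r) e∉W) , here ]′
        (signs {e} {εy-1} (trans p (sym (trans (χ-* ε (y + - ζ 2₃))
          (trans (cong (_* χ (y + - ζ 2₃)) (χ-ζ 1₃)) (*-identityˡ _))))))

    level1 : ∀ {e} → e ≢ 0# → (1₃ , e) ∈ concatMap Δ base
    level1 {e} e≢0 = by-W (θ e ∈? W)
      where
      ε⁴≢1 : (ε * ε) * (ε * ε) ≢ 1#
      ε⁴≢1 p = ε≢1 (trans (sym (trans (solve 1 (λ e → (e :* e) :* (e :* e) := (e :* (e :* e)) :* e) refl ε)
        (trans (cong (_* ε) ε³≡1) (*-identityˡ ε)))) p)
      from-class : ∀ {z} → θ e ∉ W → e ≡ π * z → θ z ∈ sixthRoots → (1₃ , e) ∈ concatMap Δ base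
      from-class e∉W e≡ (here p) =
        level1-π e≢0 (trans (θ-π* e≡ p) (*-identityʳ (θ π)))
      from-class e∉W e≡ (there (here p)) = steep-difference W (there (there (here refl))) e≢0
        (inj₂ (trans (θ-neg e) (neg*′ (θ-π* e≡ p)) ,
          W-up-to-sign e≢0 e≡ (λ r → ε²≢1 (trans (sym (χ-from-θ p)) r)) e∉W))
      from-class e∉W e≡ (there (there (here p))) = steep-difference W (there (there (there (here refl)))) e≢0
        (inj₂ (trans (θ-neg e) (neg*′ (θ-π* e≡ p)) ,
          W-up-to-sign e≢0 e≡ (λ r → ε⁴≢1 (trans (sym (χ-from-θ p)) r)) e∉W))
      from-class e∉W e≡ (there (there (there (here p)))) =
        level1-πy e≢0 (trans (θ-π* e≡ (trans p (sym θy≡-1))) (sym (θ-* π y)))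
      from-class e∉W e≡ (there (there (there (there (here p))))) =
        steep-difference W (there (there (here refl))) e≢0 (inj₁ (θ-π* e≡ p , e∉W))
      from-class e∉W e≡ (there (there (there (there (there (here p)))))) =
        steep-difference W (there (there (there (here refl)))) e≢0 (inj₁ (θ-π* e≡ p , e∉W))
      from-quotient : θ e ∉ W → ∃[ z ] (z ≢ 0# × e ≡ π * z) → (1₃ , e) ∈ concatMap Δ base
      from-quotient e∉W (z , z≢0 , e≡) = from-class e∉W e≡ (θ-sixth z≢0)
      by-W : Dec (θ e ∈ W) → (1₃ , e) ∈ concatMap Δ base
      by-W (no e∉W) = from-quotient e∉W (quotient π≢0 e≢0)
      by-W (yes (here p)) = level1-εy-1 e≢0 p
      by-W (yes (there (here p))) = level1-ε-y e≢0 p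

    cover : ∀ {e} → e ≢ 0# → ∃[ B ] ∃[ δ ] (B ∈ base × (δ , e) ∈ B)
    cover {e} e≢0 = from-class (θ-sixth e≢0)
      where
      from-class : θ e ∈ sixthRoots → ∃[ B ] ∃[ δ ] (B ∈ base × (δ , e) ∈ B)
      from-class (here p) = hexagon-point e≢0 p
      from-class (there (here p)) = triple-point (here refl) e≢0 p
      from-class (there (there (here p))) = triple-point (there (here refl)) e≢0 p
      from-class (there (there (there (here p)))) = hexagon-point′ y≢0 e≢0 (trans p (sym θy≡-1))
      from-class (there (there (there (there (here p))))) = triple-point (there (there (here refl))) e≢0 p
      from-class (there (there (there (there (there (here p)))))) = triple-point (there (there (there (here refl)))) e≢0 p

    caseII : Starter
    caseII = starter refl
      (there (here refl) ∷ there (there (here refl)) ∷ there (there (there (there (here refl)))) ∷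
        there (there (there (there (there (here refl))))) ∷ [])
      level0 level1 cover

  -- `ε y - ζ i` is `ε` times `y - ε² ζ i`, and `ε` is a cube. Replacing `y` by `ε y` therefore
  -- permutes the three separated characters cyclically.
  χ-rotate : ∀ y i → χ (ε * y + - ζ i) ≡ χ (y + - ζ (2₃ +₃ i))
  χ-rotate y i = trans (cong χ (trans
      (solve 3 (λ e y z → e :* y :+ (:- z) := e :* (y :+ (:- ((e :* e) :* z))) :+ (e :* (e :* e) :* z :+ (:- z))) refl ε y (ζ i))
      (trans (cong (λ w → ε * (y + - (ε * ε * ζ i)) + (w * ζ i + - ζ i)) ε³≡1)
        (trans (cong (ε * (y + - (ε * ε * ζ i)) +_) (trans (cong (_+ - ζ i) (*-identityˡ (ζ i))) (-‿inverseʳ (ζ i))))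
          (trans (+-identityʳ _) (cong (λ w → ε * (y + - w)) (ζ-+ 2₃ i)))))))
    (trans (χ-* ε (y + - ζ (2₃ +₃ i))) (trans (cong (_* χ (y + - ζ (2₃ +₃ i))) (χ-ζ 1₃)) (*-identityˡ _)))

  rotate : ∀ {y} → Good y → Good (ε * y)
  rotate {y} good = record
    { y≢0 = *-≢0 ε≢0 y≢0
    ; y≢ζ = λ i e → y≢ζ (2₃ +₃ i) (trans (sym (trans (*-assoc ε ε (ε * y)) (ε³* y)))
        (trans (cong (ε * ε *_) e) (ζ-+ 2₃ i)))
    ; separated = distinct
        (λ e → a≢c (trans (sym (χ-rotate y 1₃)) (trans (sym e) (χ-rotate y zero))))
        (λ e → b≢c (trans (sym (χ-rotate y 2₃)) (trans (sym e) (χ-rotate y zero))))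
        (λ e → a≢b (trans (sym (χ-rotate y 1₃)) (trans e (χ-rotate y 2₃))))
    ; θ≢1 = λ e → θ≢1 (trans (sym (θ-ζ* 1₃ y)) e)
    }
    where
    open Good good
    open Distinct separated

  -- The three separated characters exhaust the cube roots of unity, so one of them is `χ π`; at
  -- most two rotations bring it to the front, and they do not affect `θ y`.
  aligned-rotation : ∀ {y} → Good y → ∃[ y′ ] (Good y′ × θ y′ ≡ θ y × χ π ≡ χ (y′ + - ζ zero))
  aligned-rotation {y} good = [ (λ p → y , good , refl , p) , [ two , one ]′ ]′
    (cube-roots-exhausted (χ-cube (difference-≢0 (y≢ζ zero))) (χ-cube (difference-≢0 (y≢ζ 1₃)))
      (χ-cube (difference-≢0 (y≢ζ 2₃))) separated (χ-cube π≢0))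
    where
    open Good good
    one : χ π ≡ χ (y + - ζ 2₃) → _
    one p = ε * y , rotate good , θ-ζ* 1₃ y , trans p (sym (χ-rotate y zero))
    two : χ π ≡ χ (y + - ζ 1₃) → _
    two p = ε * (ε * y) , rotate (rotate good) , trans (θ-ζ* 1₃ (ε * y)) (θ-ζ* 1₃ y) ,
      trans p (sym (trans (χ-rotate (ε * y) zero) (χ-rotate y 2₃)))

  good⇒starter : ∀ {y} → Good y → Starter
  good⇒starter {y} good = by-χ (χ y ≟ 1#)
    where
    by-sign : θ y ≡ 1# ⊎ θ y ≡ - 1# → Starter
    by-sign (inj₁ p) = contradiction p (Good.θ≢1 good)
    by-sign (inj₂ p) = let y′ , good′ , θy′ , aligned = aligned-rotation good in
      CaseII.caseII y′ good′ (trans θy′ p) aligned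
    by-χ : Dec (χ y ≡ 1#) → Starter
    by-χ (no χy≢1) = CaseI.caseI y good χy≢1
    by-χ (yes χy≡1) = by-sign (squares-≡ (trans (sym (χ≡θ² y)) (trans χy≡1 (sym (*-identityˡ 1#)))))

-- Cyclotomic numbers of order three

-- The square of `x - c` is nonnegative: the parabola lies above its tangent at `c`, stated without
-- subtraction.
square-tangent : ∀ c x → 2 ℕ.* c ℕ.* x ≤ x ℕ.* x ℕ.+ c ℕ.* c
square-tangent c x = [ below , above ]′ (ℕ.≤-total c x)
  where
  expand : ∀ a d → 2 ℕ.* a ℕ.* (a ℕ.+ d) ℕ.+ d ℕ.* d ≡ (a ℕ.+ d) ℕ.* (a ℕ.+ d) ℕ.+ a ℕ.* a
  expand = solve-∀
  expand′ : ∀ a d → 2 ℕ.* (a ℕ.+ d) ℕ.* a ℕ.+ d ℕ.* d ≡ a ℕ.* a ℕ.+ (a ℕ.+ d) ℕ.* (a ℕ.+ d)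
  expand′ = solve-∀
  below : c ≤ x → 2 ℕ.* c ℕ.* x ≤ x ℕ.* x ℕ.+ c ℕ.* c
  below c≤x = subst (λ z → 2 ℕ.* c ℕ.* z ≤ z ℕ.* z ℕ.+ c ℕ.* c) (ℕ.m+[n∸m]≡n c≤x)
    (subst (2 ℕ.* c ℕ.* (c ℕ.+ (x ℕ.∸ c)) ≤_) (expand c (x ℕ.∸ c)) (ℕ.m≤m+n _ _))
  above : x ≤ c → 2 ℕ.* c ℕ.* x ≤ x ℕ.* x ℕ.+ c ℕ.* c
  above x≤c = subst (λ z → 2 ℕ.* z ℕ.* x ≤ x ℕ.* x ℕ.+ z ℕ.* z) (ℕ.m+[n∸m]≡n x≤c)
    (subst (2 ℕ.* (x ℕ.+ (c ℕ.∸ x)) ℕ.* x ≤_) (expand′ x (c ℕ.∸ x)) (ℕ.m≤m+n _ _))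

sum-squares-tangent : ∀ c xs → 2 ℕ.* c ℕ.* sum xs ≤ sum (map (λ x → x ℕ.* x) xs) ℕ.+ length xs ℕ.* (c ℕ.* c)
sum-squares-tangent c [] = ℕ.≤-reflexive (ℕ.*-zeroʳ (2 ℕ.* c))
sum-squares-tangent c (x ∷ xs) = begin
  2 ℕ.* c ℕ.* (x ℕ.+ sum xs)
    ≡⟨ ℕ.*-distribˡ-+ (2 ℕ.* c) x (sum xs) ⟩
  2 ℕ.* c ℕ.* x ℕ.+ 2 ℕ.* c ℕ.* sum xs
    ≤⟨ ℕ.+-mono-≤ (square-tangent c x) (sum-squares-tangent c xs) ⟩
  (x ℕ.* x ℕ.+ c ℕ.* c) ℕ.+ (S ℕ.+ length xs ℕ.* (c ℕ.* c))
    ≡⟨ arithmetic (x ℕ.* x) (c ℕ.* c) S (length xs ℕ.* (c ℕ.* c)) ⟩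
  (x ℕ.* x ℕ.+ S) ℕ.+ (c ℕ.* c ℕ.+ length xs ℕ.* (c ℕ.* c)) ∎
  where
  open ℕ.≤-Reasoning
  S = sum (map (λ x → x ℕ.* x) xs)
  arithmetic : ∀ a b s l → (a ℕ.+ b) ℕ.+ (s ℕ.+ l) ≡ (a ℕ.+ s) ℕ.+ (b ℕ.+ l)
  arithmetic = solve-∀

-- If two of the nine cells had at most 6 m points together, then the tangents at 3 m (for these two)
-- and at 4 m + 2 (for the other seven) would push the sum of squares above the available bound.
cells-contradiction : ∀ m s t A B → s ≤ 6 ℕ.* m → 36 ℕ.* m ℕ.+ 17 ≤ s ℕ.+ t →
  A ℕ.+ B ≤ 36 ℕ.* m ℕ.+ 19 ℕ.+ (12 ℕ.* m ℕ.+ 5) ℕ.* (12 ℕ.* m ℕ.+ 4) →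
  2 ℕ.* (3 ℕ.* m) ℕ.* s ≤ A ℕ.+ 2 ℕ.* ((3 ℕ.* m) ℕ.* (3 ℕ.* m)) →
  2 ℕ.* (4 ℕ.* m ℕ.+ 2) ℕ.* t ≤ B ℕ.+ 7 ℕ.* ((4 ℕ.* m ℕ.+ 2) ℕ.* (4 ℕ.* m ℕ.+ 2)) → ⊥
cells-contradiction m s t A B s≤ total squares tangent-s tangent-t = ℕ.<-irrefl refl (begin-strict
  36 ℕ.* m ℕ.* m ℕ.+ (8 ℕ.* m ℕ.+ 4) ℕ.* (30 ℕ.* m ℕ.+ 17)
    ≡⟨ split m s d (sym s+d) ⟩
  2 ℕ.* (3 ℕ.* m) ℕ.* s ℕ.+ (6 ℕ.* m ℕ.* d ℕ.+ (8 ℕ.* m ℕ.+ 4) ℕ.* (30 ℕ.* m ℕ.+ 17))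
    -- What the two cells lack, `d`, has to sit in the other seven, where the tangent is at least as
    -- steep.
    ≤⟨ ℕ.+-monoʳ-≤ (2 ℕ.* (3 ℕ.* m) ℕ.* s) (ℕ.+-monoˡ-≤ _ (ℕ.*-monoˡ-≤ d 6m≤8m+4)) ⟩
  2 ℕ.* (3 ℕ.* m) ℕ.* s ℕ.+ ((8 ℕ.* m ℕ.+ 4) ℕ.* d ℕ.+ (8 ℕ.* m ℕ.+ 4) ℕ.* (30 ℕ.* m ℕ.+ 17))
    ≡⟨ cong (2 ℕ.* (3 ℕ.* m) ℕ.* s ℕ.+_) (collect m d) ⟩
  2 ℕ.* (3 ℕ.* m) ℕ.* s ℕ.+ 2 ℕ.* (4 ℕ.* m ℕ.+ 2) ℕ.* (d ℕ.+ (30 ℕ.* m ℕ.+ 17))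
    ≤⟨ ℕ.+-mono-≤ tangent-s (ℕ.≤-trans (ℕ.*-monoʳ-≤ (2 ℕ.* (4 ℕ.* m ℕ.+ 2)) t≥) tangent-t) ⟩
  (A ℕ.+ 2 ℕ.* ((3 ℕ.* m) ℕ.* (3 ℕ.* m))) ℕ.+ (B ℕ.+ 7 ℕ.* ((4 ℕ.* m ℕ.+ 2) ℕ.* (4 ℕ.* m ℕ.+ 2)))
    ≡⟨ regroup m A B ⟩
  (A ℕ.+ B) ℕ.+ (130 ℕ.* (m ℕ.* m) ℕ.+ 112 ℕ.* m ℕ.+ 28)
    ≤⟨ ℕ.+-monoˡ-≤ _ squares ⟩
  (36 ℕ.* m ℕ.+ 19 ℕ.+ (12 ℕ.* m ℕ.+ 5) ℕ.* (12 ℕ.* m ℕ.+ 4)) ℕ.+ (130 ℕ.* (m ℕ.* m) ℕ.+ 112 ℕ.* m ℕ.+ 28)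
    -- The two sides differ by exactly `1 + 2 m²`.
    <⟨ ℕ.m<m+n _ (s≤s (z≤n {2 ℕ.* (m ℕ.* m)})) ⟩
  (36 ℕ.* m ℕ.+ 19 ℕ.+ (12 ℕ.* m ℕ.+ 5) ℕ.* (12 ℕ.* m ℕ.+ 4)) ℕ.+ (130 ℕ.* (m ℕ.* m) ℕ.+ 112 ℕ.* m ℕ.+ 28)
    ℕ.+ (1 ℕ.+ 2 ℕ.* (m ℕ.* m))
    ≡⟨ final m ⟩
  36 ℕ.* m ℕ.* m ℕ.+ (8 ℕ.* m ℕ.+ 4) ℕ.* (30 ℕ.* m ℕ.+ 17) ∎)
  where
  open ℕ.≤-Reasoning
  d = 6 ℕ.* m ℕ.∸ s
  s+d : s ℕ.+ d ≡ 6 ℕ.* m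
  s+d = ℕ.m+[n∸m]≡n s≤
  6m≤8m+4 : 6 ℕ.* m ≤ 8 ℕ.* m ℕ.+ 4
  6m≤8m+4 = ℕ.≤-trans (ℕ.*-monoˡ-≤ m {6} {8} (ℕ.m≤m+n 6 2)) (ℕ.m≤m+n (8 ℕ.* m) 4)
  t≥ : d ℕ.+ (30 ℕ.* m ℕ.+ 17) ≤ t
  t≥ = ℕ.+-cancelˡ-≤ s _ _ (ℕ.≤-trans (ℕ.≤-reflexive (trans (sym (ℕ.+-assoc s d _))
    (trans (cong (ℕ._+ (30 ℕ.* m ℕ.+ 17)) s+d) (add m)))) total)
    where
    add : ∀ m → 6 ℕ.* m ℕ.+ (30 ℕ.* m ℕ.+ 17) ≡ 36 ℕ.* m ℕ.+ 17
    add = solve-∀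
  split : ∀ m s d → 6 ℕ.* m ≡ s ℕ.+ d → 36 ℕ.* m ℕ.* m ℕ.+ (8 ℕ.* m ℕ.+ 4) ℕ.* (30 ℕ.* m ℕ.+ 17)
    ≡ 2 ℕ.* (3 ℕ.* m) ℕ.* s ℕ.+ (6 ℕ.* m ℕ.* d ℕ.+ (8 ℕ.* m ℕ.+ 4) ℕ.* (30 ℕ.* m ℕ.+ 17))
  split m s d e = trans (cong (ℕ._+ K) (trans (factor m) (cong (6 ℕ.* m ℕ.*_) e))) (expand m s d K)
    where
    K = (8 ℕ.* m ℕ.+ 4) ℕ.* (30 ℕ.* m ℕ.+ 17)
    factor : ∀ m → 36 ℕ.* m ℕ.* m ≡ 6 ℕ.* m ℕ.* (6 ℕ.* m)
    factor = solve-∀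
    expand : ∀ m s d K → 6 ℕ.* m ℕ.* (s ℕ.+ d) ℕ.+ K ≡ 2 ℕ.* (3 ℕ.* m) ℕ.* s ℕ.+ (6 ℕ.* m ℕ.* d ℕ.+ K)
    expand = solve-∀
  collect : ∀ m d → (8 ℕ.* m ℕ.+ 4) ℕ.* d ℕ.+ (8 ℕ.* m ℕ.+ 4) ℕ.* (30 ℕ.* m ℕ.+ 17)
    ≡ 2 ℕ.* (4 ℕ.* m ℕ.+ 2) ℕ.* (d ℕ.+ (30 ℕ.* m ℕ.+ 17))
  collect = solve-∀
  regroup : ∀ m A B → (A ℕ.+ 2 ℕ.* ((3 ℕ.* m) ℕ.* (3 ℕ.* m))) ℕ.+ (B ℕ.+ 7 ℕ.* ((4 ℕ.* m ℕ.+ 2) ℕ.* (4 ℕ.* m ℕ.+ 2)))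
    ≡ (A ℕ.+ B) ℕ.+ (130 ℕ.* (m ℕ.* m) ℕ.+ 112 ℕ.* m ℕ.+ 28)
  regroup = solve-∀
  final : ∀ m → (36 ℕ.* m ℕ.+ 19 ℕ.+ (12 ℕ.* m ℕ.+ 5) ℕ.* (12 ℕ.* m ℕ.+ 4)) ℕ.+ (130 ℕ.* (m ℕ.* m) ℕ.+ 112 ℕ.* m ℕ.+ 28)
    ℕ.+ (1 ℕ.+ 2 ℕ.* (m ℕ.* m)) ≡ 36 ℕ.* m ℕ.* m ℕ.+ (8 ℕ.* m ℕ.+ 4) ℕ.* (30 ℕ.* m ℕ.+ 17)
  final = solve-∀

length-filter-¬ : ∀ {a p} {A : Set a} {P : Pred A p} (P? : Decidable P) (xs : List A) →
  length xs ≡ length (filter P? xs) ℕ.+ length (filter (λ x → ¬? (P? x)) xs)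
length-filter-¬ P? [] = refl
length-filter-¬ P? (x ∷ xs) with P? x
... | yes _ = cong suc (length-filter-¬ P? xs)
... | no _ = trans (cong suc (length-filter-¬ P? xs)) (sym (ℕ.+-suc _ _))

-- Existence of a suitable `y`

module Existence {q : ℕ} (F : FiniteField q) (n m : ℕ) (n≡2m+1 : n ≡ 2 ℕ.* m ℕ.+ 1) (q≡18n+1 : q ≡ 18 ℕ.* n ℕ.+ 1)
  (ε : FiniteField.Carrier F) (ε≢1 : ε ≢ FiniteField.1# F)
  (ε³≡1 : FiniteField._*_ F ε (FiniteField._*_ F ε ε) ≡ FiniteField.1# F) where
  open FiniteField F
  open Field F
  open Roots F
  open Cyclotomy F n m n≡2m+1 q≡18n+1 ε ε≢1 ε³≡1
  open Construction F n m n≡2m+1 q≡18n+1 ε ε≢1 ε³≡1 using (Good; 1₃; 2₃; good⇒starter; Starter)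

  -- Total inversion, with value 0 at 0, so that `mobius` and `code` are plain functions that can be
  -- mapped over lists.
  reciprocal : Carrier → Carrier
  reciprocal x with x ≟ 0#
  ... | yes _ = 0#
  ... | no x≢0 = inv x≢0

  *-reciprocal : ∀ {x} → x ≢ 0# → x * reciprocal x ≡ 1#
  *-reciprocal {x} x≢0 with x ≟ 0#
  ... | yes x≡0 = contradiction x≡0 x≢0
  ... | no x≢0′ = *-inv x≢0′

  ratio : Carrier → Carrier → Carrier
  ratio x y = x * reciprocal y

  ratio-* : ∀ {x y} → y ≢ 0# → ratio x y * y ≡ x
  ratio-* {x} {y} y≢0 = trans (solve 3 (λ x y r → (x :* r) :* y := x :* (y :* r)) refl x y (reciprocal y))
    (trans (cong (x *_) (*-reciprocal y≢0)) (*-identityʳ x))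

  record Separating (x : Carrier) : Set where
    field
      χx≢1 : χ x ≢ 1#
      χ[1+x]≢1 : χ (1# + x) ≢ 1#
      χx≢χ[1+x] : χ x ≢ χ (1# + x)
      x≢0 : x ≢ 0#
      1+x≢0 : 1# + x ≢ 0#

  -- The zero-sum triple (1, x, -(1 + x)) is proportional to (y - 1, ε (y - ε), ε² (y - ε²)) for this y.
  mobius : Carrier → Carrier
  mobius x = ratio (x + - (ε * ε)) (x + - ε)

  module _ {x : Carrier} (sep : Separating x) where
    open Separating sep

    x-ε≢0 : x + - ε ≢ 0#
    x-ε≢0 = difference-≢0 (λ e → χx≢1 (trans (cong χ e) (χ-ζ 1₃)))

    private
      r = reciprocal (x + - ε)

      r≢0 : r ≢ 0#
      r≢0 = factor-≢0ʳ (λ e → 1≢0 (trans (sym (*-reciprocal x-ε≢0)) e))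

      -- The common factor of the three differences `mobius x - ζ i`, whose cofactors are `ε`, `x`
      -- and `- ε² (1 + x)`. As `ε` and `- ε²` are cubes, separation of the differences reduces to
      -- 1, `χ x` and `χ (1 + x)` being distinct.
      λ₀ = (1# + - ε) * r

      λ₀≢0 : λ₀ ≢ 0#
      λ₀≢0 = *-≢0 (difference-≢0 (λ e → ε≢1 (sym e))) r≢0

      mobius-minus : ∀ z → mobius x + - z ≡ ((x + - (ε * ε)) + - (z * (x + - ε))) * r
      mobius-minus z = trans (cong (λ w → mobius x + - w)
          (trans (sym (*-identityʳ z)) (cong (z *_) (sym (*-reciprocal x-ε≢0)))))
        (solve 4 (λ a b r z → a :* r :+ (:- (z :* (b :* r))) := (a :+ (:- (z :* b))) :* r) refl
          (x + - (ε * ε)) (x + - ε) r z)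

      mobius-1 : mobius x + - ζ zero ≡ ε * λ₀
      mobius-1 = trans (mobius-minus 1#)
        (solve 3 (λ x e r → ((x :+ (:- (e :* e))) :+ (:- (con (1 , 0) :* (x :+ (:- e))))) :* r
          := e :* ((con (1 , 0) :+ (:- e)) :* r)) refl x ε r)

      mobius-ε : mobius x + - ζ 1₃ ≡ x * λ₀
      mobius-ε = trans (mobius-minus ε)
        (solve 3 (λ x e r → ((x :+ (:- (e :* e))) :+ (:- (e :* (x :+ (:- e))))) :* r
          := x :* ((con (1 , 0) :+ (:- e)) :* r)) refl x ε r)

      mobius-ε² : mobius x + - ζ 2₃ ≡ (- (ε * ε) * (1# + x)) * λ₀
      mobius-ε² = trans (mobius-minus (ε * ε)) (trans
        -- The identity holds only modulo `ε³ ≡ 1`, so one `x` becomes `ε³ x` before the solver is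
        -- called.
        (cong (λ w → ((w + - (ε * ε)) + - (ε * ε * (x + - ε))) * r) (sym (trans (cong (_* x) ε³≡1) (*-identityˡ x))))
        (solve 3 (λ x e r → ((e :* (e :* e) :* x :+ (:- (e :* e))) :+ (:- (e :* e :* (x :+ (:- e))))) :* r
          := ((:- (e :* e)) :* (con (1 , 0) :+ x)) :* ((con (1 , 0) :+ (:- e)) :* r)) refl x ε r))

      mobius-ζ≢0 : ∀ i → mobius x + - ζ i ≢ 0#
      mobius-ζ≢0 zero = subst (_≢ 0#) (sym mobius-1) (*-≢0 ε≢0 λ₀≢0)
      mobius-ζ≢0 (suc zero) = subst (_≢ 0#) (sym mobius-ε) (*-≢0 x≢0 λ₀≢0)
      mobius-ζ≢0 (suc (suc zero)) = subst (_≢ 0#) (sym mobius-ε²) (*-≢0 (*-≢0 (-‿≢0 (*-≢0 ε≢0 ε≢0)) 1+x≢0) λ₀≢0)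

      χ-1 : χ (mobius x + - ζ zero) ≡ 1# * χ λ₀
      χ-1 = trans (cong χ mobius-1) (trans (χ-* ε λ₀) (cong (_* χ λ₀) (χ-ζ 1₃)))

      χ-ε : χ (mobius x + - ζ 1₃) ≡ χ x * χ λ₀
      χ-ε = trans (cong χ mobius-ε) (χ-* x λ₀)

      χ-ε² : χ (mobius x + - ζ 2₃) ≡ χ (1# + x) * χ λ₀
      χ-ε² = trans (cong χ mobius-ε²) (trans (χ-* (- (ε * ε) * (1# + x)) λ₀) (cong (_* χ λ₀)
        (trans (χ-* (- (ε * ε)) (1# + x)) (trans (cong (_* χ (1# + x)) (trans (χ-neg (ε * ε)) (χ-ζ 2₃))) (*-identityˡ _)))))

      cancel : ∀ {u v} → u * χ λ₀ ≡ v * χ λ₀ → u ≡ v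
      cancel {u} {v} e = *-cancelˡ (^-≢0 (6 ℕ.* n) λ₀≢0) (trans (*-comm (χ λ₀) u) (trans e (*-comm v (χ λ₀))))

    mobius≢ζ : ∀ i → mobius x ≢ ζ i
    mobius≢ζ i e = mobius-ζ≢0 i (trans (cong (_+ - ζ i) e) (-‿inverseʳ (ζ i)))

    mobius-good : θ (mobius x) ≢ 1# → Good (mobius x)
    mobius-good θ≢1 = record
      { y≢0 = *-≢0 (difference-≢0 (λ e → χx≢1 (trans (cong χ e) (χ-ζ 2₃)))) r≢0
      ; y≢ζ = mobius≢ζ
      ; separated = distinct
          (λ e → χx≢1 (sym (cancel (trans (sym χ-1) (trans e χ-ε)))))
          (λ e → χ[1+x]≢1 (sym (cancel (trans (sym χ-1) (trans e χ-ε²)))))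
          (λ e → χx≢χ[1+x] (cancel (trans (sym χ-ε) (trans e χ-ε²))))
      ; θ≢1 = θ≢1
      }

    -- The defining fraction, cleared and solved for `x`; since `mobius x` is not 1, it recovers `x`
    -- from `mobius x`.
    mobius-equation : (mobius x + - 1#) * x ≡ mobius x * ε + - (ε * ε)
    mobius-equation = trans
      (solve 3 (λ y x e → (y :+ (:- con (1 , 0))) :* x := y :* (x :+ (:- e)) :+ (y :* e :+ (:- x))) refl (mobius x) x ε)
      (trans (cong (_+ (mobius x * ε + - x)) (ratio-* x-ε≢0))
        (solve 3 (λ y x e → (x :+ (:- (e :* e))) :+ (y :* e :+ (:- x)) := y :* e :+ (:- (e :* e))) refl (mobius x) x ε))

  mobius-injective : ∀ {x x′} → Separating x → Separating x′ → mobius x ≡ mobius x′ → x ≡ x′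
  mobius-injective {x} {x′} sep sep′ e = *-cancelˡ (difference-≢0 (mobius≢ζ sep zero))
    (trans (mobius-equation sep) (trans (cong (λ y → y * ε + - (ε * ε)) e)
      (trans (sym (mobius-equation sep′)) (cong (λ y → (y + - 1#) * x′) (sym e)))))

  -- The cell of (a , b) consists of the x with cubic characters χ x = a and χ (1 + x) = b, as for
  -- cyclotomic numbers of order three.
  Key : Set
  Key = Carrier × Carrier

  key : Carrier → Key
  key x = χ x , χ (1# + x)

  admissible : List Carrier
  admissible = filter (λ x → ¬? (x ≟ 0#) ×-dec ¬? ((1# + x) ≟ 0#)) elements

  cell : Key → List Carrier
  cell (a , b) = filter (λ x → (χ x ≟ a) ×-dec (χ (1# + x) ≟ b)) admissible

  admissible! : Unique admissible
  admissible! = Unique.filter⁺ (λ x → ¬? (x ≟ 0#) ×-dec ¬? ((1# + x) ≟ 0#)) elements!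

  cell! : ∀ k → Unique (cell k)
  cell! (a , b) = Unique.filter⁺ (λ x → (χ x ≟ a) ×-dec (χ (1# + x) ≟ b)) admissible!

  ∈-admissible⁻ : ∀ {x} → x ∈ admissible → x ≢ 0# × 1# + x ≢ 0#
  ∈-admissible⁻ x∈ = proj₂ (∈-filter⁻ (λ x → ¬? (x ≟ 0#) ×-dec ¬? ((1# + x) ≟ 0#)) {xs = elements} x∈)

  ∈-cell⁻ : ∀ {k x} → x ∈ cell k → (x ≢ 0# × 1# + x ≢ 0#) × key x ≡ k
  ∈-cell⁻ {a , b} x∈ = let x∈′ , p , r = ∈-filter⁻ (λ x → (χ x ≟ a) ×-dec (χ (1# + x) ≟ b)) {xs = admissible} x∈
    in ∈-admissible⁻ x∈′ , cong₂ _,_ p r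

  ∈-cell⁺ : ∀ {x} → x ∈ admissible → x ∈ cell (key x)
  ∈-cell⁺ {x} x∈ = ∈-filter⁺ (λ z → (χ z ≟ χ x) ×-dec (χ (1# + z) ≟ χ (1# + x))) x∈ (refl , refl)

  -- The good cells hold the `x` whose two characters are nontrivial and different. Listing them
  -- first lets sums over the nine cells split at the append.
  goodKeys badKeys keys : List Key
  goodKeys = (ε , ε * ε) ∷ (ε * ε , ε) ∷ []
  badKeys = (1# , 1#) ∷ (1# , ε) ∷ (1# , ε * ε) ∷ (ε , 1#) ∷ (ε , ε) ∷ (ε * ε , 1#) ∷ (ε * ε , ε * ε) ∷ []
  keys = goodKeys ++ badKeys

  keys-complete : ∀ {a b} → a ≡ 1# ⊎ a ≡ ε ⊎ a ≡ ε * ε → b ≡ 1# ⊎ b ≡ ε ⊎ b ≡ ε * ε → (a , b) ∈ keys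
  keys-complete (inj₁ refl) (inj₁ refl) = there (there (here refl))
  keys-complete (inj₁ refl) (inj₂ (inj₁ refl)) = there (there (there (here refl)))
  keys-complete (inj₁ refl) (inj₂ (inj₂ refl)) = there (there (there (there (here refl))))
  keys-complete (inj₂ (inj₁ refl)) (inj₁ refl) = there (there (there (there (there (here refl)))))
  keys-complete (inj₂ (inj₁ refl)) (inj₂ (inj₁ refl)) = there (there (there (there (there (there (here refl))))))
  keys-complete (inj₂ (inj₁ refl)) (inj₂ (inj₂ refl)) = here refl
  keys-complete (inj₂ (inj₂ refl)) (inj₁ refl) = there (there (there (there (there (there (there (here refl)))))))
  keys-complete (inj₂ (inj₂ refl)) (inj₂ (inj₁ refl)) = there (here refl)
  keys-complete (inj₂ (inj₂ refl)) (inj₂ (inj₂ refl)) = there (there (there (there (there (there (there (there (here refl))))))))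

  ζs : List Carrier
  ζs = 1# ∷ ε ∷ ε * ε ∷ []

  ζs! : Unique ζs
  ζs! = ((λ e → ε≢1 (sym e)) ∷ (λ e → ε²≢1 (sym e)) ∷ []) ∷ ((λ e → ε²≢ε (sym e)) ∷ []) ∷ [] ∷ []

  ∈-ζs : ∀ {a} → a ∈ ζs → a ≡ 1# ⊎ a ≡ ε ⊎ a ≡ ε * ε
  ∈-ζs (here e) = inj₁ e
  ∈-ζs (there (here e)) = inj₂ (inj₁ e)
  ∈-ζs (there (there (here e))) = inj₂ (inj₂ e)

  -- Pigeonhole replaces the 36 pairwise inequalities: the nine keys contain all nine pairs of cube
  -- roots of unity, which are known to be distinct.
  keys! : Unique keys
  keys! = unique-↭ (↭-sym (unique-⊆-≥⇒↭ pairs! pairs⊆ ℕ.≤-refl)) pairs!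
    where
    pairs! : Unique (cartesianProduct ζs ζs)
    pairs! = Unique.cartesianProduct⁺ ζs! ζs!
    pairs⊆ : ∀ {k} → k ∈ cartesianProduct ζs ζs → k ∈ keys
    pairs⊆ k∈ = let a∈ , b∈ = ∈-cartesianProduct⁻ ζs ζs k∈ in keys-complete (∈-ζs a∈) (∈-ζs b∈)

  ratio-≡1 : ∀ {x y} → y ≢ 0# → ratio x y ≡ 1# → x ≡ y
  ratio-≡1 {x} {y} y≢0 e = trans (sym (ratio-* y≢0)) (trans (cong (_* y) e) (*-identityˡ y))

  χ-ratio : ∀ {x y} → y ≢ 0# → χ x ≡ χ y → χ (ratio x y) ≡ 1#
  χ-ratio {x} {y} y≢0 e = *-cancelˡ (^-≢0 (6 ℕ.* n) y≢0) (trans (*-comm (χ y) _) (trans (sym (χ-* (ratio x y) y))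
    (trans (cong χ (ratio-* y≢0)) (trans e (sym (*-identityʳ (χ y)))))))

  1+-cancel : ∀ {x y} → 1# + x ≡ 1# + y → x ≡ y
  1+-cancel {x} {y} e = trans (drop x) (trans (cong (_+ - 1#) e) (sym (drop y)))
    where
    drop : ∀ x → x ≡ (1# + x) + - 1#
    drop = solve 1 (λ x → x := (con (1 , 0) :+ x) :+ (:- con (1 , 0))) refl

  code : Carrier × Carrier → Carrier × Carrier
  code (u , v) = ratio v u , ratio (1# + v) (1# + u)

  -- If both ratios were `α`, subtracting `α u ≡ v` from `α (1 + u) ≡ 1 + v` would give `α ≡ 1` and
  -- hence `u ≡ v`.
  code-distinct : ∀ {u v} → u ≢ 0# → 1# + u ≢ 0# → u ≢ v → ratio v u ≢ ratio (1# + v) (1# + u)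
  code-distinct {u} {v} u≢0 1+u≢0 u≢v e = u≢v (sym (ratio-≡1 u≢0 (difference-≡0 (begin
    α + - 1#                                 ≡⟨ solve 3 (λ a u v → a :+ (:- con (1 , 0)) := (a :* (con (1 , 0) :+ u) :+ (:- (con (1 , 0) :+ v))) :+ (v :+ (:- (a :* u)))) refl α u v ⟩
    (α * (1# + u) + - (1# + v)) + (v + - (α * u))
                                             ≡⟨ cong₂ _+_ (trans (cong (λ w → w + - (1# + v)) (trans (cong (_* (1# + u)) e) (ratio-* 1+u≢0))) (-‿inverseʳ (1# + v)))
                                                          (trans (cong (λ w → v + - w) (ratio-* u≢0)) (-‿inverseʳ v)) ⟩
    0# + 0#                                  ≡⟨ +-identityˡ 0# ⟩
    0#                                       ∎))))
    where
    open ≡-Reasoning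
    α = ratio v u

  -- u is determined by α = v / u and β = (1 + v) / (1 + u), because (α - β) u = β - 1.
  code-equation : ∀ {u v α β} → u ≢ 0# → 1# + u ≢ 0# → code (u , v) ≡ (α , β) → (α + - β) * u ≡ β + - 1#
  code-equation {u} {v} {α} {β} u≢0 1+u≢0 refl = trans
    (solve 3 (λ a b u → (a :+ (:- b)) :* u := (a :* u :+ (:- (b :* (con (1 , 0) :+ u)))) :+ b) refl α β u)
    (trans (cong₂ (λ x y → (x + - y) + β) (ratio-* u≢0) (ratio-* 1+u≢0))
      (solve 2 (λ v b → (v :+ (:- (con (1 , 0) :+ v))) :+ b := b :+ (:- con (1 , 0))) refl v β))

  code-injective : ∀ {u v u′ v′} → u ≢ 0# → 1# + u ≢ 0# → u ≢ v → u′ ≢ 0# → 1# + u′ ≢ 0# →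
    code (u , v) ≡ code (u′ , v′) → (u , v) ≡ (u′ , v′)
  code-injective {u} {v} {u′} {v′} u≢0 1+u≢0 u≢v u′≢0 1+u′≢0 e = cong₂ _,_ u≡u′
    (trans (sym (ratio-* u≢0)) (trans (cong₂ _*_ (cong proj₁ e) u≡u′) (ratio-* u′≢0)))
    where
    u≡u′ : u ≡ u′
    u≡u′ = *-cancelˡ (difference-≢0 (code-distinct u≢0 1+u≢0 u≢v))
      (trans (code-equation u≢0 1+u≢0 refl) (sym (code-equation u′≢0 1+u′≢0 (sym e))))

  6n≡12m+6 : 6 ℕ.* n ≡ 12 ℕ.* m ℕ.+ 6
  6n≡12m+6 = trans (cong (6 ℕ.*_) n≡2m+1) (arithmetic m)
    where
    arithmetic : ∀ m → 6 ℕ.* (2 ℕ.* m ℕ.+ 1) ≡ 12 ℕ.* m ℕ.+ 6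
    arithmetic = solve-∀

  q≡36m+19 : q ≡ 36 ℕ.* m ℕ.+ 19
  q≡36m+19 = trans q≡18n+1 (trans (cong (λ k → 18 ℕ.* k ℕ.+ 1) n≡2m+1) (arithmetic m))
    where
    arithmetic : ∀ m → 18 ℕ.* (2 ℕ.* m ℕ.+ 1) ℕ.+ 1 ≡ 36 ℕ.* m ℕ.+ 19
    arithmetic = solve-∀

  IsRatio : Carrier → Set
  IsRatio α = χ α ≡ 1# × α ≢ 1#

  ratio? : Decidable IsRatio
  ratio? α = (χ α ≟ 1#) ×-dec ¬? (α ≟ 1#)

  ratios : List Carrier
  ratios = filter ratio? elements

  ratios! : Unique ratios
  ratios! = Unique.filter⁺ ratio? elements!

  ∈-ratios⁻ : ∀ {α} → α ∈ ratios → IsRatio α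
  ∈-ratios⁻ α∈ = proj₂ (∈-filter⁻ ratio? {xs = elements} α∈)

  others : Carrier → List Carrier
  others α = filter (λ β → ¬? (β ≟ α)) ratios

  ∈-others⁻ : ∀ {α β} → β ∈ others α → β ∈ ratios × β ≢ α
  ∈-others⁻ {α} = ∈-filter⁻ (λ β → ¬? (β ≟ α)) {xs = ratios}

  χ1 : χ 1# ≡ 1#
  χ1 = 1^ (6 ℕ.* n)

  -- Together with 1, the ratios are roots of `x ^ (6 n) ≡ 1`, so there are at most `6 n - 1` of
  -- them; for `others α` both 1 and `α` are set aside.
  length-ratios : length ratios ≤ 12 ℕ.* m ℕ.+ 5
  length-ratios = ℕ.s≤s⁻¹ (subst (suc (length ratios) ≤_) (trans 6n≡12m+6 (ℕ.+-suc (12 ℕ.* m) 5))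
    (length-power-roots-≤ (6 ℕ.* n) 1# 0<6n
      (All.tabulate (λ α∈ e → proj₂ (∈-ratios⁻ α∈) (sym e)) ∷ ratios!)
      (χ1 ∷ All.tabulate (λ α∈ → proj₁ (∈-ratios⁻ α∈)))))

  length-others : ∀ {α} → α ∈ ratios → length (others α) ≤ 12 ℕ.* m ℕ.+ 4
  length-others {α} α∈ = ℕ.s≤s⁻¹ (ℕ.s≤s⁻¹ (subst (2 ℕ.+ length (others α) ≤_)
    (trans 6n≡12m+6 (trans (ℕ.+-suc (12 ℕ.* m) 5) (cong suc (ℕ.+-suc (12 ℕ.* m) 4))))
    (length-power-roots-≤ (6 ℕ.* n) 1# 0<6n
      (((λ e → proj₂ (∈-ratios⁻ α∈) (sym e)) ∷ All.tabulate (λ β∈ e → proj₂ (∈-ratios⁻ (proj₁ (∈-others⁻ β∈))) (sym e))) ∷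
        All.tabulate (λ β∈ e → proj₂ (∈-others⁻ β∈) (sym e)) ∷
        Unique.filter⁺ (λ β → ¬? (β ≟ α)) ratios!)
      (χ1 ∷ proj₁ (∈-ratios⁻ α∈) ∷ All.tabulate (λ β∈ → proj₁ (∈-ratios⁻ (proj₁ (∈-others⁻ β∈))))))))

  codes : List (Carrier × Carrier)
  codes = concatMap (λ α → map (α ,_) (others α)) ratios

  length-codes : length codes ≤ (12 ℕ.* m ℕ.+ 5) ℕ.* (12 ℕ.* m ℕ.+ 4)
  length-codes = ℕ.≤-trans
    (length-concatMap-≤ (λ α → map (α ,_) (others α)) (12 ℕ.* m ℕ.+ 4) ratios
      (λ {α} α∈ → ℕ.≤-trans (ℕ.≤-reflexive (length-map (α ,_) (others α))) (length-others α∈)))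
    (ℕ.*-monoˡ-≤ (12 ℕ.* m ℕ.+ 4) length-ratios)

  ∈-codes : ∀ {α β} → IsRatio α → IsRatio β → α ≢ β → (α , β) ∈ codes
  ∈-codes {α} {β} α-ratio β-ratio α≢β = ∈-concatMap-intro (λ α → map (α ,_) (others α))
    (∈-filter⁺ ratio? (∈-elements α) α-ratio)
    (∈-map⁺ (α ,_) (∈-filter⁺ (λ β → ¬? (β ≟ α)) (∈-filter⁺ ratio? (∈-elements β) β-ratio) (λ e → α≢β (sym e))))

  -- Its length is the sum of the squares of the cell sizes. The diagonal has at most `q` pairs;
  -- `code` embeds the rest into the pairs of different nontrivial cubes.
  cellmates : List (Carrier × Carrier)
  cellmates = concatMap (λ k → cartesianProduct (cell k) (cell k)) keys

  cellmates! : Unique cellmates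
  cellmates! = unique-concatMap (λ k → cartesianProduct (cell k) (cell k)) (λ p → key (proj₁ p))
    (λ {k} _ p∈ → proj₂ (∈-cell⁻ (proj₁ (∈-cartesianProduct⁻ (cell k) (cell k) p∈))))
    (λ {k} _ → Unique.cartesianProduct⁺ (cell! k) (cell! k)) keys!

  ∈-cellmates⁻ : ∀ {u v} → (u , v) ∈ cellmates → (u ≢ 0# × 1# + u ≢ 0#) × key v ≡ key u
  ∈-cellmates⁻ p∈ =
    let k , _ , p∈k = ∈-concatMap-elim (λ k → cartesianProduct (cell k) (cell k)) keys p∈
        u∈ , v∈ = ∈-cartesianProduct⁻ (cell k) (cell k) p∈k
        nonzero , u-key = ∈-cell⁻ u∈
    in nonzero , trans (proj₂ (∈-cell⁻ v∈)) (sym u-key)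

  equal? : Decidable (λ (p : Carrier × Carrier) → proj₁ p ≡ proj₂ p)
  equal? p = proj₁ p ≟ proj₂ p

  length-diagonal : length (filter equal? cellmates) ≤ q
  length-diagonal = subst (length (filter equal? cellmates) ≤_) length-elements
    (ℕ.≤-trans (ℕ.≤-reflexive (sym (length-map proj₁ (filter equal? cellmates))))
      (unique-⊆-length
        (unique-map (λ {p} {r} p∈ r∈ e → cong₂ _,_ e
            (trans (sym (diagonal p∈)) (trans e (diagonal r∈))))
          (Unique.filter⁺ equal? cellmates!))
        (λ _ → ∈-elements _)))
    where
    diagonal : ∀ {p} → p ∈ filter equal? cellmates → proj₁ p ≡ proj₂ p
    diagonal p∈ = proj₂ (∈-filter⁻ equal? {xs = cellmates} p∈)

  unequal? : Decidable (λ (p : Carrier × Carrier) → proj₁ p ≢ proj₂ p)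
  unequal? p = ¬? (equal? p)

  length-off-diagonal : length (filter unequal? cellmates) ≤ (12 ℕ.* m ℕ.+ 5) ℕ.* (12 ℕ.* m ℕ.+ 4)
  length-off-diagonal = ℕ.≤-trans (ℕ.≤-reflexive (sym (length-map code (filter unequal? cellmates))))
    (ℕ.≤-trans (unique-⊆-length codes! codes⊆) length-codes)
    where
    open-pair : ∀ {p} → p ∈ filter unequal? cellmates → p ∈ cellmates × proj₁ p ≢ proj₂ p
    open-pair p∈ = ∈-filter⁻ unequal? {xs = cellmates} p∈
    codes! : Unique (map code (filter unequal? cellmates))
    codes! = unique-map
      (λ p∈ r∈ e →
        let p∈′ , u≢v = open-pair p∈
            (u≢0 , 1+u≢0) , _ = ∈-cellmates⁻ p∈′
            (u′≢0 , 1+u′≢0) , _ = ∈-cellmates⁻ (proj₁ (open-pair r∈))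
        in code-injective u≢0 1+u≢0 u≢v u′≢0 1+u′≢0 e)
      (Unique.filter⁺ unequal? cellmates!)
    code-∈ : ∀ {p} → p ∈ filter unequal? cellmates → code p ∈ codes
    code-∈ p∈ =
      let p∈′ , u≢v = open-pair p∈
          (u≢0 , 1+u≢0) , same = ∈-cellmates⁻ p∈′
      in ∈-codes (χ-ratio u≢0 (cong proj₁ same) , λ e → u≢v (sym (ratio-≡1 u≢0 e)))
           (χ-ratio 1+u≢0 (cong proj₂ same) , λ e → u≢v (sym (1+-cancel (ratio-≡1 1+u≢0 e))))
           (code-distinct u≢0 1+u≢0 u≢v)
    codes⊆ : ∀ {c} → c ∈ map code (filter unequal? cellmates) → c ∈ codes
    codes⊆ c∈ = let p , p∈ , c≡ = ∈-map⁻ code c∈ in subst (_∈ codes) (sym c≡) (code-∈ p∈)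

  size : Key → ℕ
  size k = length (cell k)

  sum-squares-sizes : sum (map (λ x → x ℕ.* x) (map size goodKeys)) ℕ.+ sum (map (λ x → x ℕ.* x) (map size badKeys))
    ≤ 36 ℕ.* m ℕ.+ 19 ℕ.+ (12 ℕ.* m ℕ.+ 5) ℕ.* (12 ℕ.* m ℕ.+ 4)
  sum-squares-sizes = begin
    sum (map sq (map size goodKeys)) ℕ.+ sum (map sq (map size badKeys))
      ≡⟨ sum-++ (map sq (map size goodKeys)) (map sq (map size badKeys)) ⟨
    sum (map sq (map size keys))
      ≡⟨ cong sum (trans (sym (map-∘ {g = sq} {f = size} keys)) (map-cong (λ k → sym (length-cartesianProduct (cell k) (cell k))) keys)) ⟩
    sum (map (λ k → length (cartesianProduct (cell k) (cell k))) keys)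
      ≡⟨ length-concatMap (λ k → cartesianProduct (cell k) (cell k)) keys ⟨
    length cellmates
      ≡⟨ length-filter-¬ equal? cellmates ⟩
    length (filter equal? cellmates) ℕ.+ length (filter unequal? cellmates)
      ≤⟨ ℕ.+-mono-≤ (ℕ.≤-trans length-diagonal (ℕ.≤-reflexive q≡36m+19)) length-off-diagonal ⟩
    36 ℕ.* m ℕ.+ 19 ℕ.+ (12 ℕ.* m ℕ.+ 5) ℕ.* (12 ℕ.* m ℕ.+ 4) ∎
    where
    open ℕ.≤-Reasoning
    sq : ℕ → ℕ
    sq x = x ℕ.* x

  -- Only 0 and -1 lie in no cell, so the cells together hold at least `q - 2` elements.
  sum-sizes : 36 ℕ.* m ℕ.+ 17 ≤ sum (map size goodKeys) ℕ.+ sum (map size badKeys)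
  sum-sizes = ℕ.+-cancelˡ-≤ 2 _ _ (begin
    2 ℕ.+ (36 ℕ.* m ℕ.+ 17)            ≡⟨ arithmetic m ⟩
    36 ℕ.* m ℕ.+ 19                    ≡⟨ trans length-elements q≡36m+19 ⟨
    length elements                    ≤⟨ unique-⊆-length elements! elements⊆ ⟩
    2 ℕ.+ length admissible            ≤⟨ ℕ.+-monoʳ-≤ 2 (unique-⊆-length admissible! admissible⊆) ⟩
    2 ℕ.+ length (concatMap cell keys) ≡⟨ cong (2 ℕ.+_) (trans (length-concatMap cell keys) (sum-++ (map size goodKeys) (map size badKeys))) ⟩
    2 ℕ.+ (sum (map size goodKeys) ℕ.+ sum (map size badKeys)) ∎)
    where
    open ℕ.≤-Reasoning
    arithmetic : ∀ m → 2 ℕ.+ (36 ℕ.* m ℕ.+ 17) ≡ 36 ℕ.* m ℕ.+ 19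
    arithmetic = solve-∀
    elements⊆ : ∀ {x} → x ∈ elements → x ∈ 0# ∷ - 1# ∷ admissible
    elements⊆ {x} _ = cases (x ≟ 0#) ((1# + x) ≟ 0#)
      where
      cases : Dec (x ≡ 0#) → Dec (1# + x ≡ 0#) → x ∈ 0# ∷ - 1# ∷ admissible
      cases (yes e) _ = here e
      cases (no _) (yes e) = there (here (1+-cancel (trans e (sym (-‿inverseʳ 1#)))))
      cases (no x≢0) (no 1+x≢0) = there (there (∈-filter⁺ (λ x → ¬? (x ≟ 0#) ×-dec ¬? ((1# + x) ≟ 0#)) (∈-elements x) (x≢0 , 1+x≢0)))
    admissible⊆ : ∀ {x} → x ∈ admissible → x ∈ concatMap cell keys
    admissible⊆ x∈ = let x≢0 , 1+x≢0 = ∈-admissible⁻ x∈ in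
      ∈-concatMap-intro cell (keys-complete (ζ-exhausted (χ-cube x≢0)) (ζ-exhausted (χ-cube 1+x≢0))) (∈-cell⁺ x∈)

  candidates : List Carrier
  candidates = concatMap cell goodKeys

  candidates! : Unique candidates
  candidates! = unique-concatMap cell key (λ _ x∈ → proj₂ (∈-cell⁻ x∈)) (λ {k} _ → cell! k)
    (((λ e → ε²≢ε (sym (cong proj₁ e))) ∷ []) ∷ [] ∷ [])

  candidate-separating : ∀ {x} → x ∈ candidates → Separating x
  candidate-separating x∈ = let k , k∈ , x∈k = ∈-concatMap-elim cell goodKeys x∈
                                (x≢0 , 1+x≢0) , x-key = ∈-cell⁻ x∈k
    in separating x≢0 1+x≢0 k∈ x-key
    where
    separating : ∀ {x k} → x ≢ 0# → 1# + x ≢ 0# → k ∈ goodKeys → key x ≡ k → Separating x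
    separating x≢0 1+x≢0 (here refl) e = record
      { χx≢1 = λ r → ε≢1 (trans (sym (cong proj₁ e)) r)
      ; χ[1+x]≢1 = λ r → ε²≢1 (trans (sym (cong proj₂ e)) r)
      ; χx≢χ[1+x] = λ r → ε²≢ε (trans (sym (cong proj₂ e)) (trans (sym r) (cong proj₁ e)))
      ; x≢0 = x≢0 ; 1+x≢0 = 1+x≢0 }
    separating x≢0 1+x≢0 (there (here refl)) e = record
      { χx≢1 = λ r → ε²≢1 (trans (sym (cong proj₁ e)) r)
      ; χ[1+x]≢1 = λ r → ε≢1 (trans (sym (cong proj₂ e)) r)
      ; χx≢χ[1+x] = λ r → ε²≢ε (trans (sym (cong proj₁ e)) (trans r (cong proj₂ e)))
      ; x≢0 = x≢0 ; 1+x≢0 = 1+x≢0 }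

  few-candidates⇒⊥ : sum (map size goodKeys) ≤ 6 ℕ.* m → ⊥
  few-candidates⇒⊥ few = cells-contradiction m (sum (map size goodKeys)) (sum (map size badKeys))
    (sum (map (λ x → x ℕ.* x) (map size goodKeys))) (sum (map (λ x → x ℕ.* x) (map size badKeys))) few
    sum-sizes sum-squares-sizes
    (sum-squares-tangent (3 ℕ.* m) (map size goodKeys)) (sum-squares-tangent (4 ℕ.* m ℕ.+ 2) (map size badKeys))

  -- If every `mobius x` were a sixth power, these values and the three cube roots of unity, which
  -- they avoid, would be distinct roots of `t ^ (3 n) ≡ 1`. That leaves at most `3 n - 3`, which is
  -- `6 m`.
  few-candidates : (∀ {x} → x ∈ candidates → θ (mobius x) ≡ 1#) → sum (map size goodKeys) ≤ 6 ℕ.* m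
  few-candidates trivial = ℕ.+-cancelˡ-≤ 3 _ _ (begin
    3 ℕ.+ sum (map size goodKeys)        ≡⟨ cong (3 ℕ.+_) (trans (length-map mobius candidates) (length-concatMap cell goodKeys)) ⟨
    length (ζs ++ map mobius candidates) ≤⟨ length-power-roots-≤ (3 ℕ.* n) 1# 0<3n roots! (All.++⁺ (θ-ζ zero ∷ θ-ζ 1₃ ∷ θ-ζ 2₃ ∷ [])
                                              (All.map⁺ (All.tabulate trivial))) ⟩
    3 ℕ.* n                              ≡⟨ trans (cong (3 ℕ.*_) n≡2m+1) (arithmetic m) ⟩
    3 ℕ.+ 6 ℕ.* m                        ∎)
    where
    open ℕ.≤-Reasoning
    arithmetic : ∀ m → 3 ℕ.* (2 ℕ.* m ℕ.+ 1) ≡ 3 ℕ.+ 6 ℕ.* m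
    arithmetic = solve-∀
    disjoint : ∀ {z} → z ∈ ζs × z ∈ map mobius candidates → ⊥
    disjoint (z∈ζs , z∈) = let x , x∈ , z≡ = ∈-map⁻ mobius z∈
                               avoid = λ i e → mobius≢ζ (candidate-separating x∈) i (trans (sym z≡) e)
      in [ avoid zero , [ avoid 1₃ , avoid 2₃ ]′ ]′ (∈-ζs z∈ζs)
    roots! : Unique (ζs ++ map mobius candidates)
    roots! = Unique.++⁺ ζs! (unique-map (λ x∈ x′∈ → mobius-injective (candidate-separating x∈) (candidate-separating x′∈)) candidates!) disjoint

  good-exists : ∃[ y ] (Good y)
  good-exists = search (Any.any? (λ x → ¬? (θ (mobius x) ≟ 1#)) candidates)
    where
    search : Dec (Any.Any (λ x → θ (mobius x) ≢ 1#) candidates) → ∃[ y ] (Good y)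
    search (yes found) = let x , x∈ , θ≢1 = find found in mobius x , mobius-good (candidate-separating x∈) θ≢1
    search (no none) = ⊥-elim (few-candidates⇒⊥ (few-candidates (λ {x} x∈ →
      decidable-stable (θ (mobius x) ≟ 1#) (All.lookup (All.¬Any⇒All¬ candidates none) x∈))))

open import Data.Nat using (_+_; _*_)

theorem6p2 : (n : ℕ) → (q : ℕ) → q ≡ 18 * n + 1 → IsPrimePower q →
    (∃[ m ] (n ≡ 2 * m + 1)) → (F : FiniteField q) →
    let open Group3 F in
    ∃[ P ] (IsPDF P (replicate (12 * n + 1) 3 ++ replicate (3 * n) 6) 3 × IsHSBase P)
theorem6p2 n q q≡18n+1 _ (m , n≡2m+1) F = good⇒starter (proj₂ good-exists)
  where
  cube-root = CubeRoot.nontrivial-cube-root F n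
    (subst (0 ℕ.<_) (sym (trans n≡2m+1 (ℕ.+-comm (2 ℕ.* m) 1))) (s≤s z≤n)) q≡18n+1
  ε = proj₁ cube-root
  ε≢1 = proj₁ (proj₂ cube-root)
  ε³≡1 = proj₂ (proj₂ cube-root)
  open Existence F n m n≡2m+1 q≡18n+1 ε ε≢1 ε³≡1
  open Construction F n m n≡2m+1 q≡18n+1 ε ε≢1 ε³≡1
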